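{- For $n\ge 1$ let $C_n(q,t)=\sum_D q^{\mathrm{area}(D)}t^{\mathrm{dinv}(D)}$, where $D$ ranges over Dyck sequences of length $n$. Then \[ C_n(q,t)=\sum_{(F,P)} q^{\mathrm{area}(F:\mathrm{RR}(P))}\,t^{\mathrm{dinv}(F:\mathrm{RR}(P))-|P|}\,s_{\lambda(P)'}(q,t). \] The sum is over all pairs $(F,P)$ such that $F$ is a Dyck $m$-skeleton for some $m\ge 0$, $P$ is an at-most-two-column Dyck tableau with entries in $[0,m-1]$, and $|F|+|\mathrm{RR}(P)|=n$. Here $\lambda(P)$ is the shape of $P$, $\lambda(P)'$ is its conjugate partition, and $s_{\lambda(P)'}(q,t)$ is the Schur function in the two variables $q,t$.
   Context: Sequences are finite integer sequences indexed from $0$, possibly empty; $|x|$ is the length of a sequence $x$; $A:B$ denotes concatenation. For $x=(x_0,\ldots,x_{r-1})$: $\mathrm{di}(x)=\#\{i<j: x_i=x_j+1\}$, $\mathrm{nv}(x)=\#\{i<j:x_i=x_j\}$, $\mathrm{dinv}(x)=\mathrm{di}(x)+\mathrm{nv}(x)$, and $\mathrm{area}(x)=\sum_i x_i$. A Dyck sequence is a nonempty sequence with $x_0=0$, all entries nonnegative, and $x_{i+1}\le x_i+1$ for all $i$. In a Dyck sequence $C=(c_0,\ldots,c_{r-1})$, an index $j$ is eligible if (i) there is exactly one index $i<j$ with $c_i=c_j-1$, and (ii) if $j+1<r$ then $c_{j+1}\le c_j$. For $m\ge0$, a Dyck sequence $F$ of length $r$ is a Dyck $m$-skeleton if $\max(F)=m$,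 the last entry of $F$ equals $m$, and $F$ has no eligible index $j<r-1$ (no "nonfinal extractable element"; the last index may be eligible). A Dyck tableau is a left-aligned tableau with rows $T_0,\ldots,T_{\ell-1}$ from top to bottom (nonempty rows; the empty tableau is allowed), with weakly decreasing row lengths $|T_0|\ge\cdots\ge|T_{\ell-1}|$, such that each row $T=(T[0],T[1],\ldots)$ satisfies $T[p+1]\ge T[p]+2$, and whenever adjacent rows $T_j,T_{j+1}$ both have an entry in column $p$, $T_j[p]\le T_{j+1}[p]+1$. $\mathrm{RR}(P)=T_{\ell-1}T_{\ell-2}\cdots T_0$ (rows read left to right, bottom row first), $\lambda(P)$ is the partition of row lengths, and $|P|$ is the number of cells. If $m=0$ the interval $[0,m-1]$ is empty, so $P$ must be empty. -}

module Defs where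

open import Algebra.Bundles using (CommutativeRing)
open import Data.Fin.Base using (Fin; toℕ) renaming (zero to 0F; suc to sucF; _<_ to _<ᶠ_)
import Data.Fin.Properties as Fin
open import Data.List.Base using (List; []; _∷_; [_]; _++_; _∷ʳ_; length; map; filter; concat; reverse; lookup; zip; upTo; allFin; head; last; cartesianProductWith; cartesianProduct; foldr)
open import Data.List.Extrema.Nat using (max; max≤v⁺)
open import Data.List.Membership.Propositional using (_∈_)
open import Data.List.Membership.Propositional.Properties using (∈-filter⁺; ∈-filter⁻; ∈-cartesianProductWith⁺; ∈-cartesianProductWith⁻; ∈-cartesianProduct⁺; ∈-upTo⁺; ∈-allFin; ∈-++⁺ˡ)
open import Data.List.Properties using (length-++; length-map; unfold-reverse; concat-++; concat-[_]; filter-++; filter-some; ++-identityʳ; ∷ʳ-++; ∷-injective; ≡-dec)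
open import Data.List.Relation.Unary.All as All using (All; []; _∷_)
open import Data.List.Relation.Unary.All.Properties using () renaming (concat⁺ to All-concat⁺)
open import Data.List.Relation.Unary.Any using (here; there)
open import Data.List.Relation.Unary.Any.Properties using () renaming (reverse⁻ to ∈-reverse⁻)
import Data.List.Relation.Unary.AllPairs as AllPairs
open import Data.List.Relation.Unary.Linked as Linked using (Linked; []; [-]; _∷_; linked?)
open import Data.List.Relation.Unary.Unique.Propositional using (Unique)
open import Data.List.Relation.Unary.Unique.Propositional.Properties using (filter⁺; cartesianProductWith⁺; cartesianProduct⁺; upTo⁺; allFin⁺)
import Data.Maybe.Properties as Maybe
open import Data.Maybe.Base using (just)
open import Data.Nat.Base using (ℕ; zero; suc; _+_; _≤_; _<_; _≥_; z≤n; s≤s)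
open import Data.Nat.ListAction using (sum)
open import Data.Nat.Properties using (_≟_; _≤?_; _<?_; ≤-refl; ≤-trans; ≤-reflexive; <-≤-trans; +-mono-≤; +-monoˡ-≤; +-monoʳ-≤; ≤-antisym; ≤∧≢⇒<; <⇒≤; +-comm; m≤m+n; m≤n+m; m≤n⇒m≤1+n; +-suc; +-assoc; module ≤-Reasoning)
open import Data.Product using (∃!; _×_; _,_; proj₁; proj₂; uncurry)
open import Function.Base using (_∘_)
open import Level using (Level; 0ℓ) renaming (_⊔_ to _⊔ˡ_)
open import Relation.Binary.Core using (Rel)
open import Relation.Binary.Definitions using () renaming (Decidable to Decidable₂)
open import Relation.Binary.PropositionalEquality using (_≡_; refl; sym; subst)
open import Relation.Nullary using (Dec; yes; no; ¬_; contradiction)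
open import Relation.Nullary.Decidable using (map′; _×-dec_; _→-dec_; ¬?)
open import Relation.Unary using (Pred; Decidable)

private
  variable
    a p ℓ : Level
    A : Set a

------------------------------------------------------------------------
-- Statistics on sequences

-- Every sequence entering the identity has nonnegative entries, so
-- sequences are lists of naturals.
Seq : Set
Seq = List ℕ

di : Seq → ℕ
di []       = 0
di (x ∷ xs) = length (filter (λ y → x ≟ suc y) xs) + di xs

nv : Seq → ℕ
nv []       = 0
nv (x ∷ xs) = length (filter (λ y → x ≟ y) xs) + nv xs

dinv : Seq → ℕ
dinv x = di x + nv x

area : Seq → ℕ
area = sum

------------------------------------------------------------------------
-- Dyck sequences and skeletons

record IsDyck (x : Seq) : Set where
  field
    starts-at-0 : head x ≡ just 0
    steps       : Linked (λ u v → v ≤ u + 1) x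

record Eligible (c : Seq) (j : Fin (length c)) : Set where
  field
    one-before : ∃! _≡_ λ i → i <ᶠ j × lookup c i + 1 ≡ lookup c j
    next-≤     : ∀ k → toℕ k ≡ toℕ j + 1 → lookup c k ≤ lookup c j

-- max 0 F is the largest entry of F, as F is nonempty.
record IsSkeleton (m : ℕ) (F : Seq) : Set where
  field
    isDyck      : IsDyck F
    max≡m       : max 0 F ≡ m
    last≡m      : last F ≡ just m
    no-eligible : ∀ j → toℕ j + 1 < length F → ¬ Eligible F j

------------------------------------------------------------------------
-- Tableaux

-- A tableau is the list of its rows, from top to bottom.
Tableau : Set a → Set a
Tableau A = List (List A)

shape : Tableau A → List ℕ
shape = map length

cells : Tableau A → ℕ
cells T = sum (shape T)

-- R relates each entry of the upper row to the entry of the lower row in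
-- the same column; zip stops at the end of the shorter row.
Columnwise : Rel A ℓ → Rel (List A) _
Columnwise R upper lower = All (uncurry R) (zip upper lower)

record IsDyckTableau (P : Tableau ℕ) : Set where
  field
    nonempty-rows : All (λ T → 0 < length T) P
    partition     : Linked _≥_ (shape P)
    rows          : All (Linked (λ u v → v ≥ u + 2)) P
    columns       : Linked (Columnwise (λ u v → u ≤ v + 1)) P

RR : Tableau ℕ → Seq
RR P = concat (reverse P)

-- The j-th part of the conjugate counts the parts exceeding j.
conjugate : List ℕ → List ℕ
conjugate []         = []
conjugate (l ∷ rest) = map (λ j → length (filter (j <?_) (l ∷ rest))) (upTo l)

record IsSSYT (k : ℕ) (μ : List ℕ) (T : Tableau (Fin k)) : Set where
  field
    has-shape : shape T ≡ μ
    rows      : All (Linked (λ u v → toℕ u ≤ toℕ v)) T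
    columns   : Linked (Columnwise (λ u v → toℕ u < toℕ v)) T

------------------------------------------------------------------------
-- The two index sets

DyckOfLength : ℕ → Pred Seq 0ℓ
DyckOfLength n D = IsDyck D × length D ≡ n

record IsIndex (n : ℕ) (FP : Seq × Tableau ℕ) : Set where
  F = proj₁ FP
  P = proj₂ FP
  field
    m           : ℕ
    skeleton    : IsSkeleton m F
    tableau     : IsDyckTableau P
    two-columns : All (λ T → length T ≤ 2) P
    entries     : All (All (_< m)) P
    size        : length F + length (RR P) ≡ n

------------------------------------------------------------------------
-- Finite sets, as duplicate-free exhaustive lists

record Listing {A : Set a} (P : Pred A p) : Set (a ⊔ˡ p) where
  field
    list     : List A
    unique   : Unique list
    sound    : ∀ {x} → x ∈ list → P x
    complete : ∀ {x} → P x → x ∈ list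

open Listing using (list)

listing : {P : Pred A p} → Decidable P → (xs : List A) → Unique xs →
          (∀ {x} → P x → x ∈ xs) → Listing P
listing P? xs uniq enough = record
  { list     = filter P? xs
  ; unique   = filter⁺ P? uniq
  ; sound    = λ x∈ → proj₂ (∈-filter⁻ P? {xs = xs} x∈)
  ; complete = λ Px → ∈-filter⁺ P? (enough Px) Px
  }

-- All words of length at most n.
words : List A → ℕ → List (List A)
words xs zero    = [ [] ]
words xs (suc n) = [] ∷ cartesianProductWith _∷_ xs (words xs n)

words-unique : {xs : List A} → Unique xs → ∀ n → Unique (words xs n)
words-unique u zero    = [] AllPairs.∷ AllPairs.[]
words-unique {xs = xs} u (suc n) =
  All.tabulate nonempty
  AllPairs.∷ cartesianProductWith⁺ _∷_ ∷-injective u (words-unique u n)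
  where
  nonempty : ∀ {w} → w ∈ cartesianProductWith _∷_ xs (words xs n) → ¬ ([] ≡ w)
  nonempty w∈ refl with ∈-cartesianProductWith⁻ _∷_ xs (words xs n) w∈
  ... | _ , _ , _ , _ , ()

∈-words : {xs : List A} {w : List A} → ∀ n → length w ≤ n →
          All (_∈ xs) w → w ∈ words xs n
∈-words zero    z≤n       []           = here refl
∈-words (suc n) _         []           = here refl
∈-words (suc n) (s≤s w≤n) (x∈ ∷ all∈) =
  there (∈-cartesianProductWith⁺ _∷_ x∈ (∈-words n w≤n all∈))

------------------------------------------------------------------------
-- Decidability

∃!? : ∀ {n} {P : Pred (Fin n) p} → Decidable P → Dec (∃! _≡_ P)
∃!? P? = map′
  (λ (x , Px , h) → x , Px , λ {y} → h y)
  (λ (x , Px , h) → x , Px , λ y → h {y})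
  (Fin.any? λ x → P? x ×-dec Fin.all? λ y → P? y →-dec (x Fin.≟ y))

columnwise? : {R : Rel A ℓ} → Decidable₂ R → Decidable₂ (Columnwise R)
columnwise? R? S T = All.all? (λ (u , v) → R? u v) (zip S T)

isDyck? : Decidable IsDyck
isDyck? x = map′
  (λ (h , s) → record { starts-at-0 = h ; steps = s })
  (λ d → IsDyck.starts-at-0 d , IsDyck.steps d)
  (Maybe.≡-dec _≟_ (head x) (just 0) ×-dec linked? (λ u v → v ≤? u + 1) x)

eligible? : ∀ c → Decidable (Eligible c)
eligible? c j = map′
  (λ (o , n) → record { one-before = o ; next-≤ = n })
  (λ e → Eligible.one-before e , Eligible.next-≤ e)
  (∃!? (λ i → (i Fin.<? j) ×-dec (lookup c i + 1 ≟ lookup c j))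
   ×-dec Fin.all? λ k → (toℕ k ≟ toℕ j + 1) →-dec (lookup c k ≤? lookup c j))

isSkeleton? : ∀ m → Decidable (IsSkeleton m)
isSkeleton? m F = map′
  (λ (d , x , l , e) → record { isDyck = d ; max≡m = x ; last≡m = l ; no-eligible = e })
  (λ s → let open IsSkeleton s in isDyck , max≡m , last≡m , no-eligible)
  (isDyck? F ×-dec (max 0 F ≟ m) ×-dec Maybe.≡-dec _≟_ (last F) (just m)
   ×-dec Fin.all? λ j → (toℕ j + 1 <? length F) →-dec ¬? (eligible? F j))

isDyckTableau? : Decidable IsDyckTableau
isDyckTableau? P = map′
  (λ (n , s , r , c) → record { nonempty-rows = n ; partition = s ; rows = r ; columns = c })
  (λ t → let open IsDyckTableau t in nonempty-rows , partition , rows , columns)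
  (All.all? (λ T → 0 <? length T) P
   ×-dec linked? (λ u v → v ≤? u) (shape P)
   ×-dec All.all? (linked? λ u v → u + 2 ≤? v) P
   ×-dec linked? (columnwise? λ u v → u ≤? v + 1) P)

isSSYT? : ∀ k μ → Decidable (IsSSYT k μ)
isSSYT? k μ T = map′
  (λ (s , r , c) → record { has-shape = s ; rows = r ; columns = c })
  (λ t → let open IsSSYT t in has-shape , rows , columns)
  (≡-dec _≟_ (shape T) μ
   ×-dec All.all? (linked? λ u v → toℕ u ≤? toℕ v) T
   ×-dec linked? (columnwise? λ u v → toℕ u <? toℕ v) T)

isIndex? : ∀ n → Decidable (IsIndex n)
isIndex? n (F , P) = map′
  (λ (s , t , c , e , z) → record
    { m = max 0 F ; skeleton = s ; tableau = t ; two-columns = c ; entries = e ; size = z })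
  split
  (isSkeleton? (max 0 F) F ×-dec isDyckTableau? P
   ×-dec All.all? (λ T → length T ≤? 2) P
   ×-dec All.all? (All.all? (_<? max 0 F)) P
   ×-dec (length F + length (RR P) ≟ n))
  where
  split : IsIndex n (F , P) → _
  split record { m = m ; skeleton = s ; tableau = t ; two-columns = c ; entries = e ; size = z }
    with refl ← IsSkeleton.max≡m s = s , t , c , e , z

------------------------------------------------------------------------
-- Bounds

steps-bound : ∀ {x xs} → Linked (λ u v → v ≤ u + 1) (x ∷ xs) →
              All (_≤ x + length xs) (x ∷ xs)
steps-bound {x} [-] = m≤m+n x 0 ∷ []
steps-bound {x} {y ∷ xs} (y≤ ∷ l) =
  m≤m+n x _ ∷ All.map (λ z≤ → ≤-trans z≤ le) (steps-bound l)
  where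
  le : y + length xs ≤ x + suc (length xs)
  le = ≤-trans (+-monoˡ-≤ (length xs) y≤) (≤-reflexive (+-assoc x 1 _))

dyck-bound : ∀ {x} → IsDyck x → All (_< length x) x
dyck-bound {0 ∷ xs} record { starts-at-0 = refl ; steps = s } =
  All.map s≤s (steps-bound s)

length≤cells : {P : Tableau A} → All (λ T → 0 < length T) P → length P ≤ cells P
length≤cells []       = z≤n
length≤cells (h ∷ hs) = +-mono-≤ h (length≤cells hs)

row≤cells : (P : Tableau A) → All (λ T → length T ≤ cells P) P
row≤cells []      = []
row≤cells (T ∷ P) =
  m≤m+n _ _ ∷ All.map (λ h → ≤-trans h (m≤n+m _ (length T))) (row≤cells P)

length-RR : ∀ P → length (RR P) ≡ cells P
length-RR []      = refl
length-RR (T ∷ P)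
  rewrite unfold-reverse T P
        | sym (concat-++ (reverse P) [ T ])
        | length-++ (concat (reverse P)) {concat [ T ]}
        | concat-[_] T
        | length-RR P
        = +-comm (cells P) (length T)

------------------------------------------------------------------------
-- The exponent dinv (F ++ RR P) ∸ cells P is a true difference

last-∈ : ∀ {m} (F : Seq) → last F ≡ just m → m ∈ F
last-∈ (x ∷ [])     refl = here refl
last-∈ (x ∷ y ∷ F) eq   = there (last-∈ (y ∷ F) eq)

steps-∈ : ∀ {x xs v w} → Linked (λ u v → v ≤ u + 1) (x ∷ xs) →
          x ≤ v → v ≤ w → w ∈ x ∷ xs → v ∈ x ∷ xs
steps-∈ {x} {v = v} l x≤v v≤w w∈ with x ≟ v
... | yes refl = here refl
steps-∈ l x≤v v≤w (here refl) | no x≢v = contradiction (≤-antisym x≤v v≤w) x≢v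
steps-∈ {x} (y≤ ∷ l) x≤v v≤w (there w∈) | no x≢v = there
  (steps-∈ l (≤-trans y≤ (≤-trans (≤-reflexive (+-comm x 1)) (≤∧≢⇒< x≤v x≢v))) v≤w w∈)

skeleton-∈ : ∀ {m F v} → IsSkeleton m F → v < m → v ∈ F
skeleton-∈ {F = x ∷ F} s v<m with refl ← IsDyck.starts-at-0 (IsSkeleton.isDyck s) =
  steps-∈ (IsDyck.steps (IsSkeleton.isDyck s)) z≤n (<⇒≤ v<m)
          (last-∈ _ (IsSkeleton.last≡m s))

nv-∷ʳ : ∀ {y} F → y ∈ F → suc (nv F) ≤ nv (F ∷ʳ y)
nv-∷ʳ {y} (x ∷ F) y∈
  rewrite filter-++ (x ≟_) F [ y ]
        | length-++ (filter (x ≟_) F) {filter (x ≟_) [ y ]} with y∈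
... | here refl = +-monoˡ-≤ (nv F) c ⟫ +-monoʳ-≤ _ (nv-mono F)
  where
  _⟫_ : ∀ {i j k} → i ≤ j → j ≤ k → i ≤ k
  _⟫_ = ≤-trans
  c : suc (length (filter (y ≟_) F)) ≤ length (filter (y ≟_) F) + length (filter (y ≟_) [ y ])
  c = ≤-trans (≤-reflexive (+-comm 1 _))
        (+-monoʳ-≤ (length (filter (y ≟_) F)) (filter-some (y ≟_) (here refl)))
  nv-mono : ∀ G → nv G ≤ nv (G ∷ʳ y)
  nv-mono []      = z≤n
  nv-mono (x ∷ G)
    rewrite filter-++ (x ≟_) G [ y ]
          | length-++ (filter (x ≟_) G) {filter (x ≟_) [ y ]}
    = +-mono-≤ (m≤m+n _ _) (nv-mono G)
... | there y∈F = ≤-trans (≤-reflexive (sym (+-suc _ (nv F))))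
                          (+-mono-≤ (m≤m+n _ _) (nv-∷ʳ F y∈F))

length≤nv : ∀ F w → All (_∈ F) w → length w + nv F ≤ nv (F ++ w)
length≤nv F []      []         rewrite ++-identityʳ F = ≤-refl
length≤nv F (y ∷ w) (y∈ ∷ w⊆) =
  subst (λ G → suc (length w) + nv F ≤ nv G) (∷ʳ-++ F y w)
    (≤-trans (≤-reflexive (sym (+-suc (length w) (nv F))))
      (≤-trans (+-monoʳ-≤ (length w) (nv-∷ʳ F y∈))
        (length≤nv (F ∷ʳ y) w (All.map ∈-++⁺ˡ w⊆))))

cells≤dinv : ∀ {n F P} → IsIndex n (F , P) → cells P ≤ dinv (F ++ RR P)
cells≤dinv {F = F} {P} I = begin
  cells P              ≡⟨ length-RR P ⟨
  length (RR P)        ≤⟨ m≤m+n _ (nv F) ⟩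
  length (RR P) + nv F ≤⟨ length≤nv F (RR P) (All.map (skeleton-∈ skeleton) below) ⟩
  nv (F ++ RR P)       ≤⟨ m≤n+m _ (di (F ++ RR P)) ⟩
  dinv (F ++ RR P)     ∎
  where
  open ≤-Reasoning
  open IsIndex I hiding (F; P)
  below : All (_< m) (RR P)
  below = All-concat⁺ (All.tabulate (All.lookup entries ∘ ∈-reverse⁻))

------------------------------------------------------------------------
-- Listings of the index sets

dycks : ∀ n → Listing (DyckOfLength n)
dycks n = listing (λ D → isDyck? D ×-dec (length D ≟ n)) (words (upTo n) n)
  (words-unique (upTo⁺ n) n)
  λ { (d , refl) → ∈-words n ≤-refl (All.map ∈-upTo⁺ (dyck-bound d)) }

indices : ∀ n → Listing (IsIndex n)
indices n = listing (isIndex? n)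
  (cartesianProduct (words (upTo n) n) (words (words (upTo n) n) n))
  (cartesianProduct⁺ (words-unique (upTo⁺ n) n)
                     (words-unique (words-unique (upTo⁺ n) n) n))
  λ {FP} → enough {FP}
  where
  enough : ∀ {FP} → IsIndex n FP →
           FP ∈ cartesianProduct (words (upTo n) n) (words (words (upTo n) n) n)
  enough {F , P} I = ∈-cartesianProduct⁺
    (∈-words n F≤n (All.map (λ h → ∈-upTo⁺ (<-≤-trans h F≤n)) F<))
    (∈-words n (≤-trans (length≤cells (IsDyckTableau.nonempty-rows tableau)) P≤n)
      (All.zipWith (λ (r≤ , e) → ∈-words n (≤-trans r≤ P≤n)
                                   (All.map (λ h → ∈-upTo⁺ (<-≤-trans h m≤n)) e))
                   (row≤cells P , entries)))
    where
    open IsIndex I hiding (F; P)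
    F< : All (_< length F) F
    F< = dyck-bound (IsSkeleton.isDyck skeleton)
    F≤n : length F ≤ n
    F≤n = ≤-trans (m≤m+n _ _) (≤-reflexive size)
    P≤n : cells P ≤ n
    P≤n = ≤-trans (≤-trans (≤-reflexive (sym (length-RR P))) (m≤n+m _ (length F)))
                  (≤-reflexive size)
    m≤n : m ≤ n
    m≤n = ≤-trans (≤-reflexive (sym (IsSkeleton.max≡m skeleton)))
      (max≤v⁺ {n} {0} {F} z≤n
        (All.map (λ h → ≤-trans (m≤n⇒m≤1+n ≤-refl) (<-≤-trans h F≤n)) F<))

ssyts : ∀ k μ → Listing (IsSSYT k μ)
ssyts k μ = listing (isSSYT? k μ) (words (words (allFin k) (sum μ)) (length μ))
  (words-unique (words-unique (allFin⁺ k) (sum μ)) (length μ))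
  λ {T} t → enough T (IsSSYT.has-shape t)
  where
  enough : ∀ T → shape T ≡ μ → T ∈ words (words (allFin k) (sum μ)) (length μ)
  enough T refl = ∈-words (length μ) (≤-reflexive (sym (length-map length T)))
    (All.map (λ r≤ → ∈-words (sum μ) r≤ (All.universal ∈-allFin _)) (row≤cells T))

------------------------------------------------------------------------
-- Polynomials

-- Polynomial identities are stated as identities between values at
-- arbitrary elements q, t of an arbitrary commutative ring.
module Polynomials {c ℓ} (R : CommutativeRing c ℓ) where

  open CommutativeRing R using (Carrier; _*_; 0#; 1#; semiring) renaming (_+_ to _⊕_)
  open import Algebra.Properties.Semiring.Exp semiring public using (_^_)

  ∑ : {P : Pred A p} → Listing P → (A → Carrier) → Carrier
  ∑ L f = foldr _⊕_ 0# (map f (list L))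

  ∏ : List Carrier → Carrier
  ∏ = foldr _*_ 1#

  -- s_μ(x₀,…,x_{k-1}) as the generating function of semistandard tableaux.
  schur : ∀ {k} → (Fin k → Carrier) → List ℕ → Carrier
  schur {k} x μ = ∑ (ssyts k μ) λ T → ∏ (map x (concat T))

  schur₂ : Carrier → Carrier → List ℕ → Carrier
  schur₂ q t = schur {2} λ { 0F → q ; (sucF 0F) → t }

  C : ℕ → Carrier → Carrier → Carrier
  C n q t = ∑ (dycks n) λ D → q ^ area D * t ^ dinv D

{-# OPTIONS --safe #-}

-- Let ins a G be G with a + 1 inserted right after the first a.  Every Dyck
-- sequence D with maximum m is uniquely ins x₀ (ins x₁ (… F)) ++ y, where F is an
-- m-skeleton and x, y are words in the letters below m whose ascents are at most
-- 1: y is what follows the last m, and x records the eligible letters extracted,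
-- largest first, each lowered by 1.  Then area D = area (F y x) + |x| and
-- dinv D = dinv (F y x) - |x|, so for fixed F the theorem says that pairs (y , x),
-- weighted by q per letter of x and t per letter of y, have the same generating
-- series as two-column tableaux weighted by their Schur functions.
--
-- As dinv only sees how often a + 1 precedes a or a precedes a, words multiply
-- like monomials in a quantum affine space u₀, …, u_{m-1}.  There the column
-- series H (z) is inverse to the signed series E (z) of chains with gaps at least
-- 2, and H (z) E_k (z) sums the columns whose last letter is at least k.  Removing
-- the top row of a tableau gives a recursion, which is solved by
--   H (t) H (q) (q E_s (q) E_r (t) - t E_s (t) E_r (q)) / (q - t)
-- for tableaux whose top row is at least (s , r), because the E_k (z) with the same
-- k commute.  At s = r = 0 this is H (t) H (q), the series of pairs.
module Submission where

open import Defs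
open import Algebra.Bundles using (CommutativeRing)
open import Data.Empty using (⊥)
open import Data.Fin.Base using (Fin; toℕ) renaming (zero to 0F; suc to sucF; _<_ to _<ᶠ_)
open import Data.List.Base using (List; []; _∷_; [_]; _++_; _ʳ++_; map; filter; concat; concatMap; foldr; length; lookup; head; last; replicate; reverse; upTo)
open import Data.List.Extrema.Nat using (max; max≤v⁺; xs≤max; argmax-sel)
open import Data.List.Membership.DecPropositional using (_∈?_)
open import Data.List.Membership.Propositional using (_∈_; lose; find)
open import Data.List.Membership.Propositional.Properties
open import Data.List.Membership.Propositional.Properties.WithK using (unique∧set⇒bag)
open import Data.List.Properties using (∷-injectiveˡ; ∷-injectiveʳ; ++-assoc; ++-identityʳ; ++-cancelˡ; length-++; length-map; length-replicate; length-reverse; map-∘; map-injective; concat-++; concat-[_]; filter-++; filter-≐; filter-all; filter-none; filter-some; filter-accept; filter-reject; unfold-reverse; reverse-++; reverse-involutive; reverse-injective)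
open import Data.List.Relation.Binary.BagAndSetEquality using (∼bag⇒↭)
open import Data.List.Relation.Binary.Permutation.Propositional as Perm using (_↭_)
open import Data.List.Relation.Binary.Permutation.Propositional.Properties using (↭-reverse)
open import Data.List.Relation.Unary.All as All using (All; []; _∷_)
import Data.List.Relation.Unary.All.Properties as All
open import Data.List.Relation.Unary.AllPairs using ([]; _∷_)
open import Data.List.Relation.Unary.Any using (here; there)
open import Data.List.Relation.Unary.Linked as Linked using (Linked; []; [-]; _∷_)
open import Data.List.Relation.Unary.Unique.Propositional using (Unique)
open import Data.List.Relation.Unary.Unique.Propositional.Properties using (map⁺; ++⁺; upTo⁺)
open import Data.Maybe.Base using (just)
open import Data.Maybe.Properties using (just-injective)
open import Data.Nat.Base as ℕ using (ℕ; zero; suc; z≤n; s≤s; _≤_; _<_; _≥_; _∸_)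
open import Data.Nat.ListAction using (sum)
open import Data.Nat.ListAction.Properties using (sum-++; sum-↭)
import Data.Nat.Properties as ℕ
open import Data.Product using (∃; ∃₂; _×_; _,_; proj₁; proj₂)
open import Data.Sum.Base using (_⊎_; inj₁; inj₂)
open import Data.Unit.Base using (⊤; tt)
open import Function.Base using (_∘_; id)
open import Function.Bundles using (mk⇔)
open import Level using () renaming (_⊔_ to _⊔ˡ_)
open import Relation.Binary.Bundles using (Setoid)
open import Relation.Binary.PropositionalEquality as ≡ using (_≡_)
open import Relation.Nullary using (Dec; yes; no; ¬_; contradiction)
open import Relation.Nullary.Decidable using (_×-dec_)

-- The identity is proved for each skeleton `F` separately. Next to `F` a letter `a` only acquires a
-- scalar: `q ^ a` times `t` to the number of entries `a` and `a + 1` of `F`, less one. The less one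
-- absorbs the subtraction of the number of cells. On the Dyck side extraction already accounts for
-- one per letter of `x`, so a surplus of one `t` per letter of `y` remains. The algebra can
-- therefore treat these scalars `κ` and the commutation factor `τ` as arbitrary.
--
-- There are two obstacles: chain series with different flags need not commute, and an arbitrary
-- ring has no division by `q - t`. Hence the series in the second variable never occurs by itself.
-- The series in `y` and the divided difference are given by their own recursions, and every
-- quotient identity is rewritten in these two. The signs are hidden in `x = - z` and `y = - w`, so
-- that the only cancellations are `w + y = 0` and `z + x = 0`.
--
-- In a composite of operators the outermost `u` supplies the last letter of the word, so products
-- appear in reversed order.

module _ where

  open import Data.Nat.Base
  open import Data.Nat.Properties
  open import Data.Nat.Solver using (module +-*-Solver)
  open import Relation.Binary.PropositionalEquality hiding ([_])
  open +-*-Solver using (solve; _:+_; _:=_; con)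

  -- Letter multiplicities and lists of admissible letters

  at : List ℕ → ℕ → ℕ
  at []      _       = 0
  at (n ∷ c) zero    = n
  at (n ∷ c) (suc a) = at c a

  below : List ℕ → ℕ → ℕ
  below c zero    = 0
  below c (suc a) = at c a

  inc : ℕ → List ℕ → List ℕ
  inc zero    []      = 1 ∷ []
  inc zero    (n ∷ c) = suc n ∷ c
  inc (suc a) []      = 0 ∷ inc a []
  inc (suc a) (n ∷ c) = n ∷ inc a c

  inc-comm : ∀ a b c → inc a (inc b c) ≡ inc b (inc a c)
  inc-comm zero    zero    c       = refl
  inc-comm zero    (suc b) []      = refl
  inc-comm zero    (suc b) (n ∷ c) = refl
  inc-comm (suc a) zero    []      = refl
  inc-comm (suc a) zero    (n ∷ c) = refl
  inc-comm (suc a) (suc b) []      = cong (0 ∷_) (inc-comm a b [])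
  inc-comm (suc a) (suc b) (n ∷ c) = cong (n ∷_) (inc-comm a b c)

  at-inc-≡ : ∀ a c → at (inc a c) a ≡ suc (at c a)
  at-inc-≡ zero    []      = refl
  at-inc-≡ zero    (n ∷ c) = refl
  at-inc-≡ (suc a) []      = at-inc-≡ a []
  at-inc-≡ (suc a) (n ∷ c) = at-inc-≡ a c

  at-inc-≢ : ∀ a b c → b ≢ a → at (inc a c) b ≡ at c b
  at-inc-≢ zero    zero    c       b≢a = contradiction refl b≢a
  at-inc-≢ zero    (suc b) []      b≢a = refl
  at-inc-≢ zero    (suc b) (n ∷ c) b≢a = refl
  at-inc-≢ (suc a) zero    []      b≢a = refl
  at-inc-≢ (suc a) zero    (n ∷ c) b≢a = refl
  at-inc-≢ (suc a) (suc b) []      b≢a = at-inc-≢ a b [] (b≢a ∘ cong suc)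
  at-inc-≢ (suc a) (suc b) (n ∷ c) b≢a = at-inc-≢ a b c (b≢a ∘ cong suc)

  below-inc-≤ : ∀ a b c → b ≤ a → below (inc a c) b ≡ below c b
  below-inc-≤ a zero    c _   = refl
  below-inc-≤ a (suc b) c b<a = at-inc-≢ a b c (<⇒≢ b<a)

  from : ℕ → ℕ → List ℕ
  from k zero    = []
  from k (suc d) = k ∷ from (suc k) d

  -- The letters a < m with p ≤ a + 1; p = 0 and p = 1 give the same list.
  letters : ℕ → ℕ → List ℕ
  letters m p = from (p ∸ 1) (m ∸ (p ∸ 1))

  ∈-from⁻ : ∀ {a} k d → a ∈ from k d → k ≤ a × a < k + d
  ∈-from⁻ k (suc d) (here refl) = ≤-refl , m<m+n k z<s
  ∈-from⁻ {a} k (suc d) (there a∈) with k<a , a<d ← ∈-from⁻ (suc k) d a∈ =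
    <⇒≤ k<a , subst (a <_) (sym (+-suc k d)) a<d

  ∈-from⁺ : ∀ {a} k d → k ≤ a → a < k + d → a ∈ from k d
  ∈-from⁺ {a} k zero k≤a a<k = contradiction (subst (a <_) (+-identityʳ k) a<k) (≤⇒≯ k≤a)
  ∈-from⁺ {a} k (suc d) k≤a a<d with k ≟ a
  ... | yes refl = here refl
  ... | no  k≢a    = there (∈-from⁺ (suc k) d (≤∧≢⇒< k≤a k≢a) (subst (a <_) (+-suc k d) a<d))

  ∸1≤⇒≤suc : ∀ {p a} → p ∸ 1 ≤ a → p ≤ suc a
  ∸1≤⇒≤suc {zero}  _ = z≤n
  ∸1≤⇒≤suc {suc p} h = s≤s h

  ∈-letters⁻ : ∀ {a} m p → a ∈ letters m p → p ≤ suc a × a < m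
  ∈-letters⁻ {a} m p a∈ with h , a<d ← ∈-from⁻ (p ∸ 1) (m ∸ (p ∸ 1)) a∈ =
    ∸1≤⇒≤suc h , a<m
    where
    a<m : a < m
    a<m with ≤-total (p ∸ 1) m
    ... | inj₁ k≤m = subst (a <_) (m+[n∸m]≡n k≤m) a<d
    ... | inj₂ m≤k rewrite m≤n⇒m∸n≡0 m≤k =
      contradiction (subst (a <_) (+-identityʳ (p ∸ 1)) a<d) (≤⇒≯ h)

  ∈-letters⁺ : ∀ {a} m p → p ≤ suc a → a < m → a ∈ letters m p
  ∈-letters⁺ {a} m p p≤ a<m = ∈-from⁺ (p ∸ 1) (m ∸ (p ∸ 1)) h
    (<-≤-trans a<m (m≤n+m∸n m (p ∸ 1)))
    where
    h : p ∸ 1 ≤ a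
    h = ∸-monoˡ-≤ 1 p≤

  letters-step : ∀ {m k} → k < m → letters m (1 + k) ≡ k ∷ letters m (2 + k)
  letters-step {suc m} {zero}  _         = refl
  letters-step {suc m} {suc k} (s≤s k<m) = lemma k<m
    where
    lemma : ∀ {i m k} → k < m → from i (m ∸ k) ≡ i ∷ from (suc i) (m ∸ suc k)
    lemma {k = zero}  (s≤s _)   = refl
    lemma {k = suc k} (s≤s k<m) = lemma k<m

  letters-end : ∀ m → letters m (1 + m) ≡ []
  letters-end m rewrite n∸n≡0 m = refl

  -- Descent along a flag: from `2 + k` to `1 + k` the list `letters m` gains the letter `k`, at
  -- `1 + m` it is empty, and at `0` it is the same as at `1`. Telescoping sums and the uniqueness
  -- of flagged recursions rest on this.
  descend : ∀ {ℓ} (P : ℕ → Set ℓ) m → P (1 + m) →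
            (∀ k → k < m → P (2 + k) → P (1 + k)) → (P 1 → P 0) → ∀ p → p ≤ 1 + m → P p
  descend P m top step bottom p p≤ = go (1 + m ∸ p) p (trans (+-comm _ p) (m+[n∸m]≡n p≤))
    where
    pos : ∀ d k → d + suc k ≡ 1 + m → P (suc k)
    pos zero    k refl = top
    pos (suc d) k eq     = step k
      (subst (k <_) (suc-injective eq) (m≤n+m (suc k) d))
      (pos d (suc k) (trans (+-suc d (suc k)) eq))
    go : ∀ d p → d + p ≡ 1 + m → P p
    go d zero    _  = bottom (pos m 0 (+-comm m 1))
    go d (suc p) eq = pos d p eq

  Ascent : ℕ → ℕ → Set
  Ascent u v = v ≤ u + 1

  -- Extraction of eligible letters

  -- Inverse to the extraction of an eligible a + 1.
  ins : ℕ → Seq → Seq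
  after : ∀ {c} a → Dec (a ≡ c) → Seq → Seq
  ins a []       = []
  ins a (c ∷ cs) = c ∷ after a (a ≟ c) cs
  after a (yes _) cs = suc a ∷ cs
  after a (no _)  cs = ins a cs

  -- The first nonfinal eligible entry of a Dyck sequence is of this form: it is
  -- the b + 1 that stands right after the first b.
  data Extractable (b : ℕ) : Seq → Set where
    here  : ∀ {c cs} → c ≤ suc b → Extractable b (b ∷ suc b ∷ c ∷ cs)
    there : ∀ {c cs} → b ≢ c → Extractable b cs → Extractable b (c ∷ cs)

  -- The part of a Dyck sequence up to its last maximal entry `m`. The initial entry is left free so
  -- that inductions can pass to the tail.
  data Path (m : ℕ) : Seq → Set where
    end  : Path m (m ∷ [])
    step : ∀ {c d cs} → c ≤ m → d ≤ c + 1 → Path m (d ∷ cs) → Path m (c ∷ d ∷ cs)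

  ≤+1⇒≤suc : ∀ {d c} → d ≤ c + 1 → d ≤ suc c
  ≤+1⇒≤suc {d} {c} = subst (d ≤_) (+-comm c 1)

  ≤suc⇒≤+1 : ∀ {d c} → d ≤ suc c → d ≤ c + 1
  ≤suc⇒≤+1 {d} {c} = subst (d ≤_) (+-comm 1 c)

  -- Ascents of at most 1 cannot jump over `a`: until the first `a`, the entries stay at most `a`.
  -- Hence a path that starts at or below `a` and ends above it must meet `a`.
  next-≤ : ∀ {a c d} → d ≤ c + 1 → c ≤ a → a ≢ c → d ≤ a
  next-≤ d≤ c≤a a≢c = ≤-trans (≤+1⇒≤suc d≤) (≤∧≢⇒< c≤a (a≢c ∘ sym))

  ins-path : ∀ {m a x xs} → Path m (x ∷ xs) → x ≤ a → a < m → Path m (ins a (x ∷ xs))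
  ins-path {a = a} end x≤a a<m = contradiction a<m (≤⇒≯ x≤a)
  ins-path {a = a} {x} (step c≤m d≤ p) x≤a a<m with a ≟ x
  ... | yes refl = step c≤m (≤-reflexive (+-comm 1 a)) (step a<m (≤-trans d≤ (n≤1+n _)) p)
  ... | no a≢x   = step c≤m d≤ (ins-path p (next-≤ d≤ x≤a a≢x) a<m)

  ins-extractable : ∀ {m a x xs} → Path m (x ∷ xs) → x ≤ a → a < m → Extractable a (ins a (x ∷ xs))
  ins-extractable end x≤a a<m = contradiction a<m (≤⇒≯ x≤a)
  ins-extractable {a = a} {x} (step c≤m d≤ p) x≤a a<m with a ≟ x
  ... | yes refl = here (≤+1⇒≤suc d≤)
  ... | no a≢x   = there a≢x (ins-extractable p (next-≤ d≤ x≤a a≢x) a<m)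

  extractable-tail : ∀ {b x xs} → Extractable b (x ∷ xs) → b ≢ x → Extractable b xs
  extractable-tail (here _)    b≢x = contradiction refl b≢x
  extractable-tail (there _ e) _   = e

  extractable-second : ∀ {b c cs} → Extractable b (b ∷ c ∷ cs) → c ≡ suc b
  extractable-second (here _)      = refl
  extractable-second (there b≢b _) = contradiction refl b≢b

  extractable-third : ∀ {b c d cs} → Extractable b (b ∷ c ∷ d ∷ cs) → d ≤ suc b
  extractable-third (here d≤)     = d≤
  extractable-third (there b≢b _) = contradiction refl b≢b

  -- After the insertion the first `a + 1` is the inserted one, and an entry at most `a + 1` follows
  -- it. This blocks `b = a + 1`; the surroundings of larger first occurrences are as before.
  ins-extractable⁻ : ∀ {m a b x xs} → Path m (x ∷ xs) → x ≤ a → a < m → a < b →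
                     Extractable b (ins a (x ∷ xs)) → suc a < b × Extractable b (x ∷ xs)
  ins-extractable⁻ end x≤a a<m _ _ = contradiction a<m (≤⇒≯ x≤a)
  ins-extractable⁻ {a = a} {b} {x} (step {d = d} c≤m d≤ p) x≤a a<m a<b e with a ≟ x
  ... | no a≢x = let l , e′ = ins-extractable⁻ p (next-≤ d≤ x≤a a≢x) a<m a<b (extractable-tail e b≢x)
                 in l , there b≢x e′
    where
    b≢x : b ≢ x
    b≢x refl = <⇒≱ a<b x≤a
  ... | yes refl with b ≟ suc a
  ...   | yes refl = contradiction (subst (_≤ suc a) (extractable-second (extractable-tail e 1+n≢n)) (≤+1⇒≤suc d≤)) 1+n≰n
  ...   | no b≢1+a = ≤∧≢⇒< a<b (b≢1+a ∘ sym) ,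
                     there (>⇒≢ a<b) (extractable-tail (extractable-tail e (>⇒≢ a<b)) b≢1+a)

  -- The removed letter is never the head, so the head stays visible in the types and only what
  -- follows it is computed.
  cut : ∀ {b c cs} → Extractable b (c ∷ cs) → Seq
  cut (here {c} {cs} _)            = c ∷ cs
  cut (there {cs = d ∷ cs} _ e) = d ∷ cut e

  ins-cut : ∀ {b c cs} (e : Extractable b (c ∷ cs)) → ins b (c ∷ cut e) ≡ c ∷ cs
  ins-cut {b} (here _) with b ≟ b
  ... | yes _  = refl
  ... | no b≢b = contradiction refl b≢b
  ins-cut {b} {c} (there {cs = d ∷ cs} b≢c e) with b ≟ c
  ... | yes b≡c = contradiction b≡c b≢c
  ... | no _    = cong (c ∷_) (ins-cut e)

  cut-path : ∀ {m b c cs} → Path m (c ∷ cs) → (e : Extractable b (c ∷ cs)) → Path m (c ∷ cut e)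
  cut-path (step b≤m _ (step _ _ p)) (here c≤)                 = step b≤m (≤suc⇒≤+1 c≤) p
  cut-path (step c≤m d≤ p)           (there {cs = d ∷ cs} _ e) = step c≤m d≤ (cut-path p e)

  -- All entries up to the removed `a + 1` are at most `a + 1`, so the first `b` and its successors
  -- lie beyond it and are untouched by the removal.
  cut-extractable : ∀ {m a b c cs} → Path m (c ∷ cs) → c ≤ a → (e : Extractable a (c ∷ cs)) →
                    suc a < b → Extractable b (c ∷ cut e) → Extractable b (c ∷ cs)
  cut-extractable p c≤a (here _) a<b e′ =
    there (>⇒≢ (<⇒≤ a<b)) (there (>⇒≢ a<b) (extractable-tail e′ (>⇒≢ (<⇒≤ a<b))))
  cut-extractable {b = b} {c} (step _ d≤ p) c≤a (there {cs = d ∷ cs} a≢c e) a<b e′ =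
    there b≢c (cut-extractable p (next-≤ d≤ c≤a a≢c) e a<b (extractable-tail e′ b≢c))
    where
    b≢c : b ≢ c
    b≢c refl = <⇒≱ a<b (≤-trans c≤a (n≤1+n _))

  path-≤ : ∀ {m G} → Path m G → All (_≤ m) G
  path-≤ end            = ≤-refl ∷ []
  path-≤ (step c≤m _ p) = c≤m ∷ path-≤ p

  path-∈ : ∀ {m G} → Path m G → m ∈ G
  path-∈ end          = here refl
  path-∈ (step _ _ p) = there (path-∈ p)

  extractable-∈ : ∀ {b G} → Extractable b G → suc b ∈ G
  extractable-∈ (here _)    = there (here refl)
  extractable-∈ (there _ e) = there (extractable-∈ e)

  extractable-< : ∀ {m b G} → Path m G → Extractable b G → b < m
  extractable-< p e = All.lookup (path-≤ p) (extractable-∈ e)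

  ins-injective : ∀ {a} G G′ → ins a G ≡ ins a G′ → G ≡ G′
  ins-injective []      []       eq = refl
  ins-injective {a} (c ∷ G) (d ∷ G′) eq with refl ← ∷-injectiveˡ eq = cong (c ∷_) (go (a ≟ c) (∷-injectiveʳ eq))
    where
    go : (dec : Dec (a ≡ c)) → after a dec G ≡ after a dec G′ → G ≡ G′
    go (yes _) = ∷-injectiveʳ
    go (no _)  = ins-injective G G′

  extractable? : ∀ b G → Dec (Extractable b G)
  extractable? b []      = no λ ()
  extractable? b (c ∷ G) with b ≟ c
  ... | no b≢c with extractable? b G
  ...   | yes e = yes (there b≢c e)
  ...   | no ¬e = no λ e → ¬e (extractable-tail e b≢c)
  extractable? b (c ∷ [])        | yes refl = no λ { (there b≢b _) → b≢b refl }
  extractable? b (c ∷ d ∷ [])    | yes refl = no λ { (there b≢b _) → b≢b refl }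
  extractable? b (c ∷ d ∷ f ∷ G) | yes refl with d ≟ suc b | f ≤? suc b
  ...   | yes refl | yes f≤ = yes (here f≤)
  ...   | no d≢    | _      = no λ e → d≢ (extractable-second e)
  ...   | yes _    | no f≰  = no λ e → f≰ (extractable-third e)

  -- Extracting the largest letter first makes the extracted letters a word with
  -- ascents at most 1; this is what pins down the order of extraction.
  Top : Seq → Seq → Set
  Top []      G = ∀ b → ¬ Extractable b G
  Top (a ∷ _) G = Extractable a G × (∀ b → Extractable b G → b ≤ a)

  largest-extractable : ∀ {k} G → (∀ b → Extractable b G → b < k) →
                        Top [] G ⊎ ∃ λ a → Extractable a G × (∀ b → Extractable b G → b ≤ a)
  largest-extractable {zero}  G bound = inj₁ λ b e → contradiction (bound b e) n≮0
  largest-extractable {suc k} G bound with extractable? k G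
  ... | yes e = inj₂ (k , e , λ b e′ → s≤s⁻¹ (bound b e′))
  ... | no ¬e = largest-extractable G λ b e → ≤∧≢⇒< (s≤s⁻¹ (bound b e)) λ { refl → ¬e e }

  record Word (m : ℕ) (w : Seq) : Set where
    constructor word
    field
      steps : Linked Ascent w
      small : All (_< m) w

  -- Skeletons in terms of extractable letters; `skeleton⇒core` and `core⇒skeleton` give the
  -- equivalence.
  record IsCore (m : ℕ) (F : Seq) : Set where
    constructor core
    field
      {rest} : Seq
      shape≡ : F ≡ 0 ∷ rest
      path   : Path m F
      none   : Top [] F

  record Inserted (m : ℕ) (x G : Seq) : Set where
    constructor inserted
    field
      {rest} : Seq
      shape≡ : G ≡ 0 ∷ rest
      path   : Path m G
      top    : Top x G

  -- The ascent condition keeps the letter inserted last the largest extractable one: a larger one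
  -- would have to exceed `a + 1` and to be extractable already, whereas the previous largest is at
  -- most `a + 1`.
  foldr-ins : ∀ {m F x} → IsCore m F → Word m x → Inserted m x (foldr ins F x)
  foldr-ins {x = []} (core refl p none) _ = inserted refl p none
  foldr-ins {m} {F} {a ∷ x} F-core (word l (a<m ∷ <m)) = go (foldr-ins F-core (word (Linked.tail l) <m)) bound
    where
    bound : ∀ {G} → Top x G → ∀ b → Extractable b G → b ≤ suc a
    bound = go′ l
      where
      go′ : ∀ {x} → Linked Ascent (a ∷ x) → ∀ {G} → Top x G → ∀ b → Extractable b G → b ≤ suc a
      go′ [-]       none      b e = contradiction e (none b)
      go′ (c≤ ∷ _) (_ , max) b e = ≤-trans (max b e) (≤+1⇒≤suc c≤)
    go : ∀ {G} → Inserted m x G → (Top x G → ∀ b → Extractable b G → b ≤ suc a) → Inserted m (a ∷ x) (ins a G)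
    go (inserted refl p top) bd = inserted refl (ins-path p z≤n a<m)
      (ins-extractable p z≤n a<m , λ b e → ≮⇒≥ λ a<b →
        let l , e′ = ins-extractable⁻ p z≤n a<m a<b e in <⇒≱ l (bd top b e′))

  -- The first letter of either word is the largest extractable letter of the common value, so both
  -- words are peeled off together. They end together because a core has no extractable letter.
  foldr-ins-injective : ∀ {m F F′ x x′} → IsCore m F → IsCore m F′ → Word m x → Word m x′ →
                        foldr ins F x ≡ foldr ins F′ x′ → F ≡ F′ × x ≡ x′
  foldr-ins-injective {x = []}    {[]}     c c′ W W′ eq = eq , refl
  foldr-ins-injective {x = []}    {a ∷ x′} c c′ W W′ eq = contradiction
    (subst (Extractable a) (sym eq) (proj₁ (Inserted.top (foldr-ins c′ W′)))) (Inserted.top (foldr-ins c W) a)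
  foldr-ins-injective {x = a ∷ x} {[]}     c c′ W W′ eq = contradiction
    (subst (Extractable a) eq (proj₁ (Inserted.top (foldr-ins c W)))) (Inserted.top (foldr-ins c′ W′) a)
  foldr-ins-injective {F = F} {F′} {x = a ∷ x} {a′ ∷ x′} c c′ W@(word l (_ ∷ <m)) W′@(word l′ (_ ∷ <m′)) eq
    with e , max ← Inserted.top (foldr-ins c W) | e′ , max′ ← Inserted.top (foldr-ins c′ W′)
    with refl ← ≤-antisym (max′ a (subst (Extractable a) eq e)) (max a′ (subst (Extractable a′) (sym eq) e′))
    with refl , refl ← foldr-ins-injective c c′ (word (Linked.tail l) <m) (word (Linked.tail l′) <m′)
                         (ins-injective (foldr ins F x) (foldr ins F′ x′) eq)
    = refl , refl

  length-cut : ∀ {b c cs} (e : Extractable b (c ∷ cs)) → length cs ≡ suc (length (cut e))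
  length-cut (here _)                  = refl
  length-cut (there {cs = d ∷ cs} _ e) = cong suc (length-cut e)

  -- The largest extractable letter is cut again and again, with `N` bounding the length. The
  -- letters cut form a word: a next letter beyond `a + 1` would have been extractable before the
  -- cut, against the choice of `a`.
  foldr-ins-surjective : ∀ {m} N cs → length cs ≤ N → Path m (0 ∷ cs) →
                         ∃₂ λ F x → IsCore m F × Word m x × foldr ins F x ≡ 0 ∷ cs
  foldr-ins-surjective N cs l p with largest-extractable (0 ∷ cs) (λ b → extractable-< p)
  ... | inj₁ none          = 0 ∷ cs , [] , core refl p none , word [] [] , refl
  foldr-ins-surjective zero [] z≤n p | inj₂ (a , there _ () , max)
  foldr-ins-surjective {m} (suc N) cs l p | inj₂ (a , e , max)
    with F , x , c , W , eq ← foldr-ins-surjective N (cut e)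
                                (s≤s⁻¹ (subst (_≤ suc N) (length-cut e) l)) (cut-path p e)
    = F , a ∷ x , c , extend W (Inserted.top (foldr-ins c W)) , trans (cong (ins a) eq) (ins-cut e)
    where
    extend : ∀ {w} → Word m w → Top w (foldr ins F x) → Word m (a ∷ w)
    extend {w = []} W _ = word [-] (extractable-< p e ∷ [])
    extend {w = b ∷ _} (word l <m) top = word (≤suc⇒≤+1 b≤ ∷ l) (extractable-< p e ∷ <m)
      where
      b≤ : b ≤ suc a
      b≤ = ≮⇒≥ λ a<b → <⇒≱ (<-trans (n<1+n a) a<b) (max b (cut-extractable p z≤n e a<b (subst (Extractable b) eq (proj₁ top))))

  -- Splitting a Dyck sequence after its last maximum

  record Splits (m : ℕ) (D : Seq) : Set where
    constructor splits
    field
      {G y} : Seq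
      eq    : G ++ y ≡ D
      path  : Path m G
      rest  : Word m y
      head≡ : head G ≡ head D

  split : ∀ {m} D → Linked Ascent D → All (_≤ m) D → m ∈ D → Splits m D
  split {m} (c ∷ cs) l (c≤m ∷ ≤m) m∈ with _∈?_ _≟_ m cs
  split {m} (m ∷ cs) l (m≤m ∷ ≤m) (here refl) | no m∉ = splits {G = m ∷ []} {y = cs} refl end
    (word (Linked.tail l) (All.tabulate λ c∈ → ≤∧≢⇒< (All.lookup ≤m c∈) λ { refl → m∉ c∈ })) refl
  split {m} (c ∷ cs) l (c≤m ∷ ≤m) (there m∈) | no m∉ = contradiction m∈ m∉
  split {m} (c ∷ d ∷ cs) (d≤ ∷ l) (c≤m ∷ ≤m) _ | yes m∈ with split (d ∷ cs) l ≤m m∈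
  ... | splits {d ∷ G} eq p W refl = splits (cong (c ∷_) eq) (step c≤m d≤ p) W refl

  -- The largest entry of the whole sequence is both `m` and `m′`, and the division comes after its
  -- last occurrence.
  split-unique : ∀ {m m′ G G′ y y′} → Path m G → Path m′ G′ → All (_< m) y → All (_< m′) y′ →
                 G ++ y ≡ G′ ++ y′ → G ≡ G′ × y ≡ y′
  split-unique {m} {m′} {G} {G′} {y} {y′} p p′ <m <m′ eq = go p p′ <m <m′ eq m≡m′
    where
    bound : ∀ {m G y} → Path m G → All (_< m) y → All (_≤ m) (G ++ y)
    bound p <m = All.++⁺ (path-≤ p) (All.map <⇒≤ <m)
    m≡m′ : m ≡ m′
    m≡m′ = ≤-antisym
      (All.lookup (subst (All (_≤ m′)) (sym eq) (bound p′ <m′)) (∈-++⁺ˡ (path-∈ p)))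
      (All.lookup (subst (All (_≤ m)) eq (bound p <m)) (∈-++⁺ˡ (path-∈ p′)))
    go : ∀ {m m′ G G′ y y′} → Path m G → Path m′ G′ → All (_< m) y → All (_< m′) y′ →
         G ++ y ≡ G′ ++ y′ → m ≡ m′ → G ≡ G′ × y ≡ y′
    go end end _ _ refl _ = refl , refl
    go end (step _ _ p′) <m _ eq refl = contradiction
      (All.lookup <m (subst (_ ∈_) (sym (∷-injectiveʳ eq)) (∈-++⁺ˡ (path-∈ p′)))) (n≮n _)
    go (step _ _ p) end _ <m′ eq refl = contradiction
      (All.lookup <m′ (subst (_ ∈_) (∷-injectiveʳ eq) (∈-++⁺ˡ (path-∈ p)))) (n≮n _)
    go (step _ _ p) (step _ _ p′) <m <m′ eq m≡ with refl ← ∷-injectiveˡ eq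
      with refl , refl ← go p p′ <m <m′ (∷-injectiveʳ eq) m≡ = refl , refl

  path-++ : ∀ {m G y} → Path m G → Word m y → Linked Ascent (G ++ y)
  path-++ {y = []}    end            _ = [-]
  path-++ {y = b ∷ y} end            (word l (b<m ∷ _)) = ≤-trans (<⇒≤ b<m) (m≤m+n _ 1) ∷ l
  path-++             (step _ d≤ p) W = d≤ ∷ path-++ p W

  path-linked : ∀ {m G} → Path m G → Linked Ascent G
  path-linked end            = [-]
  path-linked (step _ d≤ p) = d≤ ∷ path-linked p

  path-last : ∀ {m G} → Path m G → last G ≡ just m
  path-last end          = refl
  path-last (step _ _ p) = path-last p

  path-max : ∀ {m G} → Path m G → max 0 G ≡ m
  path-max p = ≤-antisym (max≤v⁺ z≤n (path-≤ p)) (All.lookup (xs≤max 0 _) (path-∈ p))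

  linked-path : ∀ {m G} → Linked Ascent G → All (_≤ m) G → last G ≡ just m → Path m G
  linked-path [-]      _           refl = end
  linked-path (d≤ ∷ l) (c≤m ∷ ≤m) eq   = step c≤m d≤ (linked-path l ≤m eq)

  -- Eligible indices and extractable letters

  -- Passes v and PassesAfterOne v read a nonfinal eligible entry v off from left
  -- to right, with no, respectively exactly one, v - 1 still to come before it.
  data Passes (v : ℕ) : Seq → Set where
    now   : ∀ {d cs} → d ≤ v → Passes v (v ∷ d ∷ cs)
    later : ∀ {c cs} → suc c ≢ v → Passes v cs → Passes v (c ∷ cs)

  data PassesAfterOne (v : ℕ) : Seq → Set where
    start : ∀ {c cs} → suc c ≡ v → Passes v cs → PassesAfterOne v (c ∷ cs)
    later : ∀ {c cs} → suc c ≢ v → PassesAfterOne v cs → PassesAfterOne v (c ∷ cs)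

  -- From c, c + 1 on, the sequence cannot ascend all the way to a later v ≤ c + 1.
  run : ∀ {c cs v} → Linked Ascent (c ∷ suc c ∷ cs) → v ≤ suc c → Passes v (suc c ∷ cs) →
        ∃ λ b → c ≤ b × Extractable b (c ∷ suc c ∷ cs)
  run {c} l                    v≤ (now d≤) = c , ≤-refl , here d≤
  run {c} {d ∷ cs} (_ ∷ d≤ ∷ l) v≤ (later _ π) with d ≤? suc c
  ... | yes d≤c = c , ≤-refl , here d≤c
  ... | no d≰c with refl ← ≤-antisym (≤+1⇒≤suc d≤) (≰⇒> d≰c)
    with b , c<b , e ← run (d≤ ∷ l) (m≤n⇒m≤1+n v≤) π
    = b , <⇒≤ c<b , there (>⇒≢ c<b) e

  -- Otherwise `d` is below `c`, since no further `c` may come before the `c + 1` in question; but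
  -- climbing back to `c + 1` by ascents of at most 1 passes through `c`.
  passes-first : ∀ {c d cs} → Linked Ascent (c ∷ d ∷ cs) → Passes (suc c) (d ∷ cs) → d ≡ suc c
  passes-first l (now _) = refl
  passes-first {c} {d} (d≤ ∷ l) π@(later d≢ _) with d ≟ suc c
  ... | yes d≡ = d≡
  ... | no d≢′ = contradiction π (avoid l (≤∧≢⇒< (s≤s⁻¹ (≤∧≢⇒< (≤+1⇒≤suc d≤) d≢′)) (d≢ ∘ cong suc)))
    where
    avoid : ∀ {d cs} → Linked Ascent (d ∷ cs) → d < c → ¬ Passes (suc c) (d ∷ cs)
    avoid l        d<c (now _) = <⇒≱ d<c (n≤1+n c)
    avoid {d} {f ∷ cs} (f≤ ∷ l) d<c (later _ π) with f ≟ c | π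
    ... | yes refl | later n _ = n refl
    ... | no f≢c   | π′        = avoid l (≤∧≢⇒< (≤-trans (≤+1⇒≤suc f≤) d<c) f≢c) π′

  -- An eligible entry need not be extractable itself. The only `v - 1` before it is followed at
  -- once by a `v`, and if the sequence goes on ascending there, `run` finds an extractable letter
  -- higher up; for skeletons the existence of one suffices. The bound on `b` keeps it distinct from
  -- the entries skipped.
  passes-extractable : ∀ {v c cs} → Linked Ascent (c ∷ cs) → c < v → PassesAfterOne v (c ∷ cs) →
                       ∃ λ b → v ≤ suc b × Extractable b (c ∷ cs)
  passes-extractable {cs = d ∷ cs} l c<v (start refl π) with refl ← passes-first l π
    with b , c≤b , e ← run l ≤-refl π = b , s≤s c≤b , e
  passes-extractable {cs = d ∷ cs} (d≤ ∷ l) c<v (later c≢ π)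
    with b , v≤ , e ← passes-extractable l (≤-<-trans (≤+1⇒≤suc d≤) (≤∧≢⇒< c<v c≢)) π
    = b , v≤ , there (λ { refl → c≢ (≤-antisym c<v v≤) }) e

  eligible-passes : ∀ {F} (j : Fin (length F)) → toℕ j + 1 < length F → Eligible F j →
                    PassesAfterOne (lookup F j) F
  eligible-passes {c ∷ F} 0F j< record { one-before = _ , (() , _) , _ }
  eligible-passes {c ∷ F} (sucF j) j< record { one-before = i , (i<j , i≡) , uniq ; next-≤ = next } with i
  ... | 0F = start (trans (+-comm 1 c) i≡) (tail F j (s≤s⁻¹ j<) (λ k k≡ → next (sucF k) (cong suc k≡))
               λ k k<j eq → contradiction (uniq {sucF k} (s≤s k<j , trans (+-comm _ 1) eq)) λ ())
    where
    tail : ∀ F (j : Fin (length F)) → toℕ j + 1 < length F →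
           (∀ k → toℕ k ≡ toℕ j + 1 → lookup F k ≤ lookup F j) →
           (∀ k → k <ᶠ j → suc (lookup F k) ≢ lookup F j) → Passes (lookup F j) F
    tail (c ∷ [])    0F (s≤s ()) _ _
    tail (c ∷ d ∷ F) 0F       j< next none = now (next (sucF 0F) refl)
    tail (c ∷ F)     (sucF j) j< next none = later (none 0F (s≤s z≤n))
      (tail F j (s≤s⁻¹ j<) (λ k k≡ → next (sucF k) (cong suc k≡)) λ k k<j → none (sucF k) (s≤s k<j))
  ... | sucF i = later (λ eq → contradiction (uniq {0F} (s≤s z≤n , trans (+-comm c 1) eq)) λ ())
    (eligible-passes j (s≤s⁻¹ j<) record
      { one-before = i , (s≤s⁻¹ i<j , i≡) , λ {k} (k<j , k≡) → suc-inj (uniq {sucF k} (s≤s k<j , k≡))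
      ; next-≤     = λ k k≡ → next (sucF k) (cong suc k≡) })
    where
    suc-inj : ∀ {n} {i k : Fin n} → sucF i ≡ sucF k → i ≡ k
    suc-inj refl = refl

  extractable-eligible : ∀ {b F} → Extractable b F →
                         ∃ λ j → toℕ j + 1 < length F × Eligible F j × lookup F j ≡ suc b
  extractable-eligible {b} (here d≤) = sucF 0F , s≤s (s≤s (s≤s z≤n)) , record
    { one-before = 0F , (s≤s z≤n , +-comm b 1) , λ { {0F} _ → refl ; {sucF k} (s≤s () , _) }
    ; next-≤     = λ { 0F () ; (sucF 0F) () ; (sucF (sucF 0F)) _ → d≤ ; (sucF (sucF (sucF k))) () }
    } , refl
  extractable-eligible {b} (there {c} {cs} b≢c e)
    with j , j< , record { one-before = i , (i<j , i≡) , uniq ; next-≤ = next } , j≡ ← extractable-eligible e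
    = sucF j , s≤s j< , record
      { one-before = sucF i , (s≤s i<j , i≡) , λ
          { {0F}     (_ , c≡)         → contradiction (suc-injective (trans (sym j≡) (trans (sym c≡) (+-comm c 1)))) b≢c
          ; {sucF k} (s≤s k<j , k≡) → cong sucF (uniq (k<j , k≡)) }
      ; next-≤     = λ { 0F () ; (sucF k) k≡ → next k (suc-injective k≡) }
      } , j≡

  skeleton⇒core : ∀ {m F} → IsSkeleton m F → IsCore m F
  skeleton⇒core {m} {c ∷ F} s with refl ← just-injective (IsDyck.starts-at-0 (IsSkeleton.isDyck s)) =
    core refl
      (linked-path (IsDyck.steps isDyck) (subst (λ k → All (_≤ k) _) max≡m (xs≤max 0 _)) last≡m)
      λ b e → let j , j< , el , _ = extractable-eligible e in no-eligible j j< el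
    where open IsSkeleton s

  core⇒skeleton : ∀ {m F} → IsCore m F → IsSkeleton m F
  core⇒skeleton (core {F} refl p none) = record
    { isDyck      = record { starts-at-0 = refl ; steps = path-linked p }
    ; max≡m       = path-max p
    ; last≡m      = path-last p
    ; no-eligible = λ j j< el → let b , _ , e = passes-extractable (path-linked p)
                                      (positive el) (eligible-passes j j< el) in none b e
    }
    where
    positive : ∀ {j : Fin (length (0 ∷ F))} → Eligible (0 ∷ F) j → 0 < lookup (0 ∷ F) j
    positive record { one-before = _ , (_ , eq) , _ } = subst (0 <_) eq (m≤n+m 1 _)

  -- The statistics under insertion

  count : ℕ → Seq → ℕ
  count a xs = length (filter (a ≟_) xs)

  countBelow : ℕ → Seq → ℕ
  countBelow a xs = length (filter (λ b → a ≟ suc b) xs)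

  countBelow-suc : ∀ a xs → countBelow (suc a) xs ≡ count a xs
  countBelow-suc a xs =
    cong length (filter-≐ (λ b → suc a ≟ suc b) (a ≟_) (suc-injective , cong suc) xs)

  countBelow-0 : ∀ xs → countBelow 0 xs ≡ 0
  countBelow-0 []       = refl
  countBelow-0 (_ ∷ xs) = countBelow-0 xs

  count-++ : ∀ a xs ys → count a (xs ++ ys) ≡ count a xs + count a ys
  count-++ a xs ys = trans (cong length (filter-++ (a ≟_) xs ys)) (length-++ (filter (a ≟_) xs))

  countBelow-++ : ∀ a xs ys → countBelow a (xs ++ ys) ≡ countBelow a xs + countBelow a ys
  countBelow-++ a xs ys = trans (cong length (filter-++ _ xs ys)) (length-++ (filter (λ b → a ≟ suc b) xs))

  count-self : ∀ a → count a [ a ] ≡ 1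
  count-self a = cong length (filter-accept (a ≟_) refl)

  count-≢ : ∀ {a b} → a ≢ b → count a [ b ] ≡ 0
  count-≢ {a} a≢b = cong length (filter-reject (a ≟_) a≢b)

  count-sym : ∀ a b → count a [ b ] ≡ count b [ a ]
  count-sym a b = go (a ≟ b)
    where
    go : Dec (a ≡ b) → count a [ b ] ≡ count b [ a ]
    go (yes refl) = refl
    go (no a≢b)   = trans (count-≢ a≢b) (sym (count-≢ (a≢b ∘ sym)))

  countBelow-sym : ∀ a b → countBelow a [ b ] ≡ count (suc b) [ a ]
  countBelow-sym zero    b = refl
  countBelow-sym (suc a) b = trans (countBelow-suc a [ b ]) (trans (count-sym a b)
    (trans (sym (countBelow-suc b [ a ])) (go (b ≟ a))))
    where
    go : Dec (b ≡ a) → countBelow (suc b) [ a ] ≡ count (suc b) [ suc a ]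
    go (yes refl) = trans (trans (countBelow-suc a [ a ]) (count-self a)) (sym (count-self (suc a)))
    go (no b≢a)   = trans (trans (countBelow-suc b [ a ]) (count-≢ b≢a)) (sym (count-≢ (b≢a ∘ suc-injective)))

  dinv-∷ : ∀ a xs → dinv (a ∷ xs) ≡ countBelow a xs + count a xs + dinv xs
  dinv-∷ a xs = solve 4 (λ i j k l → (i :+ k) :+ (j :+ l) := i :+ j :+ (k :+ l)) refl
    (countBelow a xs) (count a xs) (di xs) (nv xs)

  -- The new pairs join `a` to an earlier `a` or `a + 1`, or to a later `a` or `a - 1`.
  dinv-insert : ∀ X a s → dinv (X ++ a ∷ s) ≡
                dinv (X ++ s) + (count a X + count (suc a) X) + (countBelow a s + count a s)
  dinv-insert []      a s = trans (dinv-∷ a s)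
    (solve 2 (λ i k → i :+ k := k :+ con 0 :+ i) refl (countBelow a s + count a s) (dinv s))
  dinv-insert (x ∷ X) a s = begin
    dinv (x ∷ X ++ a ∷ s)
      ≡⟨ dinv-∷ x (X ++ a ∷ s) ⟩
    countBelow x (X ++ a ∷ s) + count x (X ++ a ∷ s) + dinv (X ++ a ∷ s)
      ≡⟨ cong₂ _+_ (cong₂ _+_ below-mid count-mid) (dinv-insert X a s) ⟩
    (countBelow x (X ++ s) + count (suc a) [ x ]) + (count x (X ++ s) + count a [ x ])
      + (dinv (X ++ s) + (count a X + count (suc a) X) + (countBelow a s + count a s))
      ≡⟨ solve 8 (λ b p c q d i j k → (b :+ p) :+ (c :+ q) :+ (d :+ (i :+ j) :+ k)
           := b :+ c :+ d :+ ((q :+ i) :+ (p :+ j)) :+ k) refl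
           (countBelow x (X ++ s)) (count (suc a) [ x ]) (count x (X ++ s)) (count a [ x ])
           (dinv (X ++ s)) (count a X) (count (suc a) X) (countBelow a s + count a s) ⟩
    countBelow x (X ++ s) + count x (X ++ s) + dinv (X ++ s)
      + ((count a [ x ] + count a X) + (count (suc a) [ x ] + count (suc a) X)) + (countBelow a s + count a s)
      ≡⟨ cong₂ (λ i j → i + j + (countBelow a s + count a s)) (dinv-∷ x (X ++ s)) (cong₂ _+_ (count-++ a [ x ] X) (count-++ (suc a) [ x ] X)) ⟨
    dinv (x ∷ X ++ s) + (count a (x ∷ X) + count (suc a) (x ∷ X)) + (countBelow a s + count a s) ∎
    where
    open ≡-Reasoning
    mid : (f : Seq → ℕ) → (∀ ys zs → f (ys ++ zs) ≡ f ys + f zs) →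
          f (X ++ a ∷ s) ≡ f (X ++ s) + f [ a ]
    mid f f-++ = begin
      f (X ++ a ∷ s)            ≡⟨ f-++ X (a ∷ s) ⟩
      f X + f (a ∷ s)           ≡⟨ cong (f X +_) (f-++ [ a ] s) ⟩
      f X + (f [ a ] + f s)     ≡⟨ solve 3 (λ i j k → i :+ (j :+ k) := (i :+ k) :+ j) refl (f X) (f [ a ]) (f s) ⟩
      (f X + f s) + f [ a ]     ≡⟨ cong (_+ f [ a ]) (f-++ X s) ⟨
      f (X ++ s) + f [ a ]      ∎
    below-mid : countBelow x (X ++ a ∷ s) ≡ countBelow x (X ++ s) + count (suc a) [ x ]
    below-mid = trans (mid (countBelow x) (countBelow-++ x)) (cong (countBelow x (X ++ s) +_) (countBelow-sym x a))
    count-mid : count x (X ++ a ∷ s) ≡ count x (X ++ s) + count a [ x ]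
    count-mid = trans (mid (count x) (count-++ x)) (cong (count x (X ++ s) +_) (count-sym x a))

  ins-here : ∀ a cs → ins a (a ∷ cs) ≡ a ∷ suc a ∷ cs
  ins-here a cs with a ≟ a
  ... | yes _  = refl
  ... | no a≢a = contradiction refl a≢a

  ins-there : ∀ {a c} cs → a ≢ c → ins a (c ∷ cs) ≡ c ∷ ins a cs
  ins-there {a} {c} cs a≢c with a ≟ c
  ... | yes a≡c = contradiction a≡c a≢c
  ... | no _    = refl

  record InsertionPoint (a : ℕ) (G : Seq) : Set where
    constructor insertion
    field
      {P R}    : Seq
      before≡  : P ++ a ∷ R ≡ G
      after≡   : P ++ a ∷ suc a ∷ R ≡ ins a G
      smaller  : All (_< a) P

  insertion-point : ∀ {m a x xs} → Path m (x ∷ xs) → x ≤ a → a < m → InsertionPoint a (x ∷ xs)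
  insertion-point end x≤a a<m = contradiction a<m (≤⇒≯ x≤a)
  insertion-point {a = a} {x} (step {d = d} {cs} _ d≤ p) x≤a a<m = go (a ≟ x)
    where
    go : Dec (a ≡ x) → InsertionPoint a (x ∷ d ∷ cs)
    go (yes refl) = insertion {P = []} refl (sym (ins-here a (d ∷ cs))) []
    go (no a≢x) with insertion-point p (next-≤ d≤ x≤a a≢x) a<m
    ... | insertion eq eq′ <a = insertion (cong (x ∷_) eq)
      (trans (cong (x ∷_) eq′) (sym (ins-there (d ∷ cs) a≢x))) (≤∧≢⇒< x≤a (a≢x ∘ sym) ∷ <a)

  count-none : ∀ {a b xs} → All (_< a) xs → a ≤ b → count b xs ≡ 0
  count-none {b = b} <a a≤b = cong length (filter-none (b ≟_)
    (All.map (λ x<a b≡x → <⇒≢ (<-≤-trans x<a a≤b) (sym b≡x)) <a))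

  -- The inserted `a + 1` forms pairs with the entries `a` and `a + 1` after it, and an `a` at the
  -- very end forms pairs with those before it. The entries before the first `a` are smaller, so the
  -- two counts differ only by that first `a`.
  dinv-ins : ∀ {a G} → InsertionPoint a G → ∀ y → dinv (ins a G ++ y) + 1 ≡ dinv (G ++ y ++ [ a ])
  dinv-ins {a} (insertion {P} {R} refl eq <a) y rewrite sym eq = begin
    dinv ((P ++ a ∷ suc a ∷ R) ++ y) + 1
      ≡⟨ cong (λ X → dinv X + 1) (trans (++-assoc P _ y) (sym (++-assoc P [ a ] _))) ⟩
    dinv ((P ++ [ a ]) ++ suc a ∷ (R ++ y)) + 1
      ≡⟨ cong (_+ 1) (dinv-insert (P ++ [ a ]) (suc a) (R ++ y)) ⟩
    dinv ((P ++ [ a ]) ++ R ++ y) + (count (suc a) (P ++ [ a ]) + count (suc (suc a)) (P ++ [ a ]))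
      + (countBelow (suc a) (R ++ y) + count (suc a) (R ++ y)) + 1
      ≡⟨ cong₂ (λ i j → dinv ((P ++ [ a ]) ++ R ++ y) + i + (j + count (suc a) (R ++ y)) + 1)
           (cong₂ _+_ (count-P ≤-refl) (count-P (n≤1+n _))) (countBelow-suc a (R ++ y)) ⟩
    dinv ((P ++ [ a ]) ++ R ++ y) + 0 + (count a (R ++ y) + count (suc a) (R ++ y)) + 1
      ≡⟨ solve 3 (λ d i j → d :+ con 0 :+ (i :+ j) :+ con 1 := d :+ (con 1 :+ i :+ j) :+ con 0) refl
           (dinv ((P ++ [ a ]) ++ R ++ y)) (count a (R ++ y)) (count (suc a) (R ++ y)) ⟩
    dinv ((P ++ [ a ]) ++ R ++ y) + (1 + count a (R ++ y) + count (suc a) (R ++ y)) + 0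
      ≡⟨ cong₂ (λ X i → dinv X + i + 0) assoc (cong₂ _+_ count-a count-1+a) ⟨
    dinv (((P ++ a ∷ R) ++ y) ++ []) + (count a ((P ++ a ∷ R) ++ y) + count (suc a) ((P ++ a ∷ R) ++ y)) + 0
      ≡⟨ dinv-insert ((P ++ a ∷ R) ++ y) a [] ⟨
    dinv (((P ++ a ∷ R) ++ y) ++ [ a ])
      ≡⟨ cong dinv (++-assoc (P ++ a ∷ R) y [ a ]) ⟩
    dinv ((P ++ a ∷ R) ++ y ++ [ a ]) ∎
    where
    open ≡-Reasoning
    assoc : ((P ++ a ∷ R) ++ y) ++ [] ≡ (P ++ [ a ]) ++ R ++ y
    assoc = trans (++-identityʳ _) (trans (++-assoc P _ y) (sym (++-assoc P [ a ] _)))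
    count-P : ∀ {b} → suc a ≤ b → count b (P ++ [ a ]) ≡ 0
    count-P {b} a<b = trans (count-++ b P [ a ])
      (cong₂ _+_ (count-none <a (<⇒≤ a<b)) (count-none (≤-refl ∷ []) a<b))
    count-G : ∀ b → a ≤ b → count b ((P ++ a ∷ R) ++ y) ≡ count b [ a ] + count b (R ++ y)
    count-G b a≤b = trans (cong (count b) (++-assoc P (a ∷ R) y))
      (trans (count-++ b P _) (cong₂ _+_ (count-none <a a≤b) (count-++ b [ a ] (R ++ y))))
    count-a : count a ((P ++ a ∷ R) ++ y) ≡ 1 + count a (R ++ y)
    count-a = trans (count-G a ≤-refl) (cong (_+ count a (R ++ y)) (count-self a))
    count-1+a : count (suc a) ((P ++ a ∷ R) ++ y) ≡ count (suc a) (R ++ y)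
    count-1+a = trans (count-G (suc a) (n≤1+n a)) (cong (_+ count (suc a) (R ++ y)) (count-none {suc a} {suc a} {[ a ]} (≤-refl ∷ []) ≤-refl))

  length-ins : ∀ {a G} → InsertionPoint a G → length (ins a G) ≡ suc (length G)
  length-ins {a} (insertion {P} {R} refl eq _) rewrite sym eq =
    trans (length-++ P) (trans (+-suc _ _) (cong suc (sym (length-++ P))))

  sum-ins : ∀ {a G} → InsertionPoint a G → sum (ins a G) ≡ sum G + suc a
  sum-ins {a} (insertion {P} {R} refl eq _) rewrite sym eq = begin
    sum (P ++ a ∷ suc a ∷ R)            ≡⟨ sum-++ P _ ⟩
    sum P + (a + (suc a + sum R))       ≡⟨ solve 3 (λ p a r → p :+ (a :+ (con 1 :+ a :+ r)) := p :+ (a :+ r) :+ (con 1 :+ a)) refl (sum P) a (sum R) ⟩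
    sum P + (a + sum R) + suc a         ≡⟨ cong (_+ suc a) (sum-++ P _) ⟨
    sum (P ++ a ∷ R) + suc a            ∎
    where open ≡-Reasoning

  module _ {m F} (F-core : IsCore m F) where

    foldr-insertion : ∀ {a x} → Word m (a ∷ x) → InsertionPoint a (foldr ins F x)
    foldr-insertion (word l (a<m ∷ <m)) with foldr-ins F-core (word (Linked.tail l) <m)
    ... | inserted eq p _ rewrite eq = insertion-point p z≤n a<m

    -- The outermost insertion is undone first and its letter goes directly behind `y`; the later
    -- ones follow it, so `x` reappears unreversed.
    dinv-foldr-ins : ∀ {x} → Word m x → ∀ y → dinv (foldr ins F x ++ y) + length x ≡ dinv (F ++ y ++ x)
    dinv-foldr-ins {[]}    _               y = trans (+-identityʳ _) (cong (λ z → dinv (F ++ z)) (sym (++-identityʳ y)))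
    dinv-foldr-ins {a ∷ x} W@(word l (_ ∷ <m)) y = begin
      dinv (ins a (foldr ins F x) ++ y) + suc (length x)
        ≡⟨ +-assoc (dinv (ins a (foldr ins F x) ++ y)) 1 (length x) ⟨
      dinv (ins a (foldr ins F x) ++ y) + 1 + length x
        ≡⟨ cong (_+ length x) (dinv-ins (foldr-insertion W) y) ⟩
      dinv (foldr ins F x ++ y ++ [ a ]) + length x
        ≡⟨ dinv-foldr-ins (word (Linked.tail l) <m) (y ++ [ a ]) ⟩
      dinv (F ++ (y ++ [ a ]) ++ x)
        ≡⟨ cong (λ z → dinv (F ++ z)) (++-assoc y [ a ] x) ⟩
      dinv (F ++ y ++ a ∷ x) ∎
      where open ≡-Reasoning

    length-foldr-ins : ∀ {x} → Word m x → length (foldr ins F x) ≡ length F + length x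
    length-foldr-ins {[]}    _ = sym (+-identityʳ _)
    length-foldr-ins {a ∷ x} W@(word l (_ ∷ <m)) = trans (length-ins (foldr-insertion W))
      (trans (cong suc (length-foldr-ins (word (Linked.tail l) <m))) (sym (+-suc (length F) (length x))))

    sum-foldr-ins : ∀ {x} → Word m x → sum (foldr ins F x) ≡ sum F + sum x + length x
    sum-foldr-ins {[]}    _ = sym (trans (+-identityʳ _) (+-identityʳ _))
    sum-foldr-ins {a ∷ x} W@(word l (_ ∷ <m)) = trans (sum-ins (foldr-insertion W))
      (trans (cong (_+ suc a) (sum-foldr-ins (word (Linked.tail l) <m)))
        (solve 4 (λ f x l a → f :+ x :+ l :+ (con 1 :+ a) := f :+ (a :+ x) :+ (con 1 :+ l)) refl
          (sum F) (sum x) (length x) a))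

  -- `dinv` in terms of letter multiplicities

  content : Seq → List ℕ
  content []      = []
  content (a ∷ s) = inc a (content s)

  at-content : ∀ s b → at (content s) b ≡ count b s
  at-content []      b = refl
  at-content (a ∷ s) b = trans (go (b ≟ a)) (sym (count-++ b [ a ] s))
    where
    go : Dec (b ≡ a) → at (inc a (content s)) b ≡ count b [ a ] + count b s
    go (yes refl) = trans (at-inc-≡ a (content s)) (cong₂ _+_ (sym (count-self a)) (at-content s a))
    go (no b≢a)   = trans (at-inc-≢ a b (content s) b≢a) (cong₂ _+_ (sym (count-≢ b≢a)) (at-content s b))

  below-content : ∀ s b → below (content s) b ≡ countBelow b s
  below-content s zero    = sym (countBelow-0 s)
  below-content s (suc b) = trans (at-content s b) (sym (countBelow-suc b s))

  -- The contribution to dinv of the reversed word r standing between F and a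
  -- suffix of content c, less one for each letter of r (the − |P| of the theorem).
  exponent : Seq → Seq → List ℕ → ℕ
  exponent F []      c = 0
  exponent F (a ∷ r) c =
    (count a F + count (suc a) F ∸ 1) + (below c a + at c a) + exponent F r (inc a c)

  dinv-exponent : ∀ F r s → All (λ a → 0 < count a F) r →
                  dinv (F ++ (r ʳ++ s)) ≡ exponent F r (content s) + length r + dinv (F ++ s)
  dinv-exponent F []      s []         = refl
  dinv-exponent F (a ∷ r) s (a∈ ∷ r∈) = begin
    dinv (F ++ (r ʳ++ (a ∷ s)))
      ≡⟨ dinv-exponent F r (a ∷ s) r∈ ⟩
    ε + length r + dinv (F ++ a ∷ s)
      ≡⟨ cong (ε + length r +_) (dinv-insert F a s) ⟩
    ε + length r + (dinv (F ++ s) + (count a F + count (suc a) F) + (countBelow a s + count a s))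
      -- As `a` occurs in `F`, the truncated subtraction in `exponent` is a true one.
      ≡⟨ cong₂ (λ i j → ε + length r + (dinv (F ++ s) + i + j)) (m+[n∸m]≡n (m≤n⇒m≤n+o (count (suc a) F) a∈))
           (cong₂ _+_ (below-content s a) (at-content s a)) ⟨
    ε + length r + (dinv (F ++ s) + (1 + k) + (below (content s) a + at (content s) a))
      ≡⟨ solve 6 (λ ε l d k i j → ε :+ l :+ (d :+ (con 1 :+ k) :+ (i :+ j)) := k :+ (i :+ j) :+ ε :+ (con 1 :+ l) :+ d) refl
           ε (length r) (dinv (F ++ s)) k (below (content s) a) (at (content s) a) ⟩
    exponent F (a ∷ r) (content s) + suc (length r) + dinv (F ++ s) ∎
    where
    open ≡-Reasoning
    ε = exponent F r (inc a (content s))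
    k = count a F + count (suc a) F ∸ 1

  -- Enumeration of columns, pairs of columns and tableaux

  module _ {a b} {A : Set a} {B : Set b} {f : A → List B} where

    ∈-bind⁺ : ∀ {xs x y} → x ∈ xs → y ∈ f x → y ∈ concatMap f xs
    ∈-bind⁺ x∈ y∈ = ∈-concatMap⁺ f (lose x∈ y∈)

    ∈-bind⁻ : ∀ {xs y} → y ∈ concatMap f xs → ∃ λ x → x ∈ xs × y ∈ f x
    ∈-bind⁻ {xs} y∈ = find (∈-concatMap⁻ f {xs = xs} y∈)

    bind-unique : ∀ {xs} → Unique xs → (∀ x → Unique (f x)) →
                  (∀ {x x′ y} → y ∈ f x → y ∈ f x′ → x ≡ x′) → Unique (concatMap f xs)
    bind-unique []              uf disj = []
    bind-unique {x ∷ xs} (x∉ ∷ u) uf disj = ++⁺ (uf x) (bind-unique u uf disj)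
      λ (y∈ , y∈′) → let x′ , x′∈ , y∈fx′ = ∈-bind⁻ {xs = xs} y∈′ in All.lookup x∉ x′∈ (disj y∈ y∈fx′)

  from-unique : ∀ k d → Unique (from k d)
  from-unique k zero    = []
  from-unique k (suc d) = All.tabulate (λ a∈ → <⇒≢ (proj₁ (∈-from⁻ (suc k) d a∈))) ∷ from-unique (suc k) d

  letters-unique : ∀ m p → Unique (letters m p)
  letters-unique m p = from-unique (p ∸ 1) (m ∸ (p ∸ 1))

  -- Columns run from top to bottom, so they are reversed words; p is the entry above.
  data Column (m : ℕ) : ℕ → Seq → Set where
    []  : ∀ {p} → Column m p []
    _∷_ : ∀ {p a r} → p ≤ suc a × a < m → Column m a r → Column m p (a ∷ r)

  column-< : ∀ {m p w} → Column m p w → All (_< m) w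
  column-< []              = []
  column-< ((_ , a<m) ∷ c) = a<m ∷ column-< c

  columns : ℕ → ℕ → ℕ → List Seq
  columns m p zero    = [] ∷ []
  columns m p (suc N) = concatMap (λ a → map (a ∷_) (columns m a N)) (letters m p)

  ∈-columns⁺ : ∀ {m p r} → Column m p r → r ∈ columns m p (length r)
  ∈-columns⁺ []                              = here refl
  ∈-columns⁺ {m} {p} ((p≤ , a<m) ∷ r) = ∈-bind⁺ (∈-letters⁺ m p p≤ a<m) (∈-map⁺ _ (∈-columns⁺ r))

  ∈-columns⁻ : ∀ {m} p {r} N → r ∈ columns m p N → Column m p r × length r ≡ N
  ∈-columns⁻ p zero (here refl) = [] , refl
  ∈-columns⁻ {m} p (suc N) r∈
    with a , a∈ , r∈′ ← ∈-bind⁻ {xs = letters m p} r∈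
    with r , r∈″ , refl ← ∈-map⁻ _ r∈′
    with r-column , refl ← ∈-columns⁻ a N r∈″
    = ∈-letters⁻ m p a∈ ∷ r-column , refl

  columns-unique : ∀ m p N → Unique (columns m p N)
  columns-unique m p zero    = [] ∷ []
  columns-unique m p (suc N) = bind-unique (letters-unique m p)
    (λ a → map⁺ ∷-injectiveʳ (columns-unique m a N)) disj
    where
    disj : ∀ {a a′ r} → r ∈ map (a ∷_) (columns m a N) → r ∈ map (a′ ∷_) (columns m a′ N) → a ≡ a′
    disj r∈ r∈′ with _ , _ , refl ← ∈-map⁻ _ r∈ | _ , _ , eq ← ∈-map⁻ _ r∈′ = ∷-injectiveˡ eq

  extend : ℕ → Seq × Seq → Seq × Seq
  extend a (x , y) = a ∷ x , y

  extend-injective : ∀ {a} {v w : Seq × Seq} → extend a v ≡ extend a w → v ≡ w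
  extend-injective refl = refl

  pairs : ℕ → ℕ → ℕ → List (Seq × Seq)
  pairs m p zero    = ([] , []) ∷ []
  pairs m p (suc N) = map ([] ,_) (columns m 0 (suc N)) ++
                      concatMap (λ a → map (extend a) (pairs m a N)) (letters m p)

  ∈-pairs⁺ : ∀ {m p x y} → Column m p x → Column m 0 y → (x , y) ∈ pairs m p (length x + length y)
  ∈-pairs⁺ {y = []}    []               []  = here refl
  ∈-pairs⁺ {y = b ∷ y} []               y-c = ∈-++⁺ˡ (∈-map⁺ ([] ,_) (∈-columns⁺ y-c))
  ∈-pairs⁺ {m} {p} {a ∷ x} {y} ((p≤ , a<m) ∷ x-c) y-c =
    ∈-++⁺ʳ (map ([] ,_) (columns m 0 (suc (length x + length y))))
      (∈-bind⁺ (∈-letters⁺ m p p≤ a<m) (∈-map⁺ (extend a) (∈-pairs⁺ x-c y-c)))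

  ∈-pairs⁻ : ∀ {m} p {x y} N → (x , y) ∈ pairs m p N →
             Column m p x × Column m 0 y × length x + length y ≡ N
  ∈-pairs⁻ p zero (here refl) = [] , [] , refl
  ∈-pairs⁻ {m} p (suc N) v∈ with ∈-++⁻ (map ([] ,_) (columns m 0 (suc N))) v∈
  ... | inj₁ v∈′ with y , y∈ , refl ← ∈-map⁻ ([] ,_) v∈′ =
    [] , ∈-columns⁻ 0 (suc N) y∈
  ... | inj₂ v∈′ with a , a∈ , v∈″ ← ∈-bind⁻ {xs = letters m p} v∈′
                 with (x , y) , w∈ , refl ← ∈-map⁻ (extend a) v∈″
                 with x-c , y-c , refl ← ∈-pairs⁻ a N w∈
    = ∈-letters⁻ m p a∈ ∷ x-c , y-c , refl

  pairs-unique : ∀ m p N → Unique (pairs m p N)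
  pairs-unique m p zero    = [] ∷ []
  pairs-unique m p (suc N) = ++⁺ (map⁺ (λ { refl → refl }) (columns-unique m 0 (suc N)))
    (bind-unique (letters-unique m p) (λ a → map⁺ extend-injective (pairs-unique m a N)) disj)
    λ (v∈ , v∈′) → apart v∈ v∈′
    where
    disj : ∀ {a a′ v} → v ∈ map (extend a) (pairs m a N) → v ∈ map (extend a′) (pairs m a′ N) → a ≡ a′
    disj v∈ v∈′ with _ , _ , refl ← ∈-map⁻ (extend _) v∈ | _ , _ , refl ← ∈-map⁻ (extend _) v∈′ = refl
    apart : ∀ {v} → v ∈ map ([] ,_) (columns m 0 (suc N)) →
            v ∈ concatMap (λ a → map (extend a) (pairs m a N)) (letters m p) → ⊥
    apart v∈ v∈′     with _ , _ , refl ← ∈-map⁻ _ v∈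
                     with _ , _ , v∈″ ← ∈-bind⁻ {xs = letters m p} v∈′
                     with _ , _ , () ← ∈-map⁻ _ v∈″

  -- p and r are the entries above the first row.
  data TwoColumn (m : ℕ) : ℕ → ℕ → Tableau ℕ → Set where
    column : ∀ {p r w} → Column m p w → TwoColumn m p r (map [_] w)
    pair   : ∀ {p r a b P} → p ≤ suc a → suc a < b → r ≤ suc b × b < m →
             TwoColumn m a b P → TwoColumn m p r ((a ∷ b ∷ []) ∷ P)

  -- In a top row `a`, `b` the entry `b` is chosen first, being nearer to the suffix in the reading
  -- word; the bound `b ∸ 1` on the letters for `a` encodes the gap `a + 2 ≤ b`.
  tableaux : ℕ → ℕ → ℕ → ℕ → List (Tableau ℕ)
  tableaux-pairs : ℕ → ℕ → ℕ → ℕ → List (Tableau ℕ)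
  tableaux m p r N = map (map [_]) (columns m p N) ++ tableaux-pairs m p r N
  tableaux-pairs m p r (suc (suc N)) = concatMap (λ b → concatMap (λ a →
    map ((a ∷ b ∷ []) ∷_) (tableaux m a b N)) (letters (b ∸ 1) p)) (letters m r)
  tableaux-pairs m p r _             = []

  cells-column : (w : Seq) → cells (map [_] w) ≡ length w
  cells-column []      = refl
  cells-column (a ∷ w) = cong suc (cells-column w)

  ∈-tableaux⁺ : ∀ {m p r P} → TwoColumn m p r P → P ∈ tableaux m p r (cells P)
  ∈-tableaux⁺ {m} {p} {r} (column {w = w} c) =
    subst (λ N → map [_] w ∈ tableaux m p r N) (sym (cells-column w)) (∈-++⁺ˡ (∈-map⁺ (map [_]) (∈-columns⁺ c)))
  ∈-tableaux⁺ {m} {p} {r} (pair {a = a} {b} {P} p≤ a<b (r≤ , b<m) t) =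
    ∈-++⁺ʳ (map (map [_]) (columns m p (2 + cells P)))
      (∈-bind⁺ (∈-letters⁺ m r r≤ b<m) (∈-bind⁺ (∈-letters⁺ (b ∸ 1) p p≤ (∸-monoˡ-≤ 1 a<b))
        (∈-map⁺ _ (∈-tableaux⁺ t))))

  ∈-tableaux⁻ : ∀ {m} p r {P} N → P ∈ tableaux m p r N → TwoColumn m p r P × cells P ≡ N
  ∈-pairs-tableaux⁻ : ∀ {m} p r {P} N → P ∈ tableaux-pairs m p r N → TwoColumn m p r P × cells P ≡ N
  ∈-tableaux⁻ {m} p r N P∈ with ∈-++⁻ (map (map [_]) (columns m p N)) P∈
  ... | inj₁ P∈′ with w , w∈ , refl ← ∈-map⁻ _ P∈′ with c , refl ← ∈-columns⁻ p N w∈ =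
    column c , cells-column w
  ... | inj₂ P∈′ = ∈-pairs-tableaux⁻ p r N P∈′
  ∈-pairs-tableaux⁻ {m} p r (suc (suc N)) P∈
    with b , b∈ , P∈′ ← ∈-bind⁻ {xs = letters m r} P∈
    with a , a∈ , P∈″ ← ∈-bind⁻ {xs = letters (b ∸ 1) p} P∈′
    with P , P∈‴ , refl ← ∈-map⁻ _ P∈″
    with t , refl ← ∈-tableaux⁻ a b N P∈‴
    with p≤ , a<b ← ∈-letters⁻ (b ∸ 1) p a∈
    = pair p≤ (pred-< b a<b) (∈-letters⁻ m r b∈) t , refl
    where
    pred-< : ∀ b {a} → a < b ∸ 1 → suc a < b
    pred-< (suc b) a<b = s≤s a<b

  tableaux-unique : ∀ m p r N → Unique (tableaux m p r N)
  tableaux-pairs-unique : ∀ m p r N → Unique (tableaux-pairs m p r N)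
  tableaux-unique m p r N = ++⁺ (map⁺ (map-injective ∷-injectiveˡ) (columns-unique m p N))
    (tableaux-pairs-unique m p r N) (λ (P∈ , P∈′) → apart N P∈ P∈′)
    where
    apart : ∀ N {P} → P ∈ map (map [_]) (columns m p N) → P ∈ tableaux-pairs m p r N → ⊥
    apart (suc (suc N)) P∈ P∈′
      with w , _ , refl ← ∈-map⁻ _ P∈
      with b , _ , P∈″ ← ∈-bind⁻ {xs = letters m r} P∈′
      with a , _ , P∈‴ ← ∈-bind⁻ {xs = letters (b ∸ 1) p} P∈″
      with _ , _ , eq ← ∈-map⁻ _ P∈‴ = clash w eq
      where
      clash : ∀ w {a b : ℕ} {P} → map [_] w ≢ (a ∷ b ∷ []) ∷ P
      clash (_ ∷ _) ()
  tableaux-pairs-unique m p r 0             = []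
  tableaux-pairs-unique m p r 1             = []
  tableaux-pairs-unique m p r (suc (suc N)) = bind-unique (letters-unique m r)
    (λ b → bind-unique (letters-unique (b ∸ 1) p) (λ a → map⁺ ∷-injectiveʳ (tableaux-unique m a b N))
      (λ P∈ P∈′ → ∷-injectiveˡ (first-row P∈ P∈′)))
    λ {b} {b′} P∈ P∈′ → let _ , _ , Q∈  = ∈-bind⁻ {xs = letters (b ∸ 1) p} P∈
                            _ , _ , Q∈′ = ∈-bind⁻ {xs = letters (b′ ∸ 1) p} P∈′
                        in ∷-injectiveˡ (∷-injectiveʳ (first-row Q∈ Q∈′))
    where
    first-row : ∀ {R R′ : Seq} {X Y : List (Tableau ℕ)} {P : Tableau ℕ} → P ∈ map (R ∷_) X → P ∈ map (R′ ∷_) Y → R ≡ R′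
    first-row {R} {R′} P∈ P∈′ with _ , _ , refl ← ∈-map⁻ (R ∷_) P∈ | _ , _ , eq ← ∈-map⁻ (R′ ∷_) P∈′ = ∷-injectiveˡ eq

  -- The enumerated tableaux are the two-column Dyck tableaux

  Under : ℕ → ℕ → Tableau ℕ → Set
  Under p r ((a ∷ [])    ∷ _) = p ≤ suc a
  Under p r ((a ∷ b ∷ _) ∷ _) = p ≤ suc a × r ≤ suc b
  Under p r _                 = ⊤

  Columnwise≤ : List ℕ → List ℕ → Set
  Columnwise≤ = Columnwise (λ u v → u ≤ v + 1)

  columnwise⇒under : ∀ {p r P} T → Columnwise≤ (p ∷ r ∷ []) T → Under p r (T ∷ P)
  columnwise⇒under []          _            = tt
  columnwise⇒under (a ∷ [])    (h ∷ _)      = ≤+1⇒≤suc h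
  columnwise⇒under (a ∷ b ∷ _) (h ∷ h′ ∷ _) = ≤+1⇒≤suc h , ≤+1⇒≤suc h′

  under⇒columnwise : ∀ {p r T P} → Under p r (T ∷ P) → Columnwise≤ (p ∷ r ∷ []) T
  under⇒columnwise {T = []}        _        = []
  under⇒columnwise {T = a ∷ []}    h        = ≤suc⇒≤+1 h ∷ []
  under⇒columnwise {T = a ∷ b ∷ _} (h , h′) = ≤suc⇒≤+1 h ∷ ≤suc⇒≤+1 h′ ∷ []

  single-column : ∀ {m a} P → All (λ T → 0 < length T) P → Linked _≥_ (shape ([ a ] ∷ P)) →
                  Linked Columnwise≤ ([ a ] ∷ P) → All (All (_< m)) P →
                  ∃ λ w → P ≡ map [_] w × Column m a w
  single-column []                _        _             _                 _                = [] , refl , []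
  single-column ([]          ∷ P) (() ∷ _) _             _                 _
  single-column ((b ∷ c ∷ T) ∷ P) _        (s≤s () ∷ _) _                 _
  single-column ((b ∷ [])    ∷ P) (_ ∷ ne) (_ ∷ part)    ((h ∷ []) ∷ cols) ((b<m ∷ []) ∷ es)
    with w , refl , c ← single-column P ne part cols es
    = b ∷ w , refl , (≤+1⇒≤suc h , b<m) ∷ c

  twoColumn : ∀ {m p r} P → All (λ T → 0 < length T) P → Linked _≥_ (shape P) →
              All (Linked (λ u v → v ≥ u + 2)) P → Linked Columnwise≤ P →
              All (λ T → length T ≤ 2) P → All (All (_< m)) P → Under p r P → TwoColumn m p r P
  twoColumn [] _ _ _ _ _ _ _ = column {w = []} []
  twoColumn ([] ∷ P) (() ∷ _)
  twoColumn ((a ∷ []) ∷ P) (_ ∷ ne) part rows cols ≤2 ((a<m ∷ []) ∷ es) p≤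
    with w , refl , c ← single-column P ne part cols es = column {w = a ∷ w} ((p≤ , a<m) ∷ c)
  twoColumn ((a ∷ b ∷ _ ∷ _) ∷ P) _ _ _ _ (s≤s (s≤s ()) ∷ _)
  twoColumn ((a ∷ b ∷ []) ∷ P) (_ ∷ ne) part ((a<b ∷ _) ∷ rows) cols (_ ∷ ≤2) ((_ ∷ b<m ∷ []) ∷ es) (p≤ , r≤) =
    pair p≤ (subst (_≤ b) (+-comm a 2) a<b) (r≤ , b<m)
      (twoColumn P ne (Linked.tail part) rows (Linked.tail cols) ≤2 es (next cols))
    where
    next : ∀ {P} → Linked Columnwise≤ ((a ∷ b ∷ []) ∷ P) → Under a b P
    next [-]               = tt
    next {T ∷ _} (c ∷ _) = columnwise⇒under T c

  twoColumn⁻ : ∀ {m p r P} → TwoColumn m p r P →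
               IsDyckTableau P × All (λ T → length T ≤ 2) P × All (All (_< m)) P × Under p r P
  twoColumn⁻ (column {w = w} c) = record
    { nonempty-rows = All.map⁺ (All.universal (λ _ → s≤s z≤n) w)
    ; partition     = partition w
    ; rows          = All.map⁺ (All.universal (λ _ → [-]) w)
    ; columns       = cols c
    } , All.map⁺ (All.universal (λ _ → s≤s z≤n) w) , entries c , under c
    where
    partition : ∀ (w : Seq) → Linked _≥_ (shape (map [_] w))
    partition []          = []
    partition (_ ∷ [])    = [-]
    partition (_ ∷ b ∷ w) = ≤-refl ∷ partition (b ∷ w)
    cols : ∀ {m p w} → Column m p w → Linked Columnwise≤ (map [_] w)
    cols []                              = []
    cols (_ ∷ [])                       = [-]
    cols (_ ∷ c@((h , _) ∷ _)) = (≤suc⇒≤+1 h ∷ []) ∷ cols c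
    entries : ∀ {m p w} → Column m p w → All (All (_< m)) (map [_] w)
    entries []              = []
    entries ((_ , a<m) ∷ c) = (a<m ∷ []) ∷ entries c
    under : ∀ {m p r w} → Column m p w → Under p r (map [_] w)
    under []            = tt
    under ((p≤ , _) ∷ _) = p≤
  twoColumn⁻ (pair {a = a} {b} {P} p≤ a<b (r≤ , b<m) t)
    with record { nonempty-rows = ne ; partition = part ; rows = rows ; columns = cols } , ≤2 , es , un ← twoColumn⁻ t
    = record
    { nonempty-rows = s≤s z≤n ∷ ne
    ; partition     = partition ≤2 part
    ; rows          = (subst (_≤ b) (+-comm 2 a) a<b ∷ [-]) ∷ rows
    ; columns       = columns′ un cols
    } , ≤-refl ∷ ≤2 , (<-trans (<-trans (n<1+n a) a<b) b<m ∷ b<m ∷ []) ∷ es , (p≤ , r≤)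
    where
    partition : ∀ {P : Tableau ℕ} → All (λ T → length T ≤ 2) P → Linked _≥_ (shape P) → Linked _≥_ (2 ∷ shape P)
    partition []       _ = [-]
    partition (≤2 ∷ _) l = ≤2 ∷ l
    columns′ : ∀ {P} → Under a b P → Linked Columnwise≤ P → Linked Columnwise≤ ((a ∷ b ∷ []) ∷ P)
    columns′ {[]}    _  _ = [-]
    columns′ {T ∷ P} un l = under⇒columnwise {T = T} {P} un ∷ l

  -- Reversal turns the column condition `p ≤ a + 1`, with `p` above `a`, into an ascent from `a` to
  -- `p` of at most 1; `s` is the part already reversed.
  column-word : ∀ {m p r} → Column m p r → ∀ {s} → Word m s → (∀ {b s′} → s ≡ b ∷ s′ → b ≤ p) → Word m (r ʳ++ s)
  column-word []              W _ = W
  column-word ((p≤ , a<m) ∷ c) (word l <m) b≤ =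
    column-word c (word (cons l b≤) (a<m ∷ <m)) λ { refl → ≤-refl }
    where
    cons : ∀ {s} → Linked Ascent s → (∀ {b s′} → s ≡ b ∷ s′ → b ≤ _) → Linked Ascent (_ ∷ s)
    cons []         _  = [-]
    cons [-]        b≤ = ≤suc⇒≤+1 (≤-trans (b≤ refl) p≤) ∷ [-]
    cons (l ∷ ls) b≤ = ≤suc⇒≤+1 (≤-trans (b≤ refl) p≤) ∷ l ∷ ls

  column⇒word : ∀ {m r} → Column m 0 r → Word m (reverse r)
  column⇒word {r = []}    c                 = word [] []
  column⇒word {r = a ∷ r} ((_ , a<m) ∷ c) = column-word c (word [-] (a<m ∷ [])) λ { refl → ≤-refl }

  word-column : ∀ {m a s} → Word m (a ∷ s) → ∀ {r} → Column m a r → Column m 0 (s ʳ++ (a ∷ r))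
  word-column (word [-]      (a<m ∷ _))  c = (z≤n , a<m) ∷ c
  word-column (word (h ∷ l) (a<m ∷ <m)) c = word-column (word l <m) ((≤+1⇒≤suc h , a<m) ∷ c)

  word⇒column : ∀ {m w} → Word m w → Column m 0 (reverse w)
  word⇒column {w = []}    _ = []
  word⇒column {w = a ∷ w} W = word-column W []

  reversedRR : Tableau ℕ → Seq
  reversedRR []      = []
  reversedRR (T ∷ P) = reverse T ++ reversedRR P

  RR-∷ : ∀ T P → RR (T ∷ P) ≡ RR P ++ T
  RR-∷ T P = trans (cong concat (unfold-reverse T P))
    (trans (sym (concat-++ (reverse P) [ T ])) (cong (RR P ++_) concat-[ T ]))

  reverse-reversedRR : ∀ P → reverse (reversedRR P) ≡ RR P
  reverse-reversedRR []      = refl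
  reverse-reversedRR (T ∷ P) = trans (reverse-++ (reverse T) (reversedRR P))
    (trans (cong₂ _++_ (reverse-reversedRR P) (reverse-involutive T)) (sym (RR-∷ T P)))

  reversedRR-column : (w : Seq) → reversedRR (map [_] w) ≡ w
  reversedRR-column []      = refl
  reversedRR-column (a ∷ w) = cong (a ∷_) (reversedRR-column w)

  -- Semistandard fillings with two letters

  pattern 1F = sucF 0F

  Weakly : Fin 2 → Fin 2 → Set
  Weakly u v = toℕ u ≤ toℕ v

  Strictly : Fin 2 → Fin 2 → Set
  Strictly u v = toℕ u < toℕ v

  weakRows : ℕ → List (List (Fin 2))
  weakRows zero    = [] ∷ []
  weakRows (suc k) = map (0F ∷_) (weakRows k) ++ [ replicate (suc k) 1F ]

  linked-0 : ∀ {r} → Linked Weakly r → Linked Weakly (0F ∷ r)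
  linked-0 []      = [-]
  linked-0 [-]     = z≤n ∷ [-]
  linked-0 (l ∷ r) = z≤n ∷ l ∷ r

  linked-0s : ∀ d {r} → Linked Weakly r → Linked Weakly (replicate d 0F ++ r)
  linked-0s zero    l = l
  linked-0s (suc d) l = linked-0 (linked-0s d l)

  linked-1s : ∀ k → Linked Weakly (replicate k 1F)
  linked-1s 0             = []
  linked-1s 1             = [-]
  linked-1s (suc (suc k)) = s≤s z≤n ∷ linked-1s (suc k)

  ones : ∀ {r} → Linked Weakly (1F ∷ r) → 1F ∷ r ≡ replicate (suc (length r)) 1F
  ones [-]                = refl
  ones {1F ∷ r} (_ ∷ l) = cong (1F ∷_) (ones l)
  ones {0F ∷ r} (() ∷ l)

  ∈-weakRows⁺ : ∀ {r} → Linked Weakly r → r ∈ weakRows (length r)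
  ∈-weakRows⁺ {[]}     _ = here refl
  ∈-weakRows⁺ {0F ∷ r} l = ∈-++⁺ˡ (∈-map⁺ (0F ∷_) (∈-weakRows⁺ (Linked.tail l)))
  ∈-weakRows⁺ {1F ∷ r} l = ∈-++⁺ʳ (map (0F ∷_) (weakRows (length r))) (here (ones l))

  ∈-weakRows⁻ : ∀ k {r} → r ∈ weakRows k → Linked Weakly r × length r ≡ k
  ∈-weakRows⁻ zero    (here refl) = [] , refl
  ∈-weakRows⁻ (suc k) r∈ with ∈-++⁻ (map (0F ∷_) (weakRows k)) r∈
  ... | inj₂ (here refl) = linked-1s (suc k) , length-replicate (suc k)
  ... | inj₁ r∈′ with r , r∈″ , refl ← ∈-map⁻ (0F ∷_) r∈′ with l , eq ← ∈-weakRows⁻ k r∈″ =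
    linked-0 l , cong suc eq

  weakRows-unique : ∀ k → Unique (weakRows k)
  weakRows-unique zero    = [] ∷ []
  weakRows-unique (suc k) = ++⁺ (map⁺ ∷-injectiveʳ (weakRows-unique k)) ([] ∷ []) λ { (r∈ , here refl) → apart r∈ }
    where
    apart : replicate (suc k) 1F ∈ map (0F ∷_) (weakRows k) → ⊥
    apart r∈ with _ , _ , () ← ∈-map⁻ (0F ∷_) r∈

  oneRow : List (Fin 2) → Tableau (Fin 2)
  oneRow r = r ∷ []

  twoRows : ℕ → List (Fin 2) → Tableau (Fin 2)
  twoRows d r = (replicate d 0F ++ r) ∷ replicate d 1F ∷ []

  -- With two letters a column of height 2 must be `0F` over `1F`, so only the `k` cells to the
  -- right of the first `d` columns are free.
  fillings : ℕ → ℕ → List (Tableau (Fin 2))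
  fillings (suc d) k       = map (twoRows (suc d)) (weakRows k)
  fillings zero    (suc k) = map oneRow (weakRows (suc k))
  fillings zero    zero    = [ [] ]

  -- The case distinction omits parts equal to 0, in agreement with `conjugate`.
  conj : ℕ → ℕ → List ℕ
  conj (suc d) k       = suc d + k ∷ suc d ∷ []
  conj zero    (suc k) = suc k ∷ []
  conj zero    zero    = []

  fillings-unique : ∀ d k → Unique (fillings d k)
  fillings-unique (suc d) k       = map⁺ (λ eq → ++-cancelˡ (replicate (suc d) 0F) _ _ (∷-injectiveˡ eq)) (weakRows-unique k)
  fillings-unique zero    (suc k) = map⁺ ∷-injectiveˡ (weakRows-unique (suc k))
  fillings-unique zero    zero    = [] ∷ []

  strict-columns : ∀ d r → Columnwise Strictly (replicate d 0F ++ r) (replicate d 1F)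
  strict-columns zero    []      = []
  strict-columns zero    (_ ∷ r) = []
  strict-columns (suc d) r       = s≤s z≤n ∷ strict-columns d r

  strict-columns⁻ : ∀ d k R₀ R₁ → length R₀ ≡ d + k → length R₁ ≡ d → Columnwise Strictly R₀ R₁ →
                    ∃ λ r → R₀ ≡ replicate d 0F ++ r × R₁ ≡ replicate d 1F × length r ≡ k
  strict-columns⁻ zero    k R₀        []        l₀ _  _ = R₀ , refl , refl , l₀
  strict-columns⁻ (suc d) k (0F ∷ R₀) (1F ∷ R₁) l₀ l₁ (_ ∷ c)
    with r , refl , refl , l ← strict-columns⁻ d k R₀ R₁ (suc-injective l₀) (suc-injective l₁) c
    = r , refl , refl , l
  strict-columns⁻ (suc d) k (0F ∷ R₀) (0F ∷ R₁) l₀ l₁ (() ∷ c)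
  strict-columns⁻ (suc d) k (1F ∷ R₀) (0F ∷ R₁) l₀ l₁ (() ∷ c)
  strict-columns⁻ (suc d) k (1F ∷ R₀) (1F ∷ R₁) l₀ l₁ (s≤s () ∷ c)

  linked-drop : ∀ d {r} → Linked Weakly (replicate d 0F ++ r) → Linked Weakly r
  linked-drop zero    l = l
  linked-drop (suc d) l = linked-drop d (Linked.tail l)

  ∈-fillings⁺ : ∀ d k {T} → IsSSYT 2 (conj d k) T → T ∈ fillings d k
  ∈-fillings⁺ (suc d) k {R₀ ∷ R₁ ∷ []} record { has-shape = sh ; rows = l₀ ∷ _ ∷ [] ; columns = c ∷ [-] }
    with r , refl , refl , refl ← strict-columns⁻ (suc d) k R₀ R₁
           (∷-injectiveˡ sh) (∷-injectiveˡ (∷-injectiveʳ sh)) c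
    = ∈-map⁺ (twoRows (suc d)) (∈-weakRows⁺ (linked-drop (suc d) l₀))
  ∈-fillings⁺ zero (suc k) {r ∷ []} record { has-shape = sh ; rows = l ∷ [] } =
    ∈-map⁺ oneRow (subst (λ n → r ∈ weakRows n) (∷-injectiveˡ sh) (∈-weakRows⁺ l))
  ∈-fillings⁺ zero zero {[]} _ = here refl

  ∈-fillings⁻ : ∀ d k {T} → T ∈ fillings d k → IsSSYT 2 (conj d k) T
  ∈-fillings⁻ (suc d) k T∈
    with r , r∈ , refl ← ∈-map⁻ (twoRows (suc d)) T∈ with l , refl ← ∈-weakRows⁻ k r∈ = record
    { has-shape = cong₂ (λ a b → a ∷ b ∷ [])
        (trans (length-++ (replicate (suc d) 0F)) (cong (_+ length r) (length-replicate (suc d))))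
        (length-replicate (suc d))
    ; rows      = linked-0s (suc d) l ∷ linked-1s (suc d) ∷ []
    ; columns   = strict-columns (suc d) r ∷ [-]
    }
  ∈-fillings⁻ zero (suc k) T∈ with r , r∈ , refl ← ∈-map⁻ oneRow T∈ with l , eq ← ∈-weakRows⁻ (suc k) r∈ = record
    { has-shape = cong [_] eq ; rows = l ∷ [] ; columns = [-] }
  ∈-fillings⁻ zero zero (here refl) = record { has-shape = refl ; rows = [] ; columns = [] }

  twoColumnShape : ℕ → ℕ → List ℕ
  twoColumnShape d k = replicate d 2 ++ replicate k 1

  conjugate-twoColumnShape : ∀ d k → conjugate (twoColumnShape d k) ≡ conj d k
  conjugate-twoColumnShape (suc d) k = cong₂ (λ i j → suc i ∷ suc j ∷ []) (count0 d) (count1 d)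
    where
    count0 : ∀ d → length (filter (0 <?_) (twoColumnShape d k)) ≡ d + k
    count0 (suc d) = cong suc (count0 d)
    count0 zero    = trans (cong length (filter-all (0 <?_) {replicate k 1} (All.replicate⁺ k (s≤s z≤n)))) (length-replicate k)
    count1 : ∀ d → length (filter (1 <?_) (twoColumnShape d k)) ≡ d
    count1 (suc d) = cong suc (count1 d)
    count1 zero    = cong length (filter-none (1 <?_) {replicate k 1} (All.replicate⁺ k λ { (s≤s ()) }))
  conjugate-twoColumnShape zero (suc k) = cong (λ i → suc i ∷ [])
    (trans (cong length (filter-all (0 <?_) {replicate k 1} (All.replicate⁺ k (s≤s z≤n)))) (length-replicate k))
  conjugate-twoColumnShape zero zero = refl

  -- Dyck sequences as triples (F , x , y)

  sum-reverse : ∀ w → sum (reverse w) ≡ sum w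
  sum-reverse w = sum-↭ (↭-reverse w)

  map-unique : ∀ {a b} {A : Set a} {B : Set b} {f : A → B} {xs} → Unique xs →
               (∀ {x y} → x ∈ xs → y ∈ xs → f x ≡ f y → x ≡ y) → Unique (map f xs)
  map-unique []       inj = []
  map-unique (x∉ ∷ u) inj =
    All.map⁺ (All.tabulate λ y∈ eq → All.lookup x∉ y∈ (inj (here refl) (there y∈) eq))
    ∷ map-unique u λ x∈ y∈ → inj (there x∈) (there y∈)

  Skeleton≤ : ℕ → Seq → Set
  Skeleton≤ n F = IsSkeleton (max 0 F) F × length F ≤ n

  skeletons : ∀ n → Listing (Skeleton≤ n)
  skeletons n = listing (λ F → isSkeleton? (max 0 F) F ×-dec (length F ≤? n)) (words (upTo n) n)
    (words-unique (upTo⁺ n) n)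
    λ { (s , F≤n) → ∈-words n F≤n
          (All.map (λ h → ∈-upTo⁺ (<-≤-trans h F≤n)) (dyck-bound (IsSkeleton.isDyck s))) }

  module _ {a} {A : Set a} (n : ℕ) (fiber : ℕ → ℕ → List A) where

    -- Both sums of the theorem are brought into this form, so that they can be compared skeleton by
    -- skeleton.
    overSkeletons : List (Seq × A)
    overSkeletons = concatMap (λ F → map (F ,_) (fiber (max 0 F) (n ∸ length F))) (Listing.list (skeletons n))

    ∈-overSkeletons⁺ : ∀ {F v} → Skeleton≤ n F → v ∈ fiber (max 0 F) (n ∸ length F) → (F , v) ∈ overSkeletons
    ∈-overSkeletons⁺ s v∈ = ∈-bind⁺ (Listing.complete (skeletons n) s) (∈-map⁺ (_ ,_) v∈)

    ∈-overSkeletons⁻ : ∀ {F v} → (F , v) ∈ overSkeletons → Skeleton≤ n F × v ∈ fiber (max 0 F) (n ∸ length F)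
    ∈-overSkeletons⁻ Fv∈ with F , F∈ , Fv∈′ ← ∈-bind⁻ {xs = Listing.list (skeletons n)} Fv∈
      with v , v∈ , refl ← ∈-map⁻ (F ,_) Fv∈′ = Listing.sound (skeletons n) F∈ , v∈

    overSkeletons-unique : (∀ m N → Unique (fiber m N)) → Unique overSkeletons
    overSkeletons-unique u = bind-unique (Listing.unique (skeletons n))
      (λ F → map⁺ (λ { refl → refl }) (u (max 0 F) (n ∸ length F))) disj
      where
      disj : ∀ {F F′ v} {X Y : List A} → v ∈ map (F ,_) X → v ∈ map (F′ ,_) Y → F ≡ F′
      disj {F} {F′} v∈ v∈′ with _ , _ , refl ← ∈-map⁻ (F ,_) v∈ | _ , _ , eq ← ∈-map⁻ (F′ ,_) v∈′ =
        cong proj₁ eq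

  join : Seq × (Seq × Seq) → Seq
  join (F , x , y) = foldr ins F (reverse x) ++ reverse y

  module _ {F x y} (s : IsSkeleton (max 0 F) F)
           (x-column : Column (max 0 F) 0 x) (y-column : Column (max 0 F) 0 y) where

    private
      F-core = skeleton⇒core s
      G      = foldr ins F (reverse x)

    join-dyck : IsDyck (join (F , x , y))
    join-dyck with foldr-ins F-core (column⇒word x-column)
    ... | inserted eq p _ = record
      { starts-at-0 = cong (λ G → head (G ++ reverse y)) eq
      ; steps       = path-++ p (column⇒word y-column) }

    join-length : length (join (F , x , y)) ≡ length F + (length x + length y)
    join-length = begin
      length (G ++ reverse y)                           ≡⟨ length-++ G ⟩
      length G + length (reverse y)                   ≡⟨ cong₂ _+_ (length-foldr-ins F-core (column⇒word x-column)) (length-reverse y) ⟩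
      length F + length (reverse x) + length y      ≡⟨ cong (λ k → length F + k + length y) (length-reverse x) ⟩
      length F + length x + length y                ≡⟨ +-assoc (length F) (length x) (length y) ⟩
      length F + (length x + length y)              ∎
      where open ≡-Reasoning

  join-injective : ∀ {F x y F′ x′ y′} → IsSkeleton (max 0 F) F → Column (max 0 F) 0 x → Column (max 0 F) 0 y →
                   IsSkeleton (max 0 F′) F′ → Column (max 0 F′) 0 x′ → Column (max 0 F′) 0 y′ →
                   join (F , x , y) ≡ join (F′ , x′ , y′) → (F , x , y) ≡ (F′ , x′ , y′)
  join-injective {F} {x} {y} {F′} {x′} {y′} s c d s′ c′ d′ eq
    with inserted _ p _  ← foldr-ins (skeleton⇒core s) (column⇒word c)
       | inserted _ p′ _ ← foldr-ins (skeleton⇒core s′) (column⇒word c′)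
    with G≡ , y≡ ← split-unique p p′ (Word.small (column⇒word d)) (Word.small (column⇒word d′)) eq
    with max≡ ← trans (sym (path-max p)) (trans (cong (max 0) G≡) (path-max p′))
    with refl , x≡ ← foldr-ins-injective (skeleton⇒core s)
           (subst (λ m → IsCore m F′) (sym max≡) (skeleton⇒core s′)) (column⇒word c)
           (subst (λ m → Word m (reverse x′)) (sym max≡) (column⇒word c′)) G≡
    = cong₂ (λ x y → F , x , y) (reverse-injective x≡) (reverse-injective y≡)

  join-surjective : ∀ {D} → IsDyck D → ∃ λ F → ∃₂ λ x y → IsSkeleton (max 0 F) F ×
                    Column (max 0 F) 0 x × Column (max 0 F) 0 y × join (F , x , y) ≡ D
  join-surjective {c ∷ D} record { starts-at-0 = refl ; steps = l } =
    assemble (split (0 ∷ D) l (xs≤max 0 (0 ∷ D)) max∈)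
    where
    max∈ : max 0 (0 ∷ D) ∈ 0 ∷ D
    max∈ with argmax-sel id 0 (0 ∷ D)
    ... | inj₁ eq = here eq
    ... | inj₂ m∈ = m∈
    assemble : ∀ {m} → Splits m (0 ∷ D) → ∃ λ F → ∃₂ λ x y → IsSkeleton (max 0 F) F ×
               Column (max 0 F) 0 x × Column (max 0 F) 0 y × join (F , x , y) ≡ 0 ∷ D
    assemble (splits {0 ∷ G} {y} D≡ p W refl)
      with F , x , F-core , W′ , eq ← foldr-ins-surjective (length G) G ≤-refl p
      with refl ← path-max (IsCore.path F-core)
      = F , reverse x , reverse y , core⇒skeleton F-core , word⇒column W′ , word⇒column W ,
        trans (cong₂ _++_ (trans (cong (foldr ins F) (reverse-involutive x)) eq) (reverse-involutive y)) D≡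

  index⁺ : ∀ {n F P} → Skeleton≤ n F → TwoColumn (max 0 F) 0 0 P → cells P ≡ n ∸ length F → IsIndex n (F , P)
  index⁺ {n} {F} {P} (s , F≤n) t eq with tab , ≤2 , es , _ ← twoColumn⁻ t = record
    { m           = max 0 F
    ; skeleton    = s
    ; tableau     = tab
    ; two-columns = ≤2
    ; entries     = es
    ; size        = trans (cong (length F +_) (trans (length-RR P) eq)) (m+[n∸m]≡n F≤n)
    }

  index⁻ : ∀ {n F P} → IsIndex n (F , P) → Skeleton≤ n F × TwoColumn (max 0 F) 0 0 P × cells P ≡ n ∸ length F
  index⁻ {n} {F} {P} record { skeleton = s ; tableau = tab ; two-columns = ≤2 ; entries = es ; size = size }
    with refl ← IsSkeleton.max≡m s
    = (s , m+n≤o⇒m≤o (length F) (≤-reflexive size))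
    , twoColumn P (IsDyckTableau.nonempty-rows tab) (IsDyckTableau.partition tab) (IsDyckTableau.rows tab)
        (IsDyckTableau.columns tab) ≤2 es (under P)
    , trans (sym (length-RR P)) (trans (sym (m+n∸m≡n (length F) _)) (cong (_∸ length F) size))
    where
    under : ∀ P → Under 0 0 P
    under []                = _
    under ([] ∷ _)          = _
    under ((_ ∷ []) ∷ _)    = z≤n
    under ((_ ∷ _ ∷ _) ∷ _) = z≤n , z≤n

  reversedRR-< : ∀ {m p r P} → TwoColumn m p r P → All (_< m) (reversedRR P)
  reversedRR-< (column {w = w} c) = subst (All _) (sym (reversedRR-column w)) (column-< c)
  reversedRR-< (pair _ a<b (_ , b<m) t) = b<m ∷ <-trans (<-trans (n<1+n _) a<b) b<m ∷ reversedRR-< t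

  twoColumn-shape : ∀ {m p r P} → TwoColumn m p r P → ∃₂ λ d k → shape P ≡ twoColumnShape d k
  twoColumn-shape (column {w = w} _) = 0 , length w , lemma w
    where
    lemma : (w : Seq) → shape (map [_] w) ≡ replicate (length w) 1
    lemma []      = refl
    lemma (_ ∷ w) = cong (1 ∷_) (lemma w)
  twoColumn-shape (pair _ _ _ t) with d , k , eq ← twoColumn-shape t = suc d , k , cong (2 ∷_) eq

  module _ {F} (s : IsSkeleton (max 0 F) F) where

    dinv-reverse : ∀ {r} → All (_< max 0 F) r → dinv (F ++ reverse r) ≡ exponent F r [] + length r + dinv F
    dinv-reverse {r} <m = trans
      (dinv-exponent F r [] (All.map (λ a<m → filter-some (_ ≟_) (skeleton-∈ s a<m)) <m))
      (cong (λ G → exponent F r [] + length r + dinv G) (++-identityʳ F))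

    area-RR : ∀ P → area (F ++ RR P) ≡ sum F + sum (reversedRR P)
    area-RR P = trans (sum-++ F (RR P)) (cong (sum F +_)
      (trans (cong sum (sym (reverse-reversedRR P))) (sum-reverse (reversedRR P))))

    dinv-RR : ∀ {P} → TwoColumn (max 0 F) 0 0 P →
              dinv (F ++ RR P) ∸ cells P ≡ exponent F (reversedRR P) [] + dinv F
    dinv-RR {P} t = begin
      dinv (F ++ RR P) ∸ cells P
        ≡⟨ cong₂ (λ X k → dinv (F ++ X) ∸ k) (reverse-reversedRR P) cells≡ ⟨
      dinv (F ++ reverse r) ∸ length r
        ≡⟨ cong (_∸ length r) (dinv-reverse (reversedRR-< t)) ⟩
      exponent F r [] + length r + dinv F ∸ length r
        ≡⟨ cong (_∸ length r) (solve 3 (λ e l d → e :+ l :+ d := e :+ d :+ l) refl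
             (exponent F r []) (length r) (dinv F)) ⟩
      exponent F r [] + dinv F + length r ∸ length r
        ≡⟨ m+n∸n≡m _ (length r) ⟩
      exponent F r [] + dinv F ∎
      where
      open ≡-Reasoning
      r = reversedRR P
      cells≡ : length r ≡ cells P
      cells≡ = trans (sym (length-reverse r)) (trans (cong length (reverse-reversedRR P)) (length-RR P))

    module _ {x y} (x-column : Column (max 0 F) 0 x) (y-column : Column (max 0 F) 0 y) where

      area-join : area (join (F , x , y)) ≡ sum F + length x + sum (x ++ y)
      area-join = begin
        sum (foldr ins F (reverse x) ++ reverse y)
          ≡⟨ sum-++ (foldr ins F (reverse x)) (reverse y) ⟩
        sum (foldr ins F (reverse x)) + sum (reverse y)
          ≡⟨ cong₂ _+_ (sum-foldr-ins (skeleton⇒core s) (column⇒word x-column)) (sum-reverse y) ⟩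
        sum F + sum (reverse x) + length (reverse x) + sum y
          ≡⟨ cong₂ (λ i j → sum F + i + j + sum y) (sum-reverse x) (length-reverse x) ⟩
        sum F + sum x + length x + sum y
          ≡⟨ solve 4 (λ f i l j → f :+ i :+ l :+ j := f :+ l :+ (i :+ j)) refl (sum F) (sum x) (length x) (sum y) ⟩
        sum F + length x + (sum x + sum y)
          ≡⟨ cong (sum F + length x +_) (sum-++ x y) ⟨
        sum F + length x + sum (x ++ y) ∎
        where open ≡-Reasoning

      -- `exponent` takes off one for each letter of `x ++ y`, and extraction has already taken off
      -- one for each letter of `x`; the letters of `y` are left over.
      dinv-join : dinv (join (F , x , y)) ≡ dinv F + length y + exponent F (x ++ y) []
      dinv-join = +-cancelʳ-≡ (length x) _ _ (begin
        dinv (join (F , x , y)) + length x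
          ≡⟨ cong (dinv (join (F , x , y)) +_) (length-reverse x) ⟨
        dinv (join (F , x , y)) + length (reverse x)
          ≡⟨ dinv-foldr-ins (skeleton⇒core s) (column⇒word x-column) (reverse y) ⟩
        dinv (F ++ reverse y ++ reverse x)
          ≡⟨ cong (λ w → dinv (F ++ w)) (reverse-++ x y) ⟨
        dinv (F ++ reverse (x ++ y))
          ≡⟨ dinv-reverse (All.++⁺ (column-< x-column) (column-< y-column)) ⟩
        exponent F (x ++ y) [] + length (x ++ y) + dinv F
          ≡⟨ cong (λ k → exponent F (x ++ y) [] + k + dinv F) (length-++ x) ⟩
        exponent F (x ++ y) [] + (length x + length y) + dinv F
          ≡⟨ solve 4 (λ e i j d → e :+ (i :+ j) :+ d := d :+ j :+ e :+ i) refl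
               (exponent F (x ++ y) []) (length x) (length y) (dinv F) ⟩
        dinv F + length y + exponent F (x ++ y) [] + length x ∎)
        where open ≡-Reasoning

-- Finite sums in a commutative ring

module Sums {c ℓ} (R : CommutativeRing c ℓ) where
  open CommutativeRing R hiding (zero)
  open import Algebra.Properties.Semiring.Exp semiring using (_^_)
  open import Algebra.Solver.Ring.NaturalCoefficients.Default commutativeSemiring
    using (solve; _:+_; _:*_; _:=_)

  -- The complete homogeneous symmetric polynomial of degree `k` in `z` and `w`, with the monomial
  -- free of `z` split off.
  complete : Carrier → Carrier → ℕ → Carrier
  complete z w zero    = 1#
  complete z w (suc k) = z * complete z w k + w ^ suc k

  ∑ˡ : ∀ {b} {B : Set b} → List B → (B → Carrier) → Carrier
  ∑ˡ xs f = foldr _+_ 0# (map f xs)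

  ∑-cong : ∀ {b} {B : Set b} (xs : List B) {f g : B → Carrier} →
           (∀ {i} → i ∈ xs → f i ≈ g i) → ∑ˡ xs f ≈ ∑ˡ xs g
  ∑-cong []       h = refl
  ∑-cong (i ∷ xs) h = +-cong (h (here ≡.refl)) (∑-cong xs (h ∘ there))

  ∑-zero : ∀ {b} {B : Set b} (xs : List B) {f : B → Carrier} →
           (∀ {i} → i ∈ xs → f i ≈ 0#) → ∑ˡ xs f ≈ 0#
  ∑-zero []       h = refl
  ∑-zero (i ∷ xs) h = trans (+-cong (h (here ≡.refl)) (∑-zero xs (h ∘ there))) (+-identityˡ 0#)

  ∑-+ : ∀ {b} {B : Set b} (xs : List B) (f g : B → Carrier) →
        ∑ˡ xs (λ i → f i + g i) ≈ ∑ˡ xs f + ∑ˡ xs g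
  ∑-+ []       f g = sym (+-identityˡ 0#)
  ∑-+ (i ∷ xs) f g = trans (+-congˡ (∑-+ xs f g))
    (solve 4 (λ a b c d → (a :+ b) :+ (c :+ d) := (a :+ c) :+ (b :+ d)) refl _ _ _ _)

  ∑-* : ∀ {b} {B : Set b} r (xs : List B) (f : B → Carrier) →
        ∑ˡ xs (λ i → r * f i) ≈ r * ∑ˡ xs f
  ∑-* r []       f = sym (zeroʳ r)
  ∑-* r (i ∷ xs) f = trans (+-congˡ (∑-* r xs f)) (sym (distribˡ r _ _))

  ∑-map : ∀ {a b} {A : Set a} {B : Set b} (g : A → B) xs (f : B → Carrier) →
          ∑ˡ (map g xs) f ≡ ∑ˡ xs (f ∘ g)
  ∑-map g xs f = ≡.cong (foldr _+_ 0#) (≡.sym (map-∘ xs))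

  ∑-++ : ∀ {b} {B : Set b} (xs ys : List B) (f : B → Carrier) →
         ∑ˡ (xs ++ ys) f ≈ ∑ˡ xs f + ∑ˡ ys f
  ∑-++ []       ys f = sym (+-identityˡ _)
  ∑-++ (x ∷ xs) ys f = trans (+-congˡ (∑-++ xs ys f)) (sym (+-assoc _ _ _))

  ∑-bind : ∀ {a b} {A : Set a} {B : Set b} (g : A → List B) xs (f : B → Carrier) →
           ∑ˡ (concatMap g xs) f ≈ ∑ˡ xs (λ x → ∑ˡ (g x) f)
  ∑-bind g []       f = refl
  ∑-bind g (x ∷ xs) f = trans (∑-++ (g x) _ f) (+-congˡ (∑-bind g xs f))

  ∑-↭ : ∀ {b} {B : Set b} {xs ys : List B} (f : B → Carrier) → xs ↭ ys → ∑ˡ xs f ≈ ∑ˡ ys f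
  ∑-↭ f Perm.refl         = refl
  ∑-↭ f (Perm.prep x p)   = +-congˡ (∑-↭ f p)
  ∑-↭ f (Perm.swap x y p) = trans (+-congˡ (+-congˡ (∑-↭ f p)))
    (solve 3 (λ a b c → a :+ (b :+ c) := b :+ (a :+ c)) refl _ _ _)
  ∑-↭ f (Perm.trans p q)  = trans (∑-↭ f p) (∑-↭ f q)

  -- Duplicate-free lists with the same members are permutations of each other. This replaces the
  -- filtered listings of the statement by structured enumerations.
  ∑-set : ∀ {b} {B : Set b} {xs ys : List B} (f : B → Carrier) → Unique xs → Unique ys →
          (∀ {x} → x ∈ xs → x ∈ ys) → (∀ {x} → x ∈ ys → x ∈ xs) → ∑ˡ xs f ≈ ∑ˡ ys f
  ∑-set f u v to from = ∑-↭ f (∼bag⇒↭ (unique∧set⇒bag u v (mk⇔ to from)))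

-- A vector sends N and the content s of a suffix to a weighted sum over the
-- words of length N put before that suffix, and u a appends the letter a.
-- Letters at distance at least 2 commute, and the order of a + 1 and a costs a
-- factor τ: the u a generate a quantum affine space.
module Appending {c ℓ} (R : CommutativeRing c ℓ)
                 (τ : CommutativeRing.Carrier R) (κ : ℕ → CommutativeRing.Carrier R) where

  open CommutativeRing R hiding (zero)
  open import Algebra.Properties.Semiring.Exp semiring using (_^_)
  open import Algebra.Solver.Ring.NaturalCoefficients.Default commutativeSemiring
    using (solve; _:+_; _:*_; _:=_)

  M : Set c
  M = ℕ → List ℕ → Carrier

  infix 4 _≋_
  _≋_ : M → M → Set ℓ
  v ≋ w = ∀ N s → v N s ≈ w N s

  vectors : Setoid c ℓ
  vectors = record
    { Carrier       = M
    ; _≈_           = _≋_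
    ; isEquivalence = record
      { refl  = λ _ _ → refl
      ; sym   = λ v≋w N s → sym (v≋w N s)
      ; trans = λ v≋w w≋z N s → trans (v≋w N s) (w≋z N s)
      }
    }

  module V = Setoid vectors
  open import Relation.Binary.Reasoning.Setoid vectors

  infixl 6 _⊞_
  infixr 7 _⊡_

  𝟎 : M
  𝟎 _ _ = 0#

  _⊞_ : M → M → M
  (v ⊞ w) N s = v N s + w N s

  _⊡_ : Carrier → M → M
  (r ⊡ v) N s = r * v N s

  ⊞-cong : ∀ {v v′ w w′} → v ≋ v′ → w ≋ w′ → v ⊞ w ≋ v′ ⊞ w′
  ⊞-cong p q N s = +-cong (p N s) (q N s)

  ⊡-cong : ∀ r {v v′} → v ≋ v′ → r ⊡ v ≋ r ⊡ v′
  ⊡-cong r p N s = *-congˡ (p N s)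

  factor : ℕ → List ℕ → Carrier
  factor a s = κ a * τ ^ (below s a ℕ.+ at s a)

  u : ℕ → M → M
  u a v zero    s = 0#
  u a v (suc N) s = factor a s * v N (inc a s)

  record Linear (f : M → M) : Set (c ⊔ˡ ℓ) where
    field
      cong   : ∀ {v w} → v ≋ w → f v ≋ f w
      ⊞-homo : ∀ v w → f (v ⊞ w) ≋ f v ⊞ f w
      ⊡-homo : ∀ r v → f (r ⊡ v) ≋ r ⊡ f v
  open Linear public

  linear-id : Linear (λ v → v)
  linear-id = record
    { cong = λ p → p ; ⊞-homo = λ _ _ → V.refl ; ⊡-homo = λ _ _ → V.refl }

  linear-𝟎 : Linear (λ _ → 𝟎)
  linear-𝟎 = record
    { cong   = λ _ → V.refl
    ; ⊞-homo = λ _ _ _ _ → sym (+-identityˡ 0#)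
    ; ⊡-homo = λ r _ _ _ → sym (zeroʳ r)
    }

  linear-⊞ : ∀ {f g} → Linear f → Linear g → Linear (λ v → f v ⊞ g v)
  linear-⊞ F G = record
    { cong   = λ p → ⊞-cong (cong F p) (cong G p)
    ; ⊞-homo = λ v w → V.trans (⊞-cong (⊞-homo F v w) (⊞-homo G v w))
        λ N s → solve 4 (λ a b c d → (a :+ b) :+ (c :+ d) := (a :+ c) :+ (b :+ d)) refl _ _ _ _
    ; ⊡-homo = λ r v → V.trans (⊞-cong (⊡-homo F r v) (⊡-homo G r v))
        λ N s → sym (distribˡ r _ _)
    }

  linear-⊡ : ∀ {f} r → Linear f → Linear (λ v → r ⊡ f v)
  linear-⊡ r F = record
    { cong   = λ p → ⊡-cong r (cong F p)
    ; ⊞-homo = λ v w → V.trans (⊡-cong r (⊞-homo F v w)) λ N s → distribˡ r _ _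
    ; ⊡-homo = λ q v → V.trans (⊡-cong r (⊡-homo F q v))
        λ N s → solve 3 (λ a b c → a :* (b :* c) := b :* (a :* c)) refl _ _ _
    }

  linear-∘ : ∀ {f g} → Linear f → Linear g → Linear (f ∘ g)
  linear-∘ F G = record
    { cong   = λ p → cong F (cong G p)
    ; ⊞-homo = λ v w → V.trans (cong F (⊞-homo G v w)) (⊞-homo F _ _)
    ; ⊡-homo = λ r v → V.trans (cong F (⊡-homo G r v)) (⊡-homo F r _)
    }

  linear-u : ∀ a → Linear (u a)
  linear-u a = record { cong = u-cong ; ⊞-homo = u-⊞ ; ⊡-homo = u-⊡ }
    where
    u-cong : ∀ {v w} → v ≋ w → u a v ≋ u a w
    u-cong p zero    s = refl
    u-cong p (suc N) s = *-congˡ (p N _)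
    u-⊞ : ∀ v w → u a (v ⊞ w) ≋ u a v ⊞ u a w
    u-⊞ v w zero    s = sym (+-identityˡ 0#)
    u-⊞ v w (suc N) s = distribˡ _ _ _
    u-⊡ : ∀ r v → u a (r ⊡ v) ≋ r ⊡ u a v
    u-⊡ r v zero    s = sym (zeroʳ r)
    u-⊡ r v (suc N) s = solve 3 (λ a b c → a :* (b :* c) := b :* (a :* c)) refl _ _ _

  Commute : (f g : M → M) → Set (c ⊔ˡ ℓ)
  Commute f g = ∀ v → f (g v) ≋ g (f v)

  commute-𝟎 : ∀ {f} → Linear f → Commute f (λ _ → 𝟎)
  commute-𝟎 {f} F v = V.trans (cong F (λ N s → sym (zeroˡ 0#)))
    (V.trans (⊡-homo F 0# 𝟎) λ N s → zeroˡ _)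

  commute-⊞ : ∀ {f g h} → Linear f → Commute f g → Commute f h → Commute f (λ v → g v ⊞ h v)
  commute-⊞ F p q v = V.trans (⊞-homo F _ _) (⊞-cong (p v) (q v))

  commute-⊡ : ∀ {f g} r → Linear f → Commute f g → Commute f (λ v → r ⊡ g v)
  commute-⊡ r F p v = V.trans (⊡-homo F r _) (⊡-cong r (p v))

  commute-∘ : ∀ {f g h} → Linear g → Commute f g → Commute f h → Commute f (g ∘ h)
  commute-∘ G p q v = V.trans (p _) (cong G (q v))

  factor-cong : ∀ a s s′ → below s a ≡ below s′ a → at s a ≡ at s′ a → factor a s ≡ factor a s′
  factor-cong a s s′ p q = ≡.cong₂ (λ i j → κ a * τ ^ (i ℕ.+ j)) p q

  u-far : ∀ {j k} → 2 ℕ.+ j ℕ.≤ k → Commute (u k) (u j)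
  u-far j<k v zero          s = refl
  u-far j<k v (suc zero)    s = trans (zeroʳ _) (sym (zeroʳ _))
  u-far {j} {suc k} (s≤s j<k) v (suc (suc N)) s
    rewrite inc-comm j (suc k) s
          | factor-cong j (inc (suc k) s) s (below-inc-≤ (suc k) j s (ℕ.m≤n⇒m≤1+n (ℕ.<⇒≤ j<k))) (at-inc-≢ (suc k) j s (ℕ.<⇒≢ (ℕ.m≤n⇒m≤1+n j<k)))
          | factor-cong (suc k) (inc j s) s (at-inc-≢ j k s (ℕ.>⇒≢ j<k)) (at-inc-≢ j (suc k) s (ℕ.>⇒≢ (ℕ.m≤n⇒m≤1+n j<k)))
    = solve 3 (λ a b c → a :* (b :* c) := b :* (a :* c)) refl _ _ _

  -- The left side places `k + 1` before `k`, a pair counted by `di` that the right side does not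
  -- have.
  u-near : ∀ k v → u k (u (suc k) v) ≋ τ ⊡ u (suc k) (u k v)
  u-near k v zero       s = sym (zeroʳ τ)
  u-near k v (suc zero) s = trans (zeroʳ _) (sym (trans (*-congˡ (zeroʳ _)) (zeroʳ τ)))
  u-near k v (suc (suc N)) s
    rewrite inc-comm k (suc k) s
          | factor-cong k (inc (suc k) s) s (below-inc-≤ (suc k) k s (ℕ.n≤1+n k)) (at-inc-≢ (suc k) k s (ℕ.<⇒≢ ℕ.≤-refl))
          | at-inc-≡ k s | at-inc-≢ k (suc k) s (ℕ.>⇒≢ ℕ.≤-refl)
    = solve 5 (λ κ τ p f v → f :* ((κ :* (τ :* p)) :* v) := τ :* ((κ :* p) :* (f :* v)))
        refl _ _ _ _ _

  -- Chain series and their divided differences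

  module Chains (x y : Carrier) where

    -- E k is the series in y of the chains of letters below k - 1 with gaps at
    -- least 2, and D k is its divided difference (E k (x) - E k (y)) / (x - y);
    -- hence A k = (x E k (x) - y E k (y)) / (x - y).  No division is needed.
    E : ℕ → M → M
    E 0             v = v
    E 1             v = v
    E (suc (suc k)) v = E (suc k) v ⊞ y ⊡ u k (E k v)

    D : ℕ → M → M
    D 0             v = 𝟎
    D 1             v = 𝟎
    D (suc (suc k)) v = D (suc k) v ⊞ u k (E k v ⊞ x ⊡ D k v)

    A : ℕ → M → M
    A k v = E k v ⊞ x ⊡ D k v

    linear-E : ∀ k → Linear (E k)
    linear-E 0             = linear-id
    linear-E 1             = linear-id
    linear-E (suc (suc k)) =
      linear-⊞ (linear-E (suc k)) (linear-⊡ y (linear-∘ (linear-u k) (linear-E k)))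

    linear-D : ∀ k → Linear (D k)
    linear-A : ∀ k → Linear (A k)
    linear-D 0             = linear-𝟎
    linear-D 1             = linear-𝟎
    linear-D (suc (suc k)) = linear-⊞ (linear-D (suc k)) (linear-∘ (linear-u k) (linear-A k))
    linear-A k = linear-⊞ (linear-E k) (linear-⊡ x (linear-D k))

    u-E : ∀ {j k} → j ℕ.≤ k → Commute (u k) (E j)
    u-E {0}           j≤k v = V.refl
    u-E {1}           j≤k v = V.refl
    u-E {suc (suc j)} {k} j≤k = commute-⊞ {g = E (suc j)} (linear-u k) (u-E (ℕ.<⇒≤ j≤k))
      (commute-⊡ {g = u j ∘ E j} y (linear-u k) (commute-∘ (linear-u j) (u-far j≤k) (u-E (ℕ.<⇒≤ (ℕ.<⇒≤ j≤k)))))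

    u-D : ∀ {j k} → j ℕ.≤ k → Commute (u k) (D j)
    u-A : ∀ {j k} → j ℕ.≤ k → Commute (u k) (A j)
    u-D {0}           {k} j≤k = commute-𝟎 (linear-u k)
    u-D {1}           {k} j≤k = commute-𝟎 (linear-u k)
    u-D {suc (suc j)} {k} j≤k = commute-⊞ {g = D (suc j)} (linear-u k) (u-D (ℕ.<⇒≤ j≤k))
      (commute-∘ (linear-u j) (u-far j≤k) (u-A (ℕ.<⇒≤ (ℕ.<⇒≤ j≤k))))
    u-A {j} {k} j≤k = commute-⊞ {g = E j} (linear-u k) (u-E j≤k) (commute-⊡ x (linear-u k) (u-D j≤k))

    axpy : ∀ {f} → Linear f → ∀ r v w → f (v ⊞ r ⊡ w) ≋ f v ⊞ r ⊡ f w
    axpy F r v w = V.trans (⊞-homo F _ _) (⊞-cong V.refl (⊡-homo F r w))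

    linear-uE : ∀ k → Linear (u k ∘ E k)
    linear-uE k = linear-∘ (linear-u k) (linear-E k)

    linear-uA : ∀ k → Linear (u k ∘ A k)
    linear-uA k = linear-∘ (linear-u k) (linear-A k)

    A-step : ∀ k v → A (2 ℕ.+ k) v ≋ A (1 ℕ.+ k) v ⊞ (y ⊡ u k (E k v) ⊞ x ⊡ u k (A k v))
    A-step k v N s = solve 6 (λ x y e d f g →
        (e :+ y :* f) :+ x :* (d :+ g) := (e :+ x :* d) :+ (y :* f :+ x :* g))
      refl _ _ _ _ _ _

    -- Among the letters of `E (2 + k)` only the largest, `k`, is a neighbour of `1 + k`; moving
    -- past it costs `τ`, and the others commute. The same reason gives `D-u`, and both together
    -- give `A-u`.
    E-u : ∀ k v → E (2 ℕ.+ k) (u (1 ℕ.+ k) v) ≋ u (1 ℕ.+ k) (E (1 ℕ.+ k) v ⊞ (τ * y) ⊡ u k (E k v))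
    E-u k v = begin
      E (1 ℕ.+ k) (u₁ v) ⊞ y ⊡ u k (E k (u₁ v))
        ≈⟨ ⊞-cong (u-E ℕ.≤-refl v) (⊡-cong y (cong (linear-u k) (u-E (ℕ.n≤1+n k) v))) ⟨
      u₁ (E (1 ℕ.+ k) v) ⊞ y ⊡ u k (u₁ (E k v))
        ≈⟨ ⊞-cong V.refl (⊡-cong y (u-near k _)) ⟩
      u₁ (E (1 ℕ.+ k) v) ⊞ y ⊡ τ ⊡ u₁ (u k (E k v))
        ≈⟨ (λ N s → solve 4 (λ a y τ b → a :+ y :* (τ :* b) := a :+ (τ :* y) :* b) refl _ _ _ _) ⟩
      u₁ (E (1 ℕ.+ k) v) ⊞ (τ * y) ⊡ u₁ (u k (E k v))
        ≈⟨ axpy (linear-u (1 ℕ.+ k)) (τ * y) _ _ ⟨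
      u₁ (E (1 ℕ.+ k) v ⊞ (τ * y) ⊡ u k (E k v)) ∎
      where u₁ = u (1 ℕ.+ k)

    D-u : ∀ k v → D (2 ℕ.+ k) (u (1 ℕ.+ k) v) ≋ u (1 ℕ.+ k) (D (1 ℕ.+ k) v ⊞ τ ⊡ u k (A k v))
    D-u k v = begin
      D (1 ℕ.+ k) (u₁ v) ⊞ u k (A k (u₁ v))
        ≈⟨ ⊞-cong (u-D ℕ.≤-refl v) (cong (linear-u k) (u-A (ℕ.n≤1+n k) v)) ⟨
      u₁ (D (1 ℕ.+ k) v) ⊞ u k (u₁ (A k v))
        ≈⟨ ⊞-cong V.refl (u-near k _) ⟩
      u₁ (D (1 ℕ.+ k) v) ⊞ τ ⊡ u₁ (u k (A k v))
        ≈⟨ axpy (linear-u (1 ℕ.+ k)) τ _ _ ⟨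
      u₁ (D (1 ℕ.+ k) v ⊞ τ ⊡ u k (A k v)) ∎
      where u₁ = u (1 ℕ.+ k)

    A-u : ∀ k v → A (2 ℕ.+ k) (u (1 ℕ.+ k) v) ≋
                  u (1 ℕ.+ k) (A (1 ℕ.+ k) v ⊞ τ ⊡ (y ⊡ u k (E k v) ⊞ x ⊡ u k (A k v)))
    A-u k v = begin
      E (2 ℕ.+ k) (u₁ v) ⊞ x ⊡ D (2 ℕ.+ k) (u₁ v)
        ≈⟨ ⊞-cong (E-u k v) (⊡-cong x (D-u k v)) ⟩
      u₁ (E (1 ℕ.+ k) v ⊞ (τ * y) ⊡ u k (E k v)) ⊞ x ⊡ u₁ (D (1 ℕ.+ k) v ⊞ τ ⊡ u k (A k v))
        ≈⟨ axpy (linear-u (1 ℕ.+ k)) x _ _ ⟨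
      u₁ ((E (1 ℕ.+ k) v ⊞ (τ * y) ⊡ u k (E k v)) ⊞ x ⊡ (D (1 ℕ.+ k) v ⊞ τ ⊡ u k (A k v)))
        ≈⟨ cong (linear-u (1 ℕ.+ k)) (λ N s → solve 7 (λ x y τ e f d g →
             (e :+ (τ :* y) :* f) :+ x :* (d :+ τ :* g)
             := (e :+ x :* d) :+ τ :* (y :* f :+ x :* g)) refl _ _ _ _ _ _ _) ⟩
      u₁ (A (1 ℕ.+ k) v ⊞ τ ⊡ (y ⊡ u k (E k v) ⊞ x ⊡ u k (A k v))) ∎
      where u₁ = u (1 ℕ.+ k)

    -- D k and E k commute because the chain series with different variables do;
    -- the induction closes with this relation, which recurs in steps of 2.
    Exchange : ℕ → Set (c ⊔ˡ ℓ)
    Exchange k = ∀ v → u k (A k (E (1 ℕ.+ k) v)) ⊞ y ⊡ D (1 ℕ.+ k) (u k (E k v)) ≋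
                       y ⊡ u k (E k (D (1 ℕ.+ k) v)) ⊞ E (1 ℕ.+ k) (u k (A k v))

    commute-A : ∀ k → Commute (D k) (E k) → Commute (A k) (E k)
    commute-A k C v = V.trans (⊞-cong V.refl (⊡-cong x (C v))) (V.sym (axpy (linear-E k) x _ _))

    -- After expanding both recursions, the terms with two letters `k` agree because `u k` commutes
    -- with `A k` and `E k`; the terms with one such letter are those of `Exchange k`.
    commute-step : ∀ k → Exchange k → Commute (D k) (E k) → Commute (D (1 ℕ.+ k)) (E (1 ℕ.+ k)) →
                   Commute (D (2 ℕ.+ k)) (E (2 ℕ.+ k))
    commute-step k X C C₁ v = begin
      D₁ (E₁ v ⊞ y ⊡ u k (E k v)) ⊞ u k (A k (E₁ v ⊞ y ⊡ u k (E k v)))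
        ≈⟨ ⊞-cong (axpy (linear-D (1 ℕ.+ k)) y _ _) (axpy (linear-uA k) y _ _) ⟩
      (D₁ (E₁ v) ⊞ y ⊡ D₁ (u k (E k v))) ⊞ (u k (A k (E₁ v)) ⊞ y ⊡ u k (A k (u k (E k v))))
        ≈⟨ (λ N s → solve 5 (λ y a b c d → (a :+ y :* b) :+ (c :+ y :* d) := (a :+ (c :+ y :* b)) :+ y :* d)
             refl _ _ _ _ _) ⟩
      (D₁ (E₁ v) ⊞ (u k (A k (E₁ v)) ⊞ y ⊡ D₁ (u k (E k v)))) ⊞ y ⊡ u k (A k (u k (E k v)))
        ≈⟨ ⊞-cong (⊞-cong (C₁ v) (X v)) (⊡-cong y (cong (linear-u k) AuE)) ⟩
      (E₁ (D₁ v) ⊞ (y ⊡ u k (E k (D₁ v)) ⊞ E₁ (u k (A k v)))) ⊞ y ⊡ u k (E k (u k (A k v)))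
        ≈⟨ (λ N s → solve 5 (λ y a b c d → (a :+ (y :* b :+ c)) :+ y :* d := (a :+ c) :+ y :* (b :+ d))
             refl _ _ _ _ _) ⟩
      (E₁ (D₁ v) ⊞ E₁ (u k (A k v))) ⊞ y ⊡ (u k (E k (D₁ v)) ⊞ u k (E k (u k (A k v))))
        ≈⟨ ⊞-cong (⊞-homo (linear-E (1 ℕ.+ k)) _ _) (⊡-cong y (⊞-homo (linear-uE k) _ _)) ⟨
      E₁ (D₁ v ⊞ u k (A k v)) ⊞ y ⊡ u k (E k (D₁ v ⊞ u k (A k v))) ∎
      where
      D₁ = D (1 ℕ.+ k)
      E₁ = E (1 ℕ.+ k)
      AuE : A k (u k (E k v)) ≋ E k (u k (A k v))
      AuE = V.trans (V.sym (u-A ℕ.≤-refl _))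
              (V.trans (cong (linear-u k) (commute-A k C v)) (u-E ℕ.≤-refl _))

    -- Letters are stripped from the outside. `D-u` and `E-u` free `u₂` in all four terms, which
    -- leaves `outer`. Expanding `E₃` and `D₃` reduces that to `middle`, where `u₁` is freed in
    -- turn. What remains, `inner`, is `Exchange k` combined with the commutation of `A₁` and `E₁`.
    exchange-step : ∀ k → Exchange k → Commute (D (1 ℕ.+ k)) (E (1 ℕ.+ k)) →
                    Commute (D (2 ℕ.+ k)) (E (2 ℕ.+ k)) → Exchange (2 ℕ.+ k)
    exchange-step k X C₁ C₂ v = begin
      u₂ (A₂ (E₃ v)) ⊞ y ⊡ D₃ (u₂ (E₂ v))
        ≈⟨ ⊞-cong V.refl (⊡-cong y (D-u (1 ℕ.+ k) _)) ⟩
      u₂ (A₂ (E₃ v)) ⊞ y ⊡ u₂ (D₂ (E₂ v) ⊞ τ ⊡ u₁ (A₁ (E₂ v)))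
        ≈⟨ axpy (linear-u (2 ℕ.+ k)) y _ _ ⟨
      u₂ (A₂ (E₃ v) ⊞ y ⊡ (D₂ (E₂ v) ⊞ τ ⊡ u₁ (A₁ (E₂ v))))
        ≈⟨ cong (linear-u (2 ℕ.+ k)) outer ⟩
      u₂ ((E₂ (A₂ v) ⊞ (τ * y) ⊡ u₁ (E₁ (A₂ v))) ⊞ y ⊡ E₂ (D₃ v))
        ≈⟨ axpy (linear-u (2 ℕ.+ k)) y _ _ ⟩
      u₂ (E₂ (A₂ v) ⊞ (τ * y) ⊡ u₁ (E₁ (A₂ v))) ⊞ y ⊡ u₂ (E₂ (D₃ v))
        ≈⟨ ⊞-cong (V.sym (E-u (1 ℕ.+ k) _)) V.refl ⟩
      E₃ (u₂ (A₂ v)) ⊞ y ⊡ u₂ (E₂ (D₃ v))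
        ≈⟨ (λ N s → +-comm _ _) ⟩
      y ⊡ u₂ (E₂ (D₃ v)) ⊞ E₃ (u₂ (A₂ v)) ∎
      where
      u₀ = u k
      u₁ = u (1 ℕ.+ k)
      u₂ = u (2 ℕ.+ k)
      E₀ = E k
      E₁ = E (1 ℕ.+ k)
      E₂ = E (2 ℕ.+ k)
      E₃ = E (3 ℕ.+ k)
      D₁ = D (1 ℕ.+ k)
      D₂ = D (2 ℕ.+ k)
      D₃ = D (3 ℕ.+ k)
      A₀ = A k
      A₁ = A (1 ℕ.+ k)
      A₂ = A (2 ℕ.+ k)
      inner : (A₁ (E₁ v) ⊞ τ ⊡ (y ⊡ u₀ (E₀ (E₁ v)) ⊞ x ⊡ u₀ (A₀ (E₁ v)))) ⊞ τ ⊡ A₁ (E₂ v) ≋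
              (E₁ (A₁ v) ⊞ (τ * y) ⊡ u₀ (E₀ (A₁ v))) ⊞ τ ⊡ E₁ (A₂ v)
      inner = begin
        (A₁ (E₁ v) ⊞ τ ⊡ (y ⊡ u₀ (E₀ (E₁ v)) ⊞ x ⊡ u₀ (A₀ (E₁ v)))) ⊞ τ ⊡ A₁ (E₂ v)
          ≈⟨ ⊞-cong V.refl (⊡-cong τ (axpy (linear-A (1 ℕ.+ k)) y _ _)) ⟩
        (A₁ (E₁ v) ⊞ τ ⊡ (y ⊡ u₀ (E₀ (E₁ v)) ⊞ x ⊡ u₀ (A₀ (E₁ v))))
          ⊞ τ ⊡ (A₁ (E₁ v) ⊞ y ⊡ A₁ (u₀ (E₀ v)))
          ≈⟨ (λ N s → solve 8 (λ x y τ e p q r s →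
               (e :+ τ :* (y :* p :+ x :* q)) :+ τ :* (e :+ y :* (r :+ x :* s))
               := (e :+ τ :* (y :* p :+ e :+ y :* r)) :+ (τ :* x) :* (q :+ y :* s))
               refl _ _ _ _ _ _ _ _) ⟩
        (A₁ (E₁ v) ⊞ τ ⊡ (y ⊡ u₀ (E₀ (E₁ v)) ⊞ A₁ (E₁ v) ⊞ y ⊡ E₁ (u₀ (E₀ v))))
          ⊞ (τ * x) ⊡ (u₀ (A₀ (E₁ v)) ⊞ y ⊡ D₁ (u₀ (E₀ v)))
          ≈⟨ ⊞-cong (⊞-cong A₁E₁ (⊡-cong τ (⊞-cong (⊞-cong V.refl A₁E₁) V.refl)))
                    (⊡-cong (τ * x) (X v)) ⟩
        (E₁ (A₁ v) ⊞ τ ⊡ (y ⊡ u₀ (E₀ (E₁ v)) ⊞ E₁ (A₁ v) ⊞ y ⊡ E₁ (u₀ (E₀ v))))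
          ⊞ (τ * x) ⊡ (y ⊡ u₀ (E₀ (D₁ v)) ⊞ E₁ (u₀ (A₀ v)))
          ≈⟨ (λ N s → solve 8 (λ x y τ e p r g h →
               (e :+ τ :* (y :* p :+ e :+ y :* r)) :+ (τ :* x) :* (y :* g :+ h)
               := (e :+ (τ :* y) :* (p :+ x :* g)) :+ τ :* (e :+ (y :* r :+ x :* h)))
               refl _ _ _ _ _ _ _ _) ⟩
        (E₁ (A₁ v) ⊞ (τ * y) ⊡ (u₀ (E₀ (E₁ v)) ⊞ x ⊡ u₀ (E₀ (D₁ v))))
          ⊞ τ ⊡ (E₁ (A₁ v) ⊞ (y ⊡ E₁ (u₀ (E₀ v)) ⊞ x ⊡ E₁ (u₀ (A₀ v))))
          ≈⟨ ⊞-cong (⊞-cong V.refl (⊡-cong (τ * y) (axpy (linear-uE k) x _ _)))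
                    (⊡-cong τ (V.trans (⊞-homo (linear-E (1 ℕ.+ k)) _ _)
                      (⊞-cong V.refl (V.trans (axpy (linear-E (1 ℕ.+ k)) x _ _)
                                        (⊞-cong (⊡-homo (linear-E (1 ℕ.+ k)) y _) V.refl))))) ⟨
        (E₁ (A₁ v) ⊞ (τ * y) ⊡ u₀ (E₀ (A₁ v)))
          ⊞ τ ⊡ E₁ (A₁ v ⊞ (y ⊡ u₀ (E₀ v) ⊞ x ⊡ u₀ (A₀ v)))
          ≈⟨ ⊞-cong V.refl (⊡-cong τ (cong (linear-E (1 ℕ.+ k)) (A-step k v))) ⟨
        (E₁ (A₁ v) ⊞ (τ * y) ⊡ u₀ (E₀ (A₁ v))) ⊞ τ ⊡ E₁ (A₂ v) ∎
        where
        A₁E₁ : A₁ (E₁ v) ≋ E₁ (A₁ v)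
        A₁E₁ = commute-A (1 ℕ.+ k) C₁ v
      middle : A₂ (u₁ (E₁ v)) ⊞ τ ⊡ u₁ (A₁ (E₂ v)) ≋ E₂ (u₁ (A₁ v)) ⊞ τ ⊡ u₁ (E₁ (A₂ v))
      middle = begin
        A₂ (u₁ (E₁ v)) ⊞ τ ⊡ u₁ (A₁ (E₂ v))
          ≈⟨ ⊞-cong (A-u k _) V.refl ⟩
        _ ≈⟨ axpy (linear-u (1 ℕ.+ k)) τ _ _ ⟨
        _ ≈⟨ cong (linear-u (1 ℕ.+ k)) inner ⟩
        _ ≈⟨ axpy (linear-u (1 ℕ.+ k)) τ _ _ ⟩
        _ ≈⟨ ⊞-cong (E-u k _) V.refl ⟨
        E₂ (u₁ (A₁ v)) ⊞ τ ⊡ u₁ (E₁ (A₂ v)) ∎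
      outer : A₂ (E₃ v) ⊞ y ⊡ (D₂ (E₂ v) ⊞ τ ⊡ u₁ (A₁ (E₂ v))) ≋
              (E₂ (A₂ v) ⊞ (τ * y) ⊡ u₁ (E₁ (A₂ v))) ⊞ y ⊡ E₂ (D₃ v)
      outer = begin
        A₂ (E₃ v) ⊞ y ⊡ (D₂ (E₂ v) ⊞ τ ⊡ u₁ (A₁ (E₂ v)))
          ≈⟨ ⊞-cong (axpy (linear-A (2 ℕ.+ k)) y _ _) V.refl ⟩
        (A₂ (E₂ v) ⊞ y ⊡ A₂ (u₁ (E₁ v))) ⊞ y ⊡ (D₂ (E₂ v) ⊞ τ ⊡ u₁ (A₁ (E₂ v)))
          ≈⟨ (λ N s → solve 6 (λ y τ a b d f → (a :+ y :* b) :+ y :* (d :+ τ :* f)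
               := (a :+ y :* (b :+ τ :* f)) :+ y :* d) refl _ _ _ _ _ _) ⟩
        (A₂ (E₂ v) ⊞ y ⊡ (A₂ (u₁ (E₁ v)) ⊞ τ ⊡ u₁ (A₁ (E₂ v)))) ⊞ y ⊡ D₂ (E₂ v)
          ≈⟨ ⊞-cong (⊞-cong (commute-A (2 ℕ.+ k) C₂ v) (⊡-cong y middle)) (⊡-cong y (C₂ v)) ⟩
        (E₂ (A₂ v) ⊞ y ⊡ (E₂ (u₁ (A₁ v)) ⊞ τ ⊡ u₁ (E₁ (A₂ v)))) ⊞ y ⊡ E₂ (D₂ v)
          ≈⟨ (λ N s → solve 6 (λ y τ a b d f → (a :+ y :* (b :+ τ :* f)) :+ y :* d
               := (a :+ (τ :* y) :* f) :+ y :* (d :+ b)) refl _ _ _ _ _ _) ⟩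
        (E₂ (A₂ v) ⊞ (τ * y) ⊡ u₁ (E₁ (A₂ v))) ⊞ y ⊡ (E₂ (D₂ v) ⊞ E₂ (u₁ (A₁ v)))
          ≈⟨ ⊞-cong V.refl (⊡-cong y (⊞-homo (linear-E (2 ℕ.+ k)) _ _)) ⟨
        (E₂ (A₂ v) ⊞ (τ * y) ⊡ u₁ (E₁ (A₂ v))) ⊞ y ⊡ E₂ (D₃ v) ∎

    commute : ∀ k → Commute (D k) (E k)
    exchange : ∀ k → Exchange k
    commute 0             v = V.refl
    commute 1             v = V.refl
    commute (suc (suc k)) = commute-step k (exchange k) (commute k) (commute (suc k))
    exchange 0 v N s = trans (+-congˡ (zeroʳ y)) (trans (+-comm _ _) (+-congʳ (sym (trans (*-congˡ (u₀𝟎 N s)) (zeroʳ y)))))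
      where
      u₀𝟎 : u 0 𝟎 ≋ 𝟎
      u₀𝟎 = commute-𝟎 (linear-u 0) v
    exchange 1 v = begin
      u 1 (A 1 (v ⊞ y ⊡ u 0 v)) ⊞ y ⊡ D 2 (u 1 v)
        ≈⟨ ⊞-cong (V.trans (cong (linear-u 1) (A₀ _)) (axpy (linear-u 1) y _ _)) (⊡-cong y (D₂ _)) ⟩
      (u 1 v ⊞ y ⊡ u 1 (u 0 v)) ⊞ y ⊡ u 0 (u 1 v)
        ≈⟨ (λ N s → solve 3 (λ a b c → (a :+ b) :+ c := b :+ (a :+ c)) refl _ _ _) ⟩
      y ⊡ u 1 (u 0 v) ⊞ (u 1 v ⊞ y ⊡ u 0 (u 1 v))
        ≈⟨ ⊞-cong (⊡-cong y (cong (linear-u 1) (D₂ v))) (cong (linear-E 2) (cong (linear-u 1) (A₀ v))) ⟨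
      y ⊡ u 1 (D 2 v) ⊞ E 2 (u 1 (A 1 v)) ∎
      where
      A₀ : ∀ w → w ⊞ x ⊡ 𝟎 ≋ w
      A₀ w N s = trans (+-congˡ (zeroʳ x)) (+-identityʳ _)
      D₂ : ∀ w → D 2 w ≋ u 0 w
      D₂ w N s = trans (+-identityˡ _) (cong (linear-u 0) (A₀ w) N s)
    exchange (suc (suc k)) = exchange-step k (exchange k) (commute (suc k)) (commute (suc (suc k)))

-- Column series and the tableau recursion

module Columns {c ℓ} (R : CommutativeRing c ℓ) (τ : CommutativeRing.Carrier R)
               (κ : ℕ → CommutativeRing.Carrier R) (m : ℕ) (z w : CommutativeRing.Carrier R) where

  open CommutativeRing R hiding (zero)
  open Sums R
  open Appending R τ κ
  open import Algebra.Properties.Semiring.Exp semiring using (_^_)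
  open import Algebra.Properties.Ring (CommutativeRing.ring R) using (-‿distribˡ-*; -‿distribʳ-*; -‿involutive)
  open import Algebra.Solver.Ring.NaturalCoefficients.Default commutativeSemiring
    using (solve; _:+_; _:*_; _:=_)
  open import Relation.Binary.Reasoning.Setoid setoid

  x y : Carrier
  x = - z
  y = - w
  open Chains x y

  ⨁ : List ℕ → (ℕ → M) → M
  ⨁ xs f N s = ∑ˡ xs λ a → f a N s

  u-⨁ : ∀ b xs f → u b (⨁ xs f) ≋ ⨁ xs (λ a → u b (f a))
  u-⨁ b xs f zero    s = sym (∑-zero xs λ _ → refl)
  u-⨁ b xs f (suc N) s = sym (∑-* _ xs _)

  -- With u acting on the right: S, H and Y sum over the columns below p, weighted
  -- by 1, w ^ N and h N; PP over the words y x with x a column below p, weighted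
  -- by z for each letter of x and w for each letter of y; Z over the tableaux
  -- below p and r, weighted by their Schur function.
  S : ℕ → M
  S p zero    s = 1#
  S p (suc N) s = ∑ˡ (letters m p) λ a → factor a s * S a N (inc a s)

  h : ℕ → Carrier
  h = complete z w

  H Y : ℕ → M
  H p N s = w ^ N * S p N s
  Y p N s = h N * S p N s

  PP : ℕ → M
  PP p zero    s = 1#
  PP p (suc N) s = H 0 (suc N) s + z * ∑ˡ (letters m p) λ a → factor a s * PP a N (inc a s)

  Z : ℕ → ℕ → M
  Z p r zero          s = Y p 0 s
  Z p r (suc zero)    s = Y p 1 s
  Z p r (suc (suc N)) s = Y p (suc (suc N)) s + z * w *
    ∑ˡ (letters m r) λ b → ∑ˡ (letters (b ∸ 1) p) λ a →
      factor b s * (factor a (inc b s) * Z a b N (inc a (inc b s)))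

  𝟏 : M
  𝟏 zero    s = 1#
  𝟏 (suc N) s = 0#

  ∑-letters : ∀ {m k} (f : ℕ → Carrier) → k < m →
              ∑ˡ (letters m (1 ℕ.+ k)) f ≈ f k + ∑ˡ (letters m (2 ℕ.+ k)) f
  ∑-letters f k<m rewrite letters-step k<m = refl

  ∑-letters-end : ∀ m (f : ℕ → Carrier) → ∑ˡ (letters m (1 ℕ.+ m)) f ≈ 0#
  ∑-letters-end m f rewrite letters-end m = refl

  S-step : ∀ {k} → k < m → S (1 ℕ.+ k) ≋ S (2 ℕ.+ k) ⊞ u k (S k)
  S-step k<m zero    s = sym (+-identityʳ 1#)
  S-step k<m (suc N) s = trans (∑-letters _ k<m) (+-comm _ _)

  S-end : S (1 ℕ.+ m) ≋ 𝟏
  S-end zero    s = refl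
  S-end (suc N) s = ∑-letters-end m _

  S-0 : S 0 ≋ S 1
  S-0 zero    s = refl
  S-0 (suc N) s = refl

  H-step : ∀ {k} → k < m → H (1 ℕ.+ k) ≋ H (2 ℕ.+ k) ⊞ w ⊡ u k (H k)
  H-step k<m zero    s = trans (sym (+-identityʳ _)) (+-congˡ (sym (zeroʳ w)))
  H-step k<m (suc N) s = trans (*-congˡ (S-step k<m (suc N) s))
    (solve 5 (λ w p a f b → (w :* p) :* (a :+ f :* b) := (w :* p) :* a :+ w :* (f :* (p :* b)))
      refl _ _ _ _ _)

  H-end : H (1 ℕ.+ m) ≋ 𝟏
  H-end zero    s = *-identityˡ 1#
  H-end (suc N) s = trans (*-congˡ (S-end (suc N) s)) (zeroʳ _)

  H-0 : H 0 ≋ H 1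
  H-0 N s = *-congˡ (S-0 N s)

  Y-step : ∀ {k} → k < m → Y (1 ℕ.+ k) ≋ Y (2 ℕ.+ k) ⊞ (z ⊡ u k (Y k) ⊞ w ⊡ u k (H k))
  Y-step k<m zero    s = trans (sym (+-identityʳ _))
    (+-congˡ (sym (trans (+-cong (zeroʳ z) (zeroʳ w)) (+-identityˡ 0#))))
  Y-step k<m (suc N) s = trans (*-congˡ (S-step k<m (suc N) s))
    (solve 7 (λ z w h p a f b → (z :* h :+ w :* p) :* (a :+ f :* b)
        := (z :* h :+ w :* p) :* a :+ (z :* (f :* (h :* b)) :+ w :* (f :* (p :* b))))
      refl _ _ _ _ _ _ _)

  Y-end : Y (1 ℕ.+ m) ≋ 𝟏
  Y-end zero    s = *-identityˡ 1#
  Y-end (suc N) s = trans (*-congˡ (S-end (suc N) s)) (zeroʳ _)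

  Y-0 : Y 0 ≋ Y 1
  Y-0 N s = *-congˡ (S-0 N s)

  PP-step : ∀ {k} → k < m → PP (1 ℕ.+ k) ≋ PP (2 ℕ.+ k) ⊞ z ⊡ u k (PP k)
  PP-step k<m zero    s = trans (sym (+-identityʳ _)) (+-congˡ (sym (zeroʳ z)))
  PP-step k<m (suc N) s = trans (+-congˡ (*-congˡ (∑-letters _ k<m)))
    (solve 4 (λ z g a b → g :+ z :* (a :+ b) := (g :+ z :* b) :+ z :* a) refl _ _ _ _)

  PP-end : PP (1 ℕ.+ m) ≋ H 0
  PP-end zero    s = sym (*-identityˡ 1#)
  PP-end (suc N) s = trans (+-congˡ (trans (*-congˡ (∑-letters-end m _)) (zeroʳ z))) (+-identityʳ _)

  PP-0 : PP 0 ≋ PP 1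
  PP-0 zero    s = refl
  PP-0 (suc N) s = refl

  w+y : w + y ≈ 0#
  w+y = -‿inverseʳ w

  z+x : z + x ≈ 0#
  z+x = -‿inverseʳ z

  zw≈xy : z * w ≈ x * y
  zw≈xy = sym (trans (sym (-‿distribˡ-* z y)) (trans (-‿cong (sym (-‿distribʳ-* z w))) (-‿involutive _)))

  -- Solved for the term with the larger flag, `H-step` is the recursion of `E` with `y = - w`. At
  -- the flag `1 + m`, where `H` is `𝟏`, this says that the full chain series inverts the column
  -- series.
  H≋E : ∀ p → p ≤ 1 ℕ.+ m → H p ≋ E p (H 0)
  H≋E 0             _   = V.refl
  H≋E 1             _   = V.sym H-0
  H≋E (suc (suc k)) k<m N s = begin
    H (2 ℕ.+ k) N s
      ≈⟨ +-identityʳ _ ⟨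
    H (2 ℕ.+ k) N s + 0#
      ≈⟨ +-congˡ (trans (*-congʳ w+y) (zeroˡ _)) ⟨
    H (2 ℕ.+ k) N s + (w + y) * u k (H k) N s
      ≈⟨ solve 4 (λ w y a b → a :+ (w :+ y) :* b := (a :+ w :* b) :+ y :* b) refl _ _ _ _ ⟩
    (H (2 ℕ.+ k) N s + w * u k (H k) N s) + y * u k (H k) N s
      ≈⟨ +-congʳ (H-step (ℕ.≤-pred k<m) N s) ⟨
    H (1 ℕ.+ k) N s + y * u k (H k) N s
      ≈⟨ +-cong (H≋E (suc k) (ℕ.<⇒≤ k<m) N s)
           (*-congˡ (cong (linear-u k) (H≋E k (ℕ.<⇒≤ (ℕ.<⇒≤ k<m))) N s)) ⟩
    E (2 ℕ.+ k) (H 0) N s ∎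

  -- The chain series in the other variable `x` is `A p` minus `y` times `D p`, and it takes `PP 0`
  -- to `PP p`; the subtracted term stands on the right.
  A-PP : ∀ p → p ≤ 1 ℕ.+ m → A p (PP 0) ≋ PP p ⊞ y ⊡ D p (PP 0)
  A-PP 0             _       = λ N s → +-congˡ (trans (zeroʳ x) (sym (zeroʳ y)))
  A-PP 1             _       = λ N s → +-cong (PP-0 N s) (trans (zeroʳ x) (sym (zeroʳ y)))
  A-PP (suc (suc k)) k<m N s = begin
    A (2 ℕ.+ k) (PP 0) N s
      ≈⟨ A-step k (PP 0) N s ⟩
    A (1 ℕ.+ k) (PP 0) N s + (y * u k (E k (PP 0)) N s + x * u k (A k (PP 0)) N s)
      ≈⟨ +-cong (trans (A-PP (suc k) (ℕ.<⇒≤ k<m) N s) (+-congʳ (PP-step (ℕ.≤-pred k<m) N s)))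
           (+-congˡ (*-congˡ (trans (cong (linear-u k) (A-PP k (ℕ.<⇒≤ (ℕ.<⇒≤ k<m))) N s)
                                    (axpy (linear-u k) y _ _ N s)))) ⟩
    ((PP (2 ℕ.+ k) N s + z * u k (PP k) N s) + y * D (1 ℕ.+ k) (PP 0) N s)
      + (y * u k (E k (PP 0)) N s + x * (u k (PP k) N s + y * u k (D k (PP 0)) N s))
      ≈⟨ solve 8 (λ x y z a b d e f → ((a :+ z :* b) :+ y :* d) :+ (y :* e :+ x :* (b :+ y :* f))
           := (a :+ y :* (d :+ (e :+ x :* f))) :+ (z :+ x) :* b) refl _ _ _ _ _ _ _ _ ⟩
    (PP (2 ℕ.+ k) N s + y * (D (1 ℕ.+ k) (PP 0) N s + (u k (E k (PP 0)) N s + x * u k (D k (PP 0)) N s)))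
      + (z + x) * u k (PP k) N s
      ≈⟨ trans (+-congˡ (trans (*-congʳ z+x) (zeroˡ _))) (+-identityʳ _) ⟩
    PP (2 ℕ.+ k) N s + y * (D (1 ℕ.+ k) (PP 0) N s + (u k (E k (PP 0)) N s + x * u k (D k (PP 0)) N s))
      ≈⟨ +-congˡ (*-congˡ (+-congˡ (axpy (linear-u k) x _ _ N s))) ⟨
    PP (2 ℕ.+ k) N s + y * D (2 ℕ.+ k) (PP 0) N s ∎

  -- At length `N + 1` the term `u k (f k)` involves `f k` only at length `N`. An induction on the
  -- length around the descent on the flag thus determines the solution.
  unique-solution : (f g b : ℕ → M) → f 0 ≋ f 1 → g 0 ≋ g 1 → f (1 ℕ.+ m) ≋ g (1 ℕ.+ m) →
    (∀ k → k < m → f (1 ℕ.+ k) ≋ f (2 ℕ.+ k) ⊞ (z ⊡ u k (f k) ⊞ b k)) →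
    (∀ k → k < m → g (1 ℕ.+ k) ≋ g (2 ℕ.+ k) ⊞ (z ⊡ u k (g k) ⊞ b k)) →
    ∀ p → p ≤ 1 ℕ.+ m → f p ≋ g p
  unique-solution f g b f₀ g₀ top f-step g-step p p≤ N s = go N s p p≤
    where
    go : ∀ N s p → p ≤ 1 ℕ.+ m → f p N s ≈ g p N s
    uf : ∀ N s k → k < m → u k (f k) N s ≈ u k (g k) N s
    go N s = descend (λ p → f p N s ≈ g p N s) m (top N s)
      (λ k k<m eq → trans (f-step k k<m N s)
        (trans (+-cong eq (+-congʳ (*-congˡ (uf N s k k<m)))) (sym (g-step k k<m N s))))
      (λ eq → trans (f₀ N s) (trans eq (sym (g₀ N s))))
    uf zero    s k k<m = refl
    uf (suc N) s k k<m = *-congˡ (go N (inc k s) k (ℕ.m≤n⇒m≤1+n (ℕ.<⇒≤ k<m)))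

  -- A flagged Jacobi–Trudi formula: G p r is PP 0 times
  -- (x E p (x) E r (y) - y E p (y) E r (x)) / (x - y), the product of chain series
  -- that makes up for the flags p and r.
  G : ℕ → ℕ → M
  G p r = A p (E r (PP 0)) ⊞ w ⊡ E p (D r (PP 0))

  G-top-step : ∀ k → k < m →
    G (1 ℕ.+ k) (1 ℕ.+ m) ≋ G (2 ℕ.+ k) (1 ℕ.+ m) ⊞ (z ⊡ u k (G k (1 ℕ.+ m)) ⊞ w ⊡ u k (H k))
  G-top-step k k<m N s = sym (begin
    (A (2 ℕ.+ k) e N s + w * E (2 ℕ.+ k) d N s) + (z * u k (G k (1 ℕ.+ m)) N s + w * H′)
      ≈⟨ +-cong (+-congʳ (A-step k e N s)) (+-congʳ (*-congˡ (axpy (linear-u k) w _ _ N s))) ⟩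
    ((A (1 ℕ.+ k) e N s + (y * e′ + x * a′)) + w * (E (1 ℕ.+ k) d N s + y * d′))
      + (z * (a′ + w * d′) + w * H′)
      ≈⟨ solve 10 (λ x y z w A E a e d H →
           ((A :+ (y :* e :+ x :* a)) :+ w :* (E :+ y :* d)) :+ (z :* (a :+ w :* d) :+ w :* H)
           := (A :+ w :* E) :+ ((y :* e :+ (z :+ x) :* a :+ (z :* w) :* d) :+ w :* (H :+ y :* d)))
         refl _ _ _ _ _ _ _ _ _ _ ⟩
    (A (1 ℕ.+ k) e N s + w * E (1 ℕ.+ k) d N s)
      + ((y * e′ + (z + x) * a′ + (z * w) * d′) + w * (H′ + y * d′))
      ≈⟨ +-congˡ (+-congˡ (*-congˡ H′-eq)) ⟩
    (A (1 ℕ.+ k) e N s + w * E (1 ℕ.+ k) d N s)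
      + ((y * e′ + (z + x) * a′ + (z * w) * d′) + w * (e′ + x * d′))
      ≈⟨ +-congˡ (solve 7 (λ x y z w a e d →
           (y :* e :+ (z :+ x) :* a :+ (z :* w) :* d) :+ w :* (e :+ x :* d)
           := (w :+ y) :* e :+ (z :+ x) :* (a :+ w :* d)) refl _ _ _ _ _ _ _) ⟩
    (A (1 ℕ.+ k) e N s + w * E (1 ℕ.+ k) d N s) + ((w + y) * e′ + (z + x) * (a′ + w * d′))
      ≈⟨ trans (+-congˡ (trans (+-cong (trans (*-congʳ w+y) (zeroˡ _)) (trans (*-congʳ z+x) (zeroˡ _)))
                              (+-identityˡ 0#))) (+-identityʳ _) ⟩
    G (1 ℕ.+ k) (1 ℕ.+ m) N s ∎)
    where
    e = E (1 ℕ.+ m) (PP 0)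
    d = D (1 ℕ.+ m) (PP 0)
    e′ = u k (E k e) N s
    d′ = u k (E k d) N s
    a′ = u k (A k e) N s
    H′ = u k (H k) N s
    -- At the flag `1 + m` the chain series in `x` strips the `z`-weighted column from `PP 0` and
    -- leaves `H 0`, the source of the inhomogeneous term.
    H′-eq : H′ + y * d′ ≈ e′ + x * d′
    H′-eq = begin
      H′ + y * d′ ≈⟨ +-congʳ (cong (linear-u k) (H≋E k (ℕ.m≤n⇒m≤1+n (ℕ.<⇒≤ k<m))) N s) ⟩
      u k (E k (H 0)) N s + y * d′ ≈⟨ axpy (linear-uE k) y _ _ N s ⟨
      u k (E k (H 0 ⊞ y ⊡ d)) N s
        ≈⟨ cong (linear-uE k) (V.trans (A-PP (1 ℕ.+ m) ℕ.≤-refl) (⊞-cong PP-end V.refl)) N s ⟨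
      u k (E k (e ⊞ x ⊡ d)) N s ≈⟨ axpy (linear-uE k) x _ _ N s ⟩
      e′ + x * d′ ∎

  G-top-end : G (1 ℕ.+ m) (1 ℕ.+ m) ≋ 𝟏
  G-top-end N s = begin
    (E μ e N s + x * D μ e N s) + w * E μ d N s
      ≈⟨ +-congʳ (+-congˡ (*-congˡ (commute μ (PP 0) N s))) ⟩
    (E μ e N s + x * E μ d N s) + w * E μ d N s
      ≈⟨ +-congʳ (axpy (linear-E μ) x _ _ N s) ⟨
    E μ (e ⊞ x ⊡ d) N s + w * E μ d N s
      ≈⟨ +-congʳ (cong (linear-E μ) (V.trans (A-PP μ ℕ.≤-refl) (⊞-cong PP-end V.refl)) N s) ⟩
    E μ (H 0 ⊞ y ⊡ d) N s + w * E μ d N s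
      ≈⟨ +-congʳ (axpy (linear-E μ) y _ _ N s) ⟩
    (E μ (H 0) N s + y * E μ d N s) + w * E μ d N s
      ≈⟨ solve 4 (λ w y a b → (a :+ y :* b) :+ w :* b := a :+ (w :+ y) :* b) refl _ _ _ _ ⟩
    E μ (H 0) N s + (w + y) * E μ d N s
      ≈⟨ trans (+-congˡ (trans (*-congʳ w+y) (zeroˡ _))) (+-identityʳ _) ⟩
    E μ (H 0) N s
      ≈⟨ trans (sym (H≋E μ ℕ.≤-refl N s)) (H-end N s) ⟩
    𝟏 N s ∎
    where
    μ = 1 ℕ.+ m
    e = E μ (PP 0)
    d = D μ (PP 0)

  -- With the flag `1 + m` the second column is empty, and single columns weighted by `h` remain.
  -- Series with the flags `p` and `1 + m` need not commute, so no factors of `G` are cancelled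
  -- directly. Both sides are compared through their recursion in `p`, and commutation is used only
  -- at `p = 1 + m`.
  G-top : ∀ p → p ≤ 1 ℕ.+ m → G p (1 ℕ.+ m) ≋ Y p
  G-top = unique-solution (λ p → G p (1 ℕ.+ m)) Y (λ k → w ⊡ u k (H k)) V.refl Y-0
    (V.trans G-top-end (V.sym Y-end)) G-top-step (λ _ → Y-step)

  D-telescope : ∀ v n p → p ≤ 1 ℕ.+ n → D p v ⊞ ⨁ (letters n p) (λ a → u a (A a v)) ≋ D (1 ℕ.+ n) v
  D-telescope v n p p≤ N s = descend
    (λ p → D p v N s + ∑ˡ (letters n p) (λ a → u a (A a v) N s) ≈ D (1 ℕ.+ n) v N s) n
    (trans (+-congˡ (∑-letters-end n _)) (+-identityʳ _))
    (λ k k<n eq → trans (+-congˡ (∑-letters _ k<n)) (trans (sym (+-assoc _ _ _)) eq))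
    (λ eq → eq) p p≤

  E-telescope : ∀ v n p → p ≤ 1 ℕ.+ n → E p v ⊞ y ⊡ ⨁ (letters n p) (λ a → u a (E a v)) ≋ E (1 ℕ.+ n) v
  E-telescope v n p p≤ N s = descend
    (λ p → E p v N s + y * ∑ˡ (letters n p) (λ a → u a (E a v) N s) ≈ E (1 ℕ.+ n) v N s) n
    (trans (+-congˡ (trans (*-congˡ (∑-letters-end n _)) (zeroʳ y))) (+-identityʳ _))
    (λ k k<n eq → trans (+-congˡ (*-congˡ (∑-letters _ k<n)))
      (trans (solve 4 (λ y a b c → a :+ y :* (b :+ c) := (a :+ y :* b) :+ y :* c) refl _ _ _ _) eq))
    (λ eq → eq) p p≤

  D-telescope′ : ∀ v b p → p ≤ b → D p v ⊞ ⨁ (letters (b ∸ 1) p) (λ a → u a (A a v)) ≋ D b v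
  D-telescope′ v zero    zero p≤b N s = +-identityʳ _
  D-telescope′ v (suc b) p    p≤b = D-telescope v b p p≤b

  E-telescope′ : ∀ v b p → p ≤ b → E p v ⊞ y ⊡ ⨁ (letters (b ∸ 1) p) (λ a → u a (E a v)) ≋ E b v
  E-telescope′ v zero    zero p≤b N s = trans (+-congˡ (zeroʳ y)) (+-identityʳ _)
  E-telescope′ v (suc b) p    p≤b = E-telescope v b p p≤b

  -- The increments of `E` and `D` from `1 + b` to `2 + b` carry `u b`, which `p ≤ b` lets pass
  -- `A p` and `E p`. The sums over `a` telescope to `D b` and `E b`; by `commute b` both leave the
  -- same vector, and everything cancels through `w + y = 0`.
  G-step : ∀ p b → p ≤ b → G p (1 ℕ.+ b) ≋
           G p (2 ℕ.+ b) ⊞ (z * w) ⊡ ⨁ (letters (b ∸ 1) p) (λ a → u b (u a (G a b)))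
  G-step p b p≤b N s = sym (begin
    (A p (E (1 ℕ.+ b) P ⊞ y ⊡ u b e) N s + w * E p (D (1 ℕ.+ b) P ⊞ u b (e ⊞ x ⊡ d)) N s)
      + z * w * ⨁ ls (λ a → u b (u a (G a b))) N s
      ≈⟨ +-cong (+-cong (axpy (linear-A p) y _ _ N s)
                        (*-congˡ (⊞-homo (linear-E p) _ _ N s))) (*-cong zw≈xy ⨁-eq) ⟩
    ((A p (E (1 ℕ.+ b) P) N s + y * A p (u b e) N s)
      + w * (E p (D (1 ℕ.+ b) P) N s + E p (u b (e ⊞ x ⊡ d)) N s)) + x * y * u b (Σ₁ ⊞ w ⊡ Σ₂) N s
      ≈⟨ +-congʳ (+-cong (+-congˡ (*-congˡ (sym (u-A p≤b e N s))))
                   (*-congˡ (+-congˡ (trans (sym (u-E p≤b _ N s)) (cong (linear-u b) (axpy (linear-E p) x e d) N s))))) ⟩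
    ((A p (E (1 ℕ.+ b) P) N s + y * u b (A p e) N s)
      + w * (E p (D (1 ℕ.+ b) P) N s + u b (E p e ⊞ x ⊡ E p d) N s)) + x * y * u b (Σ₁ ⊞ w ⊡ Σ₂) N s
      ≈⟨ +-cong (+-cong (+-congˡ (*-congˡ (axpy (linear-u b) x _ _ N s)))
                        (*-congˡ (+-congˡ (axpy (linear-u b) x _ _ N s))))
                (*-congˡ (axpy (linear-u b) w _ _ N s)) ⟩
    ((A p (E (1 ℕ.+ b) P) N s + y * (u b (E p e) N s + x * u b (D p e) N s))
      + w * (E p (D (1 ℕ.+ b) P) N s + (u b (E p e) N s + x * u b (E p d) N s)))
      + x * y * (u b Σ₁ N s + w * u b Σ₂ N s)
      ≈⟨ solve 10 (λ x y w A E e f g S T →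
           ((A :+ y :* (e :+ x :* f)) :+ w :* (E :+ (e :+ x :* g))) :+ x :* y :* (S :+ w :* T)
           := (A :+ w :* E) :+ ((w :+ y) :* e :+ (x :* y :* (f :+ S) :+ x :* w :* (g :+ y :* T))))
         refl _ _ _ _ _ _ _ _ _ _ ⟩
    G p (1 ℕ.+ b) N s + ((w + y) * u b (E p e) N s
      + (x * y * (u b (D p e) N s + u b Σ₁ N s) + x * w * (u b (E p d) N s + y * u b Σ₂ N s)))
      ≈⟨ +-congˡ (+-congˡ (+-cong
           (*-congˡ (trans (sym (⊞-homo (linear-u b) _ _ N s)) (cong (linear-u b) (V.trans (D-telescope′ e b p p≤b) (commute b P)) N s)))
           (*-congˡ (trans (sym (axpy (linear-u b) y _ _ N s)) (cong (linear-u b) (E-telescope′ d b p p≤b) N s))))) ⟩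
    G p (1 ℕ.+ b) N s + ((w + y) * u b (E p e) N s
      + (x * y * u b (E b d) N s + x * w * u b (E b d) N s))
      ≈⟨ +-congˡ (solve 5 (λ x y w a b → (w :+ y) :* a :+ (x :* y :* b :+ x :* w :* b)
           := (w :+ y) :* (a :+ x :* b)) refl _ _ _ _ _) ⟩
    G p (1 ℕ.+ b) N s + (w + y) * (u b (E p e) N s + x * u b (E b d) N s)
      ≈⟨ trans (+-congˡ (trans (*-congʳ w+y) (zeroˡ _))) (+-identityʳ _) ⟩
    G p (1 ℕ.+ b) N s ∎)
    where
    P = PP 0
    e = E b P
    d = D b P
    ls = letters (b ∸ 1) p
    Σ₁ = ⨁ ls (λ a → u a (A a e))
    Σ₂ = ⨁ ls (λ a → u a (E a d))
    ⨁-eq : ⨁ ls (λ a → u b (u a (G a b))) N s ≈ u b (Σ₁ ⊞ w ⊡ Σ₂) N s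
    ⨁-eq = trans (sym (u-⨁ b ls (λ a → u a (G a b)) N s)) (cong (linear-u b) (λ N s →
      trans (∑-cong ls λ {a} _ → axpy (linear-u a) w _ _ N s)
        (trans (∑-+ ls _ _) (+-congˡ (∑-* w ls _)))) N s)

  G-rec : ∀ p r → r ≤ 1 ℕ.+ m → p ≤ r ∸ 1 → G p r ≋ G p (1 ℕ.+ m) ⊞
          (z * w) ⊡ ⨁ (letters m r) (λ b → ⨁ (letters (b ∸ 1) p) (λ a → u b (u a (G a b))))
  G-rec p r r≤ p≤ N s = descend
    (λ r → p ≤ r ∸ 1 → G p r N s ≈ G p (1 ℕ.+ m) N s + z * w * ∑ˡ (letters m r) (λ b → f b N s)) m
    (λ _ → sym (trans (+-congˡ (trans (*-congˡ (∑-letters-end m _)) (zeroʳ _))) (+-identityʳ _)))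
    (λ k k<m eq p≤k → trans (G-step p k p≤k N s) (trans (+-congʳ (eq (ℕ.m≤n⇒m≤1+n p≤k)))
      (trans (solve 4 (λ a b c d → (a :+ b :* c) :+ b :* d := a :+ b :* (d :+ c)) refl _ _ _ _)
             (+-congˡ (*-congˡ (sym (∑-letters _ k<m)))))))
    (λ eq → eq) r r≤ p≤
    where
    f : ℕ → M
    f b = ⨁ (letters (b ∸ 1) p) (λ a → u b (u a (G a b)))

  -- `p ≤ r ∸ 1` is what `G-rec` requires. It holds at `0`, `0`, and the gap within the removed row
  -- `a`, `b` passes it on as `a ≤ b ∸ 1`; each removal lowers `N` by 2.
  Z≈G : ∀ p r N s → r ≤ 1 ℕ.+ m → p ≤ r ∸ 1 → Z p r N s ≈ G p r N s
  Z≈G p r N s r≤ p≤ = trans (lemma N s) (sym (trans (G-rec p r r≤ p≤ N s) (+-congʳ (G-top p p≤μ N s))))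
    where
    p≤μ : p ≤ 1 ℕ.+ m
    p≤μ = ℕ.≤-trans p≤ (ℕ.≤-trans (ℕ.m∸n≤m r 1) r≤)
    f : ℕ → M
    f b = ⨁ (letters (b ∸ 1) p) (λ a → u b (u a (G a b)))
    lemma : ∀ N s → Z p r N s ≈ Y p N s + z * w * ∑ˡ (letters m r) (λ b → f b N s)
    lemma zero s = sym (trans (+-congˡ (trans (*-congˡ (∑-zero (letters m r) λ _ →
      ∑-zero (letters _ p) λ _ → refl)) (zeroʳ _))) (+-identityʳ _))
    lemma (suc zero) s = sym (trans (+-congˡ (trans (*-congˡ (∑-zero (letters m r) λ _ →
      ∑-zero (letters _ p) λ _ → zeroʳ _)) (zeroʳ _))) (+-identityʳ _))
    lemma (suc (suc N)) s = +-congˡ (*-congˡ (∑-cong (letters m r) λ {b} b∈ →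
      ∑-cong (letters (b ∸ 1) p) λ {a} a∈ → *-congˡ (*-congˡ
        (Z≈G a b N (inc a (inc b s)) (ℕ.m≤n⇒m≤1+n (ℕ.<⇒≤ (proj₂ (∈-letters⁻ m r b∈))))
             (ℕ.<⇒≤ (proj₂ (∈-letters⁻ (b ∸ 1) p a∈)))))))

  Z≈PP : ∀ N s → Z 0 0 N s ≈ PP 0 N s
  Z≈PP N s = trans (Z≈G 0 0 N s z≤n z≤n)
    (trans (+-cong (trans (+-congˡ (zeroʳ x)) (+-identityʳ _)) (zeroʳ w)) (+-identityʳ _))

-- The vectors as sums over the enumerations

module Evaluation {c ℓ} (R : CommutativeRing c ℓ) (τ : CommutativeRing.Carrier R)
                  (κ : ℕ → CommutativeRing.Carrier R) (m : ℕ) (z w : CommutativeRing.Carrier R) where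

  open CommutativeRing R hiding (zero)
  open Sums R
  open Appending R τ κ using (factor)
  open Columns R τ κ m z w
  open import Algebra.Properties.Semiring.Exp semiring using (_^_)
  open import Algebra.Solver.Ring.NaturalCoefficients.Default commutativeSemiring
    using (solve; _:+_; _:*_; _:=_)
  open import Relation.Binary.Reasoning.Setoid setoid

  weight : Seq → List ℕ → Carrier
  weight []      s = 1#
  weight (a ∷ r) s = factor a s * weight r (inc a s)

  -- The Schur function of the conjugate shape read row by row: each of the `d` rows of length 2
  -- gives `z * w`, and the `k` single cells give `h k`.
  ω : Tableau ℕ → Carrier
  ω ((a ∷ b ∷ []) ∷ P) = z * w * ω P
  ω P                  = h (length P)

  ω-column : (r : Seq) → ω (map [_] r) ≡ h (length r)
  ω-column []          = ≡.refl
  ω-column (a ∷ [])    = ≡.refl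
  ω-column (a ∷ b ∷ r) = ≡.cong h (≡.cong (suc ∘ suc) (length-map [_] r))

  ∑-columns : ∀ p N s → ∑ˡ (columns m p N) (λ r → weight r s) ≈ S p N s
  ∑-columns p zero    s = +-identityʳ 1#
  ∑-columns p (suc N) s = trans (∑-bind _ (letters m p) _) (∑-cong (letters m p) λ {a} _ →
    trans (reflexive (∑-map (a ∷_) (columns m a N) _))
      (trans (∑-* (factor a s) (columns m a N) _) (*-congˡ (∑-columns a N (inc a s)))))

  ∑-columns-* : ∀ p N s (f : ℕ → Carrier) → ∑ˡ (columns m p N) (λ r → f (length r) * weight r s) ≈ f N * S p N s
  ∑-columns-* p N s f = trans (∑-cong (columns m p N) λ r∈ →
      *-congʳ (reflexive (≡.cong f (proj₂ (∈-columns⁻ p N r∈)))))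
    (trans (∑-* (f N) (columns m p N) _) (*-congˡ (∑-columns p N s)))

  pairWeight : List ℕ → Seq × Seq → Carrier
  pairWeight s (x , y) = z ^ length x * w ^ length y * weight (x ++ y) s

  ∑-pairs : ∀ p N s → ∑ˡ (pairs m p N) (pairWeight s) ≈ PP p N s
  ∑-pairs p zero    s = trans (+-identityʳ _) (trans (*-identityʳ _) (*-identityˡ 1#))
  ∑-pairs p (suc N) s = begin
    ∑ˡ (pairs m p (suc N)) (pairWeight s)
      ≈⟨ ∑-++ (map ([] ,_) (columns m 0 (suc N))) _ (pairWeight s) ⟩
    ∑ˡ (map ([] ,_) (columns m 0 (suc N))) (pairWeight s)
      + ∑ˡ (concatMap (λ a → map (extend a) (pairs m a N)) (letters m p)) (pairWeight s)
      ≈⟨ +-cong (reflexive (∑-map ([] ,_) (columns m 0 (suc N)) (pairWeight s)))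
                (∑-bind _ (letters m p) (pairWeight s)) ⟩
    ∑ˡ (columns m 0 (suc N)) (λ y → 1# * w ^ length y * weight y s)
      + ∑ˡ (letters m p) (λ a → ∑ˡ (map (extend a) (pairs m a N)) (pairWeight s))
      ≈⟨ +-cong (trans (∑-cong (columns m 0 (suc N)) λ _ → *-congʳ (*-identityˡ _)) (∑-columns-* 0 (suc N) s (w ^_)))
                (trans (∑-cong (letters m p) λ {a} _ → prepend a) (∑-* z (letters m p) _)) ⟩
    PP p (suc N) s ∎
    where
    prepend : ∀ a → ∑ˡ (map (extend a) (pairs m a N)) (pairWeight s) ≈ z * (factor a s * PP a N (inc a s))
    prepend a = begin
      ∑ˡ (map (extend a) (pairs m a N)) (pairWeight s)
        ≈⟨ reflexive (∑-map (extend a) (pairs m a N) (pairWeight s)) ⟩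
      ∑ˡ (pairs m a N) (λ v → pairWeight s (extend a v))
        ≈⟨ ∑-cong (pairs m a N) (λ _ → solve 5 (λ z i j f e → z :* i :* j :* (f :* e) := z :* f :* (i :* j :* e)) refl _ _ _ _ _) ⟩
      ∑ˡ (pairs m a N) (λ v → z * factor a s * pairWeight (inc a s) v)
        ≈⟨ ∑-* _ (pairs m a N) _ ⟩
      z * factor a s * ∑ˡ (pairs m a N) (pairWeight (inc a s))
        ≈⟨ trans (*-congˡ (∑-pairs a N (inc a s))) (*-assoc _ _ _) ⟩
      z * (factor a s * PP a N (inc a s)) ∎

  tableauWeight : List ℕ → Tableau ℕ → Carrier
  tableauWeight s P = ω P * weight (reversedRR P) s

  ∑-tableaux : ∀ p r N s → ∑ˡ (tableaux m p r N) (tableauWeight s) ≈ Z p r N s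
  ∑-tableaux p r N s = trans (∑-++ (map (map [_]) (columns m p N)) (tableaux-pairs m p r N) (tableauWeight s))
    (trans (+-congʳ single) (rest N s))
    where
    single : ∑ˡ (map (map [_]) (columns m p N)) (tableauWeight s) ≈ Y p N s
    single = trans (reflexive (∑-map (map [_]) (columns m p N) (tableauWeight s)))
      (trans (∑-cong (columns m p N) λ {v} _ →
               reflexive (≡.cong₂ (λ a v → a * weight v s) (ω-column v) (reversedRR-column v)))
             (∑-columns-* p N s h))
    rest : ∀ N s → Y p N s + ∑ˡ (tableaux-pairs m p r N) (tableauWeight s) ≈ Z p r N s
    rest zero          s = +-identityʳ _
    rest (suc zero)    s = +-identityʳ _
    rest (suc (suc N)) s = +-congˡ (begin
      ∑ˡ (tableaux-pairs m p r (suc (suc N))) (tableauWeight s)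
        ≈⟨ ∑-bind _ (letters m r) (tableauWeight s) ⟩
      _ ≈⟨ ∑-cong (letters m r) (λ {b} _ → trans (∑-bind _ (letters (b ∸ 1) p) (tableauWeight s))
             (trans (∑-cong (letters (b ∸ 1) p) λ {a} _ → prepend a b) (∑-* (z * w) (letters (b ∸ 1) p) _))) ⟩
      _ ≈⟨ ∑-* (z * w) (letters m r) _ ⟩
      _ ∎)
      where
      prepend : ∀ a b → ∑ˡ (map ((a ∷ b ∷ []) ∷_) (tableaux m a b N)) (tableauWeight s) ≈
                     z * w * (factor b s * (factor a (inc b s) * Z a b N (inc a (inc b s))))
      prepend a b = begin
        ∑ˡ (map ((a ∷ b ∷ []) ∷_) (tableaux m a b N)) (tableauWeight s)
          ≈⟨ reflexive (∑-map ((a ∷ b ∷ []) ∷_) (tableaux m a b N) (tableauWeight s)) ⟩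
        ∑ˡ (tableaux m a b N) (λ P → tableauWeight s ((a ∷ b ∷ []) ∷ P))
          ≈⟨ ∑-cong (tableaux m a b N) (λ _ → solve 5 (λ zw e f g k → zw :* e :* (f :* (g :* k)) := zw :* f :* g :* (e :* k)) refl _ _ _ _ _) ⟩
        ∑ˡ (tableaux m a b N) (λ P → z * w * factor b s * factor a (inc b s) * tableauWeight (inc a (inc b s)) P)
          ≈⟨ ∑-* _ (tableaux m a b N) _ ⟩
        z * w * factor b s * factor a (inc b s) * ∑ˡ (tableaux m a b N) (tableauWeight (inc a (inc b s)))
          ≈⟨ *-congˡ (∑-tableaux a b N (inc a (inc b s))) ⟩
        z * w * factor b s * factor a (inc b s) * Z a b N (inc a (inc b s))
          ≈⟨ trans (*-assoc _ _ _) (*-assoc _ _ _) ⟩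
        z * w * (factor b s * (factor a (inc b s) * Z a b N (inc a (inc b s)))) ∎

  tableaux≈pairs : ∀ N → ∑ˡ (tableaux m 0 0 N) (tableauWeight []) ≈ ∑ˡ (pairs m 0 N) (pairWeight [])
  tableaux≈pairs N = trans (∑-tableaux 0 0 N []) (trans (Z≈PP N []) (sym (∑-pairs 0 N [])))

-- Schur functions in two variables

module TwoVariables {c ℓ} (R : CommutativeRing c ℓ) (z w : CommutativeRing.Carrier R) where
  open CommutativeRing R hiding (zero)
  open Sums R
  open Polynomials R
  open import Algebra.Solver.Ring.NaturalCoefficients.Default commutativeSemiring
    using (solve; _:+_; _:*_; _:=_)
  open import Relation.Binary.Reasoning.Setoid setoid

  module _ (x : Fin 2 → Carrier) (x₀ : x 0F ≡ z) (x₁ : x 1F ≡ w) where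

    monomial : List (Fin 2) → Carrier
    monomial r = ∏ (map x r)

    monomial-++ : ∀ r r′ → monomial (r ++ r′) ≈ monomial r * monomial r′
    monomial-++ []      r′ = sym (*-identityˡ _)
    monomial-++ (a ∷ r) r′ = trans (*-congˡ (monomial-++ r r′)) (sym (*-assoc _ _ _))

    monomial-replicate : ∀ k a → monomial (replicate k a) ≈ x a ^ k
    monomial-replicate zero    a = refl
    monomial-replicate (suc k) a = *-congˡ (monomial-replicate k a)

    ∑-weakRows : ∀ k → ∑ˡ (weakRows k) monomial ≈ complete z w k
    ∑-weakRows zero    = +-identityʳ 1#
    ∑-weakRows (suc k) = trans (∑-++ (map (0F ∷_) (weakRows k)) _ monomial) (+-cong
      (trans (reflexive (∑-map (0F ∷_) (weakRows k) monomial))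
        (trans (∑-* (x 0F) (weakRows k) monomial) (*-cong (reflexive x₀) (∑-weakRows k))))
      (trans (+-identityʳ _) (trans (monomial-replicate (suc k) 1F) (reflexive (≡.cong (_^ suc k) x₁)))))

    ∑-fillings : ∀ d k → ∑ˡ (fillings d k) (λ T → monomial (concat T)) ≈ (z * w) ^ d * complete z w k
    ∑-fillings (suc d) k = begin
      ∑ˡ (map (twoRows (suc d)) (weakRows k)) (λ T → monomial (concat T))
        ≈⟨ reflexive (∑-map (twoRows (suc d)) (weakRows k) _) ⟩
      ∑ˡ (weakRows k) (λ r → monomial (concat (twoRows (suc d) r)))
        ≈⟨ ∑-cong (weakRows k) (λ {r} _ → value r) ⟩
      ∑ˡ (weakRows k) (λ r → (z * w) ^ suc d * monomial r)
        ≈⟨ trans (∑-* _ (weakRows k) _) (*-congˡ (∑-weakRows k)) ⟩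
      (z * w) ^ suc d * complete z w k ∎
      where
      open import Algebra.Properties.CommutativeSemiring.Exp commutativeSemiring using (^-distrib-*)
      value : ∀ r → monomial (concat (twoRows (suc d) r)) ≈ (z * w) ^ suc d * monomial r
      value r = begin
        monomial ((replicate (suc d) 0F ++ r) ++ replicate (suc d) 1F ++ [])
          ≈⟨ reflexive (≡.cong (λ s → monomial ((replicate (suc d) 0F ++ r) ++ s)) (++-identityʳ _)) ⟩
        monomial ((replicate (suc d) 0F ++ r) ++ replicate (suc d) 1F)
          ≈⟨ trans (monomial-++ (replicate (suc d) 0F ++ r) _) (*-congʳ (monomial-++ (replicate (suc d) 0F) r)) ⟩
        monomial (replicate (suc d) 0F) * monomial r * monomial (replicate (suc d) 1F)
          ≈⟨ *-cong (*-congʳ (trans (monomial-replicate (suc d) 0F) (reflexive (≡.cong (_^ suc d) x₀))))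
                    (trans (monomial-replicate (suc d) 1F) (reflexive (≡.cong (_^ suc d) x₁))) ⟩
        z ^ suc d * monomial r * w ^ suc d
          ≈⟨ solve 3 (λ a b c → a :* b :* c := a :* c :* b) refl _ _ _ ⟩
        z ^ suc d * w ^ suc d * monomial r
          ≈⟨ *-congʳ (^-distrib-* z w (suc d)) ⟨
        (z * w) ^ suc d * monomial r ∎
    ∑-fillings zero (suc k) = begin
      ∑ˡ (map oneRow (weakRows (suc k))) (λ T → monomial (concat T))
        ≈⟨ reflexive (∑-map oneRow (weakRows (suc k)) _) ⟩
      ∑ˡ (weakRows (suc k)) (λ r → monomial (r ++ []))
        ≈⟨ ∑-cong (weakRows (suc k)) (λ {r} _ → reflexive (≡.cong monomial (++-identityʳ r))) ⟩
      ∑ˡ (weakRows (suc k)) monomial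
        ≈⟨ trans (∑-weakRows (suc k)) (sym (*-identityˡ _)) ⟩
      1# * complete z w (suc k) ∎
    ∑-fillings zero zero = trans (+-identityʳ 1#) (sym (*-identityˡ 1#))

    schur-conj : ∀ d k → schur x (conj d k) ≈ (z * w) ^ d * complete z w k
    schur-conj d k = trans
      (∑-set _ (Listing.unique (ssyts 2 (conj d k))) (fillings-unique d k)
        (λ T∈ → ∈-fillings⁺ d k (Listing.sound (ssyts 2 (conj d k)) T∈))
        (λ T∈ → Listing.complete (ssyts 2 (conj d k)) (∈-fillings⁻ d k T∈)))
      (∑-fillings d k)

  schur₂-twoColumnShape : ∀ d k → schur₂ z w (conjugate (twoColumnShape d k)) ≈ (z * w) ^ d * complete z w k
  schur₂-twoColumnShape d k = trans (reflexive (≡.cong (schur₂ z w) (conjugate-twoColumnShape d k)))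
    -- The valuation inside `schur₂` is inferred; only its values at the two letters are used.
    (schur-conj _ ≡.refl ≡.refl d k)

-- Comparison over each skeleton and summation

module Identity {c ℓ} (R : CommutativeRing c ℓ) (q t : CommutativeRing.Carrier R) (n : ℕ) where
  open CommutativeRing R hiding (zero)
  open Sums R
  open Polynomials R
  open TwoVariables R q t
  open import Algebra.Properties.Semiring.Exp semiring using (^-homo-*)
  open import Algebra.Solver.Ring.NaturalCoefficients.Default commutativeSemiring
    using (solve; _:+_; _:*_; _:=_)
  open import Relation.Binary.Reasoning.Setoid setoid

  module ForSkeleton {F : Seq} (s : IsSkeleton (max 0 F) F) where

    m = max 0 F

    -- The weight of `a` against `F` alone; pairs with letters already placed are covered by the
    -- power of `τ = t` in `factor`.
    κ : ℕ → Carrier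
    κ a = q ^ a * t ^ (count a F ℕ.+ count (suc a) F ∸ 1)

    open Evaluation R t κ m q t public

    base : Carrier
    base = q ^ sum F * t ^ dinv F

    weight-exponent : ∀ r c → weight r c ≈ q ^ sum r * t ^ exponent F r c
    weight-exponent []      c = sym (*-identityˡ 1#)
    weight-exponent (a ∷ r) c = begin
      q ^ a * t ^ i * t ^ j * weight r (inc a c)
        ≈⟨ *-congˡ (weight-exponent r (inc a c)) ⟩
      q ^ a * t ^ i * t ^ j * (q ^ sum r * t ^ e)
        ≈⟨ solve 5 (λ a b c d e → a :* b :* c :* (d :* e) := (a :* d) :* (b :* c :* e)) refl _ _ _ _ _ ⟩
      (q ^ a * q ^ sum r) * (t ^ i * t ^ j * t ^ e)
        ≈⟨ *-cong (^-homo-* q a (sum r)) (trans (^-homo-* t (i ℕ.+ j) e) (*-congʳ (^-homo-* t i j))) ⟨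
      q ^ sum (a ∷ r) * t ^ exponent F (a ∷ r) c ∎
      where
      i = count a F ℕ.+ count (suc a) F ∸ 1
      j = below c a ℕ.+ at c a
      e = exponent F r (inc a c)

    ω-schur : ∀ {p r P} → TwoColumn m p r P → ω P ≈ schur₂ q t (conjugate (shape P))
    ω-schur {P = P} tc with d , k , eq ← twoColumn-shape tc =
      trans (go {d = d} {k} tc eq) (sym (trans (reflexive (≡.cong (schur₂ q t ∘ conjugate) eq)) (schur₂-twoColumnShape d k)))
      where
      go : ∀ {p r P d k} → TwoColumn m p r P → shape P ≡ twoColumnShape d k → ω P ≈ (q * t) ^ d * complete q t k
      go {d = suc d} {k} (pair _ _ _ tc) eq = trans (*-congˡ (go {d = d} {k} tc (∷-injectiveʳ eq))) (sym (*-assoc _ _ _))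
      go {d = suc d} (column {w = []} _) ()
      go {d = suc d} (column {w = _ ∷ _} _) ()
      go {d = zero} {zero}  (pair _ _ _ _) ()
      go {d = zero} {suc k} (pair _ _ _ _) ()
      go {d = zero} {k} (column {w = w} _) eq = trans (reflexive (≡.trans (ω-column w) (≡.cong (complete q t) length≡))) (sym (*-identityˡ _))
        where
        length≡ : length w ≡ k
        length≡ = ≡.trans (≡.trans (≡.sym (length-map [_] w)) (≡.sym (length-map length (map [_] w))))
          (≡.trans (≡.cong length eq) (length-replicate k))

    tableau-summand : ∀ {P} → TwoColumn m 0 0 P →
      q ^ area (F ++ RR P) * t ^ (dinv (F ++ RR P) ∸ cells P) * schur₂ q t (conjugate (shape P)) ≈
      base * tableauWeight [] P
    tableau-summand {P} tc = begin
      q ^ area (F ++ RR P) * t ^ (dinv (F ++ RR P) ∸ cells P) * schur₂ q t (conjugate (shape P))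
        ≈⟨ *-cong (reflexive (≡.cong₂ (λ i j → q ^ i * t ^ j) (area-RR s P) (dinv-RR s tc))) (sym (ω-schur tc)) ⟩
      q ^ (sum F ℕ.+ sum r) * t ^ (exponent F r [] ℕ.+ dinv F) * ω P
        ≈⟨ *-congʳ (*-cong (^-homo-* q (sum F) (sum r)) (^-homo-* t (exponent F r []) (dinv F))) ⟩
      q ^ sum F * q ^ sum r * (t ^ exponent F r [] * t ^ dinv F) * ω P
        ≈⟨ solve 5 (λ a b c d e → a :* b :* (c :* d) :* e := a :* d :* (e :* (b :* c))) refl _ _ _ _ _ ⟩
      base * (ω P * (q ^ sum r * t ^ exponent F r []))
        ≈⟨ *-congˡ (*-congˡ (weight-exponent r [])) ⟨
      base * tableauWeight [] P ∎
      where
      r = reversedRR P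

    dyck-summand : ∀ {x y} → Column m 0 x → Column m 0 y →
      q ^ area (join (F , x , y)) * t ^ dinv (join (F , x , y)) ≈ base * pairWeight [] (x , y)
    dyck-summand {x} {y} x-column y-column = begin
      q ^ area (join (F , x , y)) * t ^ dinv (join (F , x , y))
        ≈⟨ reflexive (≡.cong₂ (λ i j → q ^ i * t ^ j) (area-join s x-column y-column) (dinv-join s x-column y-column)) ⟩
      q ^ (sum F ℕ.+ length x ℕ.+ sum r) * t ^ (dinv F ℕ.+ length y ℕ.+ exponent F r [])
        ≈⟨ *-cong (trans (^-homo-* q (sum F ℕ.+ length x) (sum r)) (*-congʳ (^-homo-* q (sum F) (length x))))
                  (trans (^-homo-* t (dinv F ℕ.+ length y) (exponent F r [])) (*-congʳ (^-homo-* t (dinv F) (length y)))) ⟩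
      q ^ sum F * q ^ length x * q ^ sum r * (t ^ dinv F * t ^ length y * t ^ exponent F r [])
        ≈⟨ solve 6 (λ a b c d e f → a :* b :* c :* (d :* e :* f) := a :* d :* (b :* e :* (c :* f))) refl _ _ _ _ _ _ ⟩
      base * (q ^ length x * t ^ length y * (q ^ sum r * t ^ exponent F r []))
        ≈⟨ *-congˡ (*-congˡ (weight-exponent r [])) ⟨
      base * pairWeight [] (x , y) ∎
      where
      r = x ++ y

    -- Every summand on either side contains the factor `base` of `F`; once it is taken out,
    -- `tableaux≈pairs` applies with `z = q` and `w = t`.
    fibers : ∀ N → ∑ˡ (map (F ,_) (pairs m 0 N)) (λ v → q ^ area (join v) * t ^ dinv (join v)) ≈
             ∑ˡ (map (F ,_) (tableaux m 0 0 N)) (λ (F , P) →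
               q ^ area (F ++ RR P) * t ^ (dinv (F ++ RR P) ∸ cells P) * schur₂ q t (conjugate (shape P)))
    fibers N = begin
      ∑ˡ (map (F ,_) (pairs m 0 N)) (λ v → q ^ area (join v) * t ^ dinv (join v))
        ≈⟨ reflexive (∑-map (F ,_) (pairs m 0 N) _) ⟩
      _ ≈⟨ ∑-cong (pairs m 0 N) (λ v∈ → let c , d , _ = ∈-pairs⁻ 0 N v∈ in dyck-summand c d) ⟩
      ∑ˡ (pairs m 0 N) (λ v → base * pairWeight [] v)
        ≈⟨ ∑-* base (pairs m 0 N) _ ⟩
      base * ∑ˡ (pairs m 0 N) (pairWeight [])
        ≈⟨ *-congˡ (tableaux≈pairs N) ⟨
      base * ∑ˡ (tableaux m 0 0 N) (tableauWeight [])
        ≈⟨ ∑-* base (tableaux m 0 0 N) _ ⟨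
      ∑ˡ (tableaux m 0 0 N) (λ P → base * tableauWeight [] P)
        ≈⟨ ∑-cong (tableaux m 0 0 N) (λ P∈ → tableau-summand (proj₁ (∈-tableaux⁻ 0 0 N P∈))) ⟨
      _ ≈⟨ reflexive (∑-map (F ,_) (tableaux m 0 0 N) _) ⟨
      ∑ˡ (map (F ,_) (tableaux m 0 0 N)) (λ (F , P) →
        q ^ area (F ++ RR P) * t ^ (dinv (F ++ RR P) ∸ cells P) * schur₂ q t (conjugate (shape P))) ∎

  dyckData : List (Seq × (Seq × Seq))
  dyckData = overSkeletons n (λ m → pairs m 0)

  indexData : List (Seq × Tableau ℕ)
  indexData = overSkeletons n (λ m → tableaux m 0 0)

  ∑-dycks : (f : Seq → Carrier) → ∑ (dycks n) f ≈ ∑ˡ dyckData (f ∘ join)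
  ∑-dycks f = trans (∑-set f (Listing.unique (dycks n)) (map-unique data-unique injective) hasData ofData)
                    (reflexive (∑-map join dyckData f))
    where
    data-unique : Unique dyckData
    data-unique = overSkeletons-unique n (λ m → pairs m 0) λ m N → pairs-unique m 0 N
    injective : ∀ {v v′} → v ∈ dyckData → v′ ∈ dyckData → join v ≡ join v′ → v ≡ v′
    injective {F , _} {F′ , _} v∈ v′∈ eq
      with (s , _) , w∈ ← ∈-overSkeletons⁻ n (λ m → pairs m 0) v∈
         | (s′ , _) , w′∈ ← ∈-overSkeletons⁻ n (λ m → pairs m 0) v′∈
      with c , d , _ ← ∈-pairs⁻ 0 (n ∸ length F) w∈ | c′ , d′ , _ ← ∈-pairs⁻ 0 (n ∸ length F′) w′∈
      = join-injective s c d s′ c′ d′ eq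
    hasData : ∀ {D} → D ∈ Listing.list (dycks n) → D ∈ map join dyckData
    hasData D∈ with D-dyck , D≡n ← Listing.sound (dycks n) D∈
      with F , x , y , s , c , d , ≡.refl ← join-surjective D-dyck
      with size ← ≡.trans (≡.sym (join-length s c d)) D≡n
      = ∈-map⁺ join (∈-overSkeletons⁺ n (λ m → pairs m 0) (s , ℕ.m+n≤o⇒m≤o (length F) (ℕ.≤-reflexive size))
          (≡.subst (λ N → (x , y) ∈ pairs (max 0 F) 0 N)
            (≡.trans (≡.sym (ℕ.m+n∸m≡n (length F) _)) (≡.cong (_∸ length F) size)) (∈-pairs⁺ c d)))
    ofData : ∀ {D} → D ∈ map join dyckData → D ∈ Listing.list (dycks n)
    ofData D∈ with (F , x , y) , v∈ , ≡.refl ← ∈-map⁻ join D∈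
      with (s , F≤n) , w∈ ← ∈-overSkeletons⁻ n (λ m → pairs m 0) v∈
      with c , d , size ← ∈-pairs⁻ 0 (n ∸ length F) w∈
      = Listing.complete (dycks n) (join-dyck s c d ,
          ≡.trans (join-length s c d) (≡.trans (≡.cong (length F ℕ.+_) size) (ℕ.m+[n∸m]≡n F≤n)))

  ∑-indices : (f : Seq × Tableau ℕ → Carrier) → ∑ (indices n) f ≈ ∑ˡ indexData f
  ∑-indices f = ∑-set f (Listing.unique (indices n))
    (overSkeletons-unique n (λ m → tableaux m 0 0) λ m N → tableaux-unique m 0 0 N)
    (λ {(F , P)} v∈ → let s , t , eq = index⁻ (Listing.sound (indices n) v∈) in
      ∈-overSkeletons⁺ n (λ m → tableaux m 0 0) s
        (≡.subst (λ N → P ∈ tableaux (max 0 F) 0 0 N) eq (∈-tableaux⁺ t)))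
    (λ {(F , P)} v∈ → let s , P∈ = ∈-overSkeletons⁻ n (λ m → tableaux m 0 0) v∈
                          t , eq = ∈-tableaux⁻ 0 0 (n ∸ length F) P∈
                      in Listing.complete (indices n) (index⁺ s t eq))

  identity : C n q t ≈ ∑ (indices n) (λ (F , P) →
    q ^ area (F ++ RR P) * t ^ (dinv (F ++ RR P) ∸ cells P) * schur₂ q t (conjugate (shape P)))
  identity = begin
    C n q t
      ≈⟨ trans (∑-dycks _) (∑-bind _ (Listing.list (skeletons n)) _) ⟩
    _ ≈⟨ ∑-cong (Listing.list (skeletons n)) (λ {F} F∈ →
           ForSkeleton.fibers (proj₁ (Listing.sound (skeletons n) F∈)) (n ∸ length F)) ⟩
    _ ≈⟨ trans (∑-indices _) (∑-bind _ (Listing.list (skeletons n)) _) ⟨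
    ∑ (indices n) (λ (F , P) →
      q ^ area (F ++ RR P) * t ^ (dinv (F ++ RR P) ∸ cells P) * schur₂ q t (conjugate (shape P))) ∎

theorem4p20 : ∀ {c ℓ} (R : CommutativeRing c ℓ) →
    let open CommutativeRing R
        open Polynomials R
    in (q t : Carrier) (n : ℕ) → n ≥ 1 →
       C n q t ≈
       ∑ (indices n) (λ (F , P) →
         q ^ area (F ++ RR P) * t ^ (dinv (F ++ RR P) ∸ cells P)
           * schur₂ q t (conjugate (shape P)))
theorem4p20 R q t n _ = Identity.identity R q t n
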